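{- Let $m\ge 0$. Let $A_1$ be a non-symmetric homogeneous $m$-quasiinvariant of degree $3m+1$ of the form $A_1=\sum_{0\le i\le j\le m}C_{[i,j]}x_1^{3m+1-i-j}m_{[i,j]}(x_2,x_3)$, and let $A_2$ be a non-symmetric homogeneous $m$-quasiinvariant of degree $3m+2$ of the form $A_2=\sum_{0\le i\le j\le m}\tilde C_{[i,j]}x_1^{3m+2-i-j}m_{[i,j]}(x_2,x_3)$, such that for each $r\in\{1,2\}$: $s_{23}(A_r)=A_r$, and the images of $A_r$ and $s_{12}(A_r)$ in $QI_m/\langle e_1,e_2,e_3\rangle$ are linearly independent and linearly independent of the image of $\Delta(x)^{2m+1}$. Then the images of \[ \{1,\ A_1,\ s_{12}(A_1),\ A_2,\ s_{12}(A_2),\ \Delta(x)^{2m+1}\} \] form a basis of the $\mathbb{Q}$-vector space $QI_m/\langle e_1,e_2,e_3\rangle$.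
   Context: $s_{ij}$ denotes the transposition exchanging $x_i$ and $x_j$, acting on $\mathbb{Q}[x_1,x_2,x_3]$ by permuting variables. For an integer $m\ge0$, $P$ is $m$-quasiinvariant if $(x_i-x_j)^{2m+1}$ divides $P-s_{ij}P$ for all $1\le i<j\le 3$; these form a ring $QI_m$. $e_1,e_2,e_3$ are the elementary symmetric polynomials in $x_1,x_2,x_3$, and $QI_m/\langle e_1,e_2,e_3\rangle$ is the quotient of $QI_m$ by the ideal of $QI_m$ generated by $e_1,e_2,e_3$. $\Delta(x)=(x_1-x_2)(x_1-x_3)(x_2-x_3)$. For $i\ne j$, $m_{[i,j]}(x_2,x_3)=x_2^ix_3^j+x_2^jx_3^i$, and $m_{[i,i]}(x_2,x_3)=x_2^ix_3^i$. -}

module Defs where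

-- Polynomials in ℚ[x₁,x₂,x₃], represented as finite lists of terms
-- (coefficient , (a , b , c)) standing for  coefficient · x₁^a x₂^b x₃^c.
-- Two polynomials are equal (≈) iff all their coefficients agree.

open import Data.Nat as ℕ using (ℕ; zero; suc; _∸_)
open import Data.Nat.Properties using (_≟_)
open import Data.Rational as ℚ using (ℚ; 0ℚ; 1ℚ)
open import Data.Product using (_×_; _,_; ∃; Σ)
open import Data.List using (List; []; _∷_; _++_; map; concatMap; upTo; foldr)
open import Data.Fin using (Fin; zero; suc)
open import Relation.Binary.PropositionalEquality using (_≡_; _≢_)
open import Relation.Nullary using (¬_; yes; no)
open import Relation.Nullary.Decidable using (⌊_⌋)
open import Data.Bool using (Bool; true; false; _∧_; if_then_else_)

Exp : Set
Exp = ℕ × ℕ × ℕ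

Poly : Set
Poly = List (ℚ × Exp)

infix 4 _≈_
infixl 6 _⊕_ _⊖_
infixl 7 _⊗_ _·_
infixr 8 _^_
infix 4 _∣P_

eqExp : Exp → Exp → Bool
eqExp (a , b , c) (a' , b' , c') = ⌊ a ≟ a' ⌋ ∧ ⌊ b ≟ b' ⌋ ∧ ⌊ c ≟ c' ⌋

coeff : Poly → Exp → ℚ
coeff [] e = 0ℚ
coeff ((q , e') ∷ P) e = if eqExp e' e then q ℚ.+ coeff P e else coeff P e

_≈_ : Poly → Poly → Set
P ≈ Q = ∀ e → coeff P e ≡ coeff Q e

mono : ℚ → ℕ → ℕ → ℕ → Poly
mono q a b c = (q , a , b , c) ∷ []

zeroP oneP x₁ x₂ x₃ : Poly
zeroP = []
oneP = mono 1ℚ 0 0 0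
x₁ = mono 1ℚ 1 0 0
x₂ = mono 1ℚ 0 1 0
x₃ = mono 1ℚ 0 0 1

_⊕_ : Poly → Poly → Poly
P ⊕ Q = P ++ Q

_·_ : ℚ → Poly → Poly
q · P = map (λ { (r , e) → (q ℚ.* r , e) }) P

_⊖_ : Poly → Poly → Poly
P ⊖ Q = P ⊕ (ℚ.- 1ℚ) · Q

addExp : Exp → Exp → Exp
addExp (a , b , c) (a' , b' , c') = (a ℕ.+ a' , b ℕ.+ b' , c ℕ.+ c')

_⊗_ : Poly → Poly → Poly
P ⊗ Q = concatMap (λ { (q , e) → map (λ { (r , f) → (q ℚ.* r , addExp e f) }) Q }) P

_^_ : Poly → ℕ → Poly
P ^ zero = oneP
P ^ suc n = P ⊗ (P ^ n)

s₁₂ s₁₃ s₂₃ : Poly → Poly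
s₁₂ = map (λ { (q , a , b , c) → (q , b , a , c) })
s₁₃ = map (λ { (q , a , b , c) → (q , c , b , a) })
s₂₃ = map (λ { (q , a , b , c) → (q , a , c , b) })

_∣P_ : Poly → Poly → Set
D ∣P P = ∃ λ Q → P ≈ D ⊗ Q

QI : ℕ → Poly → Set
QI m P = ((x₁ ⊖ x₂) ^ (2 ℕ.* m ℕ.+ 1) ∣P (P ⊖ s₁₂ P))
       × ((x₁ ⊖ x₃) ^ (2 ℕ.* m ℕ.+ 1) ∣P (P ⊖ s₁₃ P))
       × ((x₂ ⊖ x₃) ^ (2 ℕ.* m ℕ.+ 1) ∣P (P ⊖ s₂₃ P))

-- symmetric: invariant under all transpositions (which generate S₃)
Symmetric : Poly → Set
Symmetric P = (s₁₂ P ≈ P) × (s₁₃ P ≈ P) × (s₂₃ P ≈ P)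

Homogeneous : ℕ → Poly → Set
Homogeneous d P = ∀ a b c → coeff P (a , b , c) ≢ 0ℚ → a ℕ.+ b ℕ.+ c ≡ d

e₁ e₂ e₃ : Poly
e₁ = x₁ ⊕ x₂ ⊕ x₃
e₂ = x₁ ⊗ x₂ ⊕ x₁ ⊗ x₃ ⊕ x₂ ⊗ x₃
e₃ = x₁ ⊗ x₂ ⊗ x₃

Δ : Poly
Δ = (x₁ ⊖ x₂) ⊗ (x₁ ⊖ x₃) ⊗ (x₂ ⊖ x₃)

InIdeal : ℕ → Poly → Set
InIdeal m P = Σ Poly λ q₁ → Σ Poly λ q₂ → Σ Poly λ q₃ →
  QI m q₁ × QI m q₂ × QI m q₃ × (P ≈ e₁ ⊗ q₁ ⊕ e₂ ⊗ q₂ ⊕ e₃ ⊗ q₃)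

lincomb : ∀ {k} → (Fin k → ℚ) → (Fin k → Poly) → Poly
lincomb {zero} c v = zeroP
lincomb {suc k} c v = c zero · v zero ⊕ lincomb (λ i → c (suc i)) (λ i → v (suc i))

LinIndepMod : ℕ → ∀ {k} → (Fin k → Poly) → Set
LinIndepMod m {k} v = ∀ (c : Fin k → ℚ) → InIdeal m (lincomb c v) → ∀ i → c i ≡ 0ℚ

SpansMod : ℕ → ∀ {k} → (Fin k → Poly) → Set
SpansMod m {k} v = ∀ P → QI m P → ∃ λ (c : Fin k → ℚ) → InIdeal m (P ⊖ lincomb c v)

-- the images form a basis of the ℚ-vector space QI_m/⟨e₁,e₂,e₃⟩
-- (the vᵢ are assumed to lie in QI_m separately)
BasisMod : ℕ → ∀ {k} → (Fin k → Poly) → Set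
BasisMod m v = LinIndepMod m v × SpansMod m v

sumP : List Poly → Poly
sumP = foldr _⊕_ zeroP

mij : ℕ → ℕ → Poly
mij i j with i ≟ j
... | yes _ = mono 1ℚ 0 i i
... | no _ = mono 1ℚ 0 i j ⊕ mono 1ℚ 0 j i

pairs : ℕ → List (ℕ × ℕ)
pairs m = concatMap (λ j → map (λ i → (i , j)) (upTo (suc j))) (upTo (suc m))

formSum : ℕ → ℕ → (ℕ → ℕ → ℚ) → Poly
formSum m d C = sumP (map (λ { (i , j) → C i j · (mono 1ℚ (d ∸ (i ℕ.+ j)) 0 0 ⊗ mij i j) }) (pairs m))

six : Poly → Poly → ℕ → Fin 6 → Poly
six A₁ A₂ m zero = oneP
six A₁ A₂ m (suc zero) = A₁
six A₁ A₂ m (suc (suc zero)) = s₁₂ A₁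
six A₁ A₂ m (suc (suc (suc zero))) = A₂
six A₁ A₂ m (suc (suc (suc (suc zero)))) = s₁₂ A₂
six A₁ A₂ m (suc (suc (suc (suc (suc zero))))) = Δ ^ (2 ℕ.* m ℕ.+ 1)

three : Poly → ℕ → Fin 3 → Poly
three A m zero = A
three A m (suc zero) = s₁₂ A
three A m (suc (suc zero)) = Δ ^ (2 ℕ.* m ℕ.+ 1)

Hyp : ℕ → ℕ → Poly → Set
Hyp m d A = QI m A × Homogeneous d A × ¬ Symmetric A
          × (∃ λ (C : ℕ → ℕ → ℚ) → A ≈ formSum m d C)
          × (s₂₃ A ≈ A)
          × LinIndepMod m (three A m)

{-# OPTIONS --safe #-}
module Submission where

-- Let k = 2m + 1.  The alternating sum Alt over S₃ of a quasiinvariant is divisible by Δ^k, so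
-- ⟨P,Q⟩ = Alt (P Q) / Δ^k is a pairing on QI_m with symmetric values.  For degree reasons
-- ⟨A₁, s₁₂A₂⟩ is a constant κ.  On the face x₃ = 0 the coefficient of Alt (A₁ s₁₂A₂) at
-- x₁^(2m+1) x₂^(4m+2) is a product of two corner coefficients of A₁ and A₂.  If such a corner
-- coefficient vanished, A_r - s₁₂A_r would have at most 2m terms on that face while being divisible
-- by (x₁ - x₂)^(2m+1); so A_r would vanish there, e₃ would divide A_r in QI_m, and A_r would lie in
-- the ideal, against linear independence.  Hence κ ≠ 0.
-- With κ ≠ 0 the basis {1, A₁, s₁₂A₁, A₂, s₁₂A₂, Δ^k} has, up to scalars, a dual family for the
-- pairing.  Pairing a linear relation modulo the ideal with the dual family shows independence.  A
-- Cramer-type identity expands every quasiinvariant with symmetric coefficients, and a symmetric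
-- polynomial is a constant modulo e₁, e₂, e₃ with symmetric cofactors.

open import Algebra.Bundles using (CommutativeRing)
import Algebra.Morphism.Construct.Composition as Composition
open import Algebra.Morphism.Structures using (module RingMorphisms)
import Algebra.Properties.CommutativeSemiring.Exp
import Algebra.Properties.Group
import Algebra.Properties.Ring
import Algebra.Properties.Semiring.Exp
import Algebra.Solver.Ring
open import Algebra.Solver.Ring.AlmostCommutativeRing using (fromCommutativeRing; _-Raw-AlmostCommutative⟶_)
import Data.Integer as ℤ
open import Data.Maybe using (Maybe; just; nothing)
open import Data.Nat as ℕ using (ℕ; zero; suc)
import Data.Nat.Properties as ℕₚ
open import Data.Product using (_×_; _,_; ∃; Σ; proj₁; proj₂)
open import Data.Rational as ℚ using (ℚ; 0ℚ; 1ℚ)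
import Data.Rational.Properties as ℚₚ
open import Data.Rational.Solver using () renaming (module +-*-Solver to ℚ-Solver)
open import Level using (0ℓ)
open import Relation.Binary.PropositionalEquality as ≡ using (_≡_)
import Relation.Binary.Reasoning.Setoid
open import Relation.Nullary using (yes; no)

-- The six elements follow the regular representation of S₃: 1 is the trivial part, Δ^k is the sign
-- part, and the orbit of each A_r, after subtraction of its average, spans a quotient of the
-- two-dimensional representation. Expanding in two such trace-free orbits is a 2 × 2 linear system.
-- Its determinant is, up to the factor 3, the alternating sum of A₁ s₁₂A₂, whose degree (3m+1) +
-- (3m+2) equals deg Δ^k = 3(2m+1). So the determinant is a constant times Δ^k, Cramer's rule
-- divides out exactly, and the dimension of the quotient is a result and not an input. The monomial
-- x₁^(2m+1) x₂^(4m+2) is an extreme one: for x₃ = 0 the power Δ^k becomes (x₁ x₂ (x₁ - x₂))^k, and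
-- this is its term of lowest degree in x₁. There only one of the six signed images, and only one
-- pair of terms of A₁ and s₁₂A₂, contributes. The S₃ argument uses only a ring with an action and a
-- few properties of the powers of x_i - x_j, so it is carried out over an abstract record. Lists of
-- terms enter only where coefficients are read off.

2ℚ 3ℚ -3ℚ -4ℚ 6ℚ ⅓ ⅙ ⅑ : ℚ
2ℚ = ℤ.+ 2 ℚ./ 1
3ℚ = ℤ.+ 3 ℚ./ 1
-3ℚ = ℚ.- 3ℚ
-4ℚ = ℚ.- (ℤ.+ 4 ℚ./ 1)
6ℚ = ℤ.+ 6 ℚ./ 1
⅓ = ℤ.+ 1 ℚ./ 3
⅙ = ℤ.+ 1 ℚ./ 6
⅑ = ℤ.+ 1 ℚ./ 9

invertible-cancelʳ : ∀ c r r⁻¹ → r ℚ.* r⁻¹ ≡ 1ℚ → c ℚ.* r ≡ 0ℚ → c ≡ 0ℚ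
invertible-cancelʳ c r r⁻¹ p q = ≡.trans (≡.sym (ℚₚ.*-identityʳ c)) (≡.trans (≡.cong (c ℚ.*_) (≡.sym p))
  (≡.trans (≡.sym (ℚₚ.*-assoc c r r⁻¹)) (≡.trans (≡.cong (ℚ._* r⁻¹) q) (ℚₚ.*-zeroˡ r⁻¹))))

-- Rings with an action of S₃

-- D₁₂, D₁₃, D₂₃ stand for the powers (x_i - x_j)^(2m+1).
record S₃Algebra : Set₁ where
  field
    R : CommutativeRing 0ℓ 0ℓ
  open CommutativeRing R public
  open RingMorphisms rawRing rawRing using (IsRingHomomorphism)
  field
    scalars : CommutativeRing.rawRing ℚₚ.+-*-commutativeRing -Raw-AlmostCommutative⟶ fromCommutativeRing R
  open _-Raw-AlmostCommutative⟶_ scalars public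
    using (⟦_⟧) renaming (+-homo to ⟦⟧-+; *-homo to ⟦⟧-*; 0-homo to ⟦⟧-0; 1-homo to ⟦⟧-1; -‿homo to ⟦⟧-neg)
  field
    s₁₂ s₁₃ s₂₃ : Carrier → Carrier
    s₁₂-hom : IsRingHomomorphism s₁₂
    s₁₃-hom : IsRingHomomorphism s₁₃
    s₂₃-hom : IsRingHomomorphism s₂₃
    s₁₂-⟦⟧ : ∀ q → s₁₂ ⟦ q ⟧ ≈ ⟦ q ⟧
    s₁₃-⟦⟧ : ∀ q → s₁₃ ⟦ q ⟧ ≈ ⟦ q ⟧
    s₂₃-⟦⟧ : ∀ q → s₂₃ ⟦ q ⟧ ≈ ⟦ q ⟧
    s₁₂² : ∀ x → s₁₂ (s₁₂ x) ≈ x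
    s₁₃² : ∀ x → s₁₃ (s₁₃ x) ≈ x
    s₂₃² : ∀ x → s₂₃ (s₂₃ x) ≈ x
    s₁₃s₁₂ : ∀ x → s₁₃ (s₁₂ x) ≈ s₁₂ (s₂₃ x)
    s₂₃s₁₃ : ∀ x → s₂₃ (s₁₃ x) ≈ s₁₂ (s₂₃ x)
    s₁₃s₂₃ : ∀ x → s₁₃ (s₂₃ x) ≈ s₁₂ (s₁₃ x)
    s₂₃s₁₂ : ∀ x → s₂₃ (s₁₂ x) ≈ s₁₂ (s₁₃ x)

  infix 4 _∣_
  _∣_ : Carrier → Carrier → Set
  D ∣ P = ∃ λ Q → P ≈ D * Q

  field
    D₁₂ D₁₃ D₂₃ : Carrier
    s₁₂-D₁₂ : s₁₂ D₁₂ ≈ - D₁₂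
    s₁₂-D₁₃ : s₁₂ D₁₃ ≈ D₂₃
    s₁₂-D₂₃ : s₁₂ D₂₃ ≈ D₁₃
    s₂₃-D₁₂ : s₂₃ D₁₂ ≈ D₁₃
    s₂₃-D₁₃ : s₂₃ D₁₃ ≈ D₁₂
    s₂₃-D₂₃ : s₂₃ D₂₃ ≈ - D₂₃

  D : Carrier
  D = D₁₂ * D₁₃ * D₂₃

  field
    x₁ x₂ x₃ : Carrier
    s₁₂-x₁ : s₁₂ x₁ ≈ x₂
    s₁₂-x₂ : s₁₂ x₂ ≈ x₁
    s₁₂-x₃ : s₁₂ x₃ ≈ x₃
    s₂₃-x₁ : s₂₃ x₁ ≈ x₁
    s₂₃-x₂ : s₂₃ x₂ ≈ x₃
    s₂₃-x₃ : s₂₃ x₃ ≈ x₂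
    D-regular : ∀ x → D * x ≈ 0# → x ≈ 0#
    -- The pairwise coprimality of the three powers, and the only form in which unique factorisation
    -- enters.
    D-lcm : ∀ x → D₁₂ ∣ x → D₁₃ ∣ x → D₂₃ ∣ x → D ∣ x

  e₁ : Carrier
  e₁ = x₁ + x₂ + x₃

  e₂ : Carrier
  e₂ = x₁ * x₂ + x₁ * x₃ + x₂ * x₃

  e₃ : Carrier
  e₃ = x₁ * x₂ * x₃

  field
    -- All that the abstract argument keeps of the grading: the e_i have no constant term, so even
    -- the ideal that they generate in the whole ring is proper.
    no-constants : ∀ q h₁ h₂ h₃ → ⟦ q ⟧ ≈ e₁ * h₁ + e₂ * h₂ + e₃ * h₃ → q ≡ 0ℚ

-- Quasiinvariants, alternating sums and division by the product of the D_ij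

module QuasiInvariants (S : S₃Algebra) where
  open S₃Algebra S
  open RingMorphisms rawRing rawRing using (IsRingHomomorphism)
  open Relation.Binary.Reasoning.Setoid setoid
  private
    module H₁₂ = IsRingHomomorphism s₁₂-hom
    module H₁₃ = IsRingHomomorphism s₁₃-hom
    module H₂₃ = IsRingHomomorphism s₂₃-hom

    scalar≟ : (p q : ℚ) → Maybe (⟦ p ⟧ ≈ ⟦ q ⟧)
    scalar≟ p q with p ℚ.≟ q
    ... | yes ≡.refl = just refl
    ... | no _ = nothing

  open Algebra.Solver.Ring (CommutativeRing.rawRing ℚₚ.+-*-commutativeRing) (fromCommutativeRing R) scalars scalar≟
    using (Polynomial; solve; con; _:+_; _:*_; :-_; _:-_; _:^_; _:=_) public

  Symmetric : Carrier → Set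
  Symmetric x = (s₁₂ x ≈ x) × (s₁₃ x ≈ x) × (s₂₃ x ≈ x)

  Antisymmetric : Carrier → Set
  Antisymmetric x = (s₁₂ x ≈ - x) × (s₁₃ x ≈ - x) × (s₂₃ x ≈ - x)

  QI : Carrier → Set
  QI x = (D₁₂ ∣ (x - s₁₂ x)) × (D₁₃ ∣ (x - s₁₃ x)) × (D₂₃ ∣ (x - s₂₃ x))

  x-y≈0⇒x≈y : ∀ {x y} → x - y ≈ 0# → x ≈ y
  x-y≈0⇒x≈y {x} {y} p = begin
    x           ≈⟨ solve 2 (λ x y → x := x :- y :+ y) refl x y ⟩
    x - y + y   ≈⟨ +-congʳ p ⟩
    0# + y      ≈⟨ +-identityˡ y ⟩
    y           ∎

  x≈y⇒x-y≈0 : ∀ {x y} → x ≈ y → x - y ≈ 0#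
  x≈y⇒x-y≈0 {x} {y} p = trans (+-congʳ p) (-‿inverseʳ y)

  D-cancel : ∀ {x y} → D * x ≈ D * y → x ≈ y
  D-cancel {x} {y} p = x-y≈0⇒x≈y (D-regular (x - y) (begin
    D * (x - y)     ≈⟨ solve 3 (λ d x y → d :* (x :- y) := d :* x :- d :* y) refl D x y ⟩
    D * x - D * y   ≈⟨ x≈y⇒x-y≈0 p ⟩
    0#              ∎))

  ∣-resp : ∀ {d x y} → x ≈ y → d ∣ x → d ∣ y
  ∣-resp p (u , q) = u , trans (sym p) q

  ∣-+ : ∀ {d x y} → d ∣ x → d ∣ y → d ∣ (x + y)
  ∣-+ {d} (u , p) (v , q) = u + v , trans (+-cong p q) (sym (distribˡ d u v))

  ∣-*ʳ : ∀ {d x} y → d ∣ x → d ∣ (x * y)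
  ∣-*ʳ {d} y (u , p) = u * y , trans (*-congʳ p) (*-assoc d u y)

  ∣-neg : ∀ {d x} → d ∣ x → d ∣ (- x)
  ∣-neg {d} (u , p) = - u , trans (-‿cong p) (solve 2 (λ d u → :- (d :* u) := d :* (:- u)) refl d u)

  ∣-0 : ∀ {d} → d ∣ 0#
  ∣-0 {d} = 0# , sym (zeroʳ d)

  module Reflection (s : Carrier → Carrier) (s-hom : IsRingHomomorphism s) where
    open IsRingHomomorphism s-hom using (+-homo; *-homo; -‿homo; ⟦⟧-cong)

    s-minus : ∀ x y → s (x - y) ≈ s x - s y
    s-minus x y = trans (+-homo x (- y)) (+-congˡ (-‿homo y))

    s-+₃ : ∀ x y z → s (x + y + z) ≈ s x + s y + s z
    s-+₃ x y z = trans (+-homo (x + y) z) (+-congʳ (+-homo x y))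

    difference-resp : ∀ {d x y} → x ≈ y → d ∣ (x - s x) → d ∣ (y - s y)
    difference-resp p = ∣-resp (+-cong p (-‿cong (⟦⟧-cong p)))

    difference-+ : ∀ {d x y} → d ∣ (x - s x) → d ∣ (y - s y) → d ∣ ((x + y) - s (x + y))
    difference-+ {d} {x} {y} p q = ∣-resp (begin
      x - s x + (y - s y)    ≈⟨ solve 4 (λ x x' y y' → x :- x' :+ (y :- y') := x :+ y :- (x' :+ y')) refl x (s x) y (s y) ⟩
      x + y - (s x + s y)    ≈⟨ +-congˡ (-‿cong (+-homo x y)) ⟨
      x + y - s (x + y)      ∎) (∣-+ p q)

    difference-neg : ∀ {d x} → d ∣ (x - s x) → d ∣ (- x - s (- x))
    difference-neg {d} {x} p = ∣-resp (begin
      - (x - s x)        ≈⟨ solve 2 (λ x x' → :- (x :- x') := :- x :- :- x') refl x (s x) ⟩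
      - x - (- s x)      ≈⟨ +-congˡ (-‿cong (-‿homo x)) ⟨
      - x - s (- x)      ∎) (∣-neg p)

    difference-* : ∀ {d x y} → d ∣ (x - s x) → d ∣ (y - s y) → d ∣ (x * y - s (x * y))
    difference-* {d} {x} {y} p q = ∣-resp (begin
      (x - s x) * y + (y - s y) * s x   ≈⟨ solve 4 (λ x x' y y' → (x :- x') :* y :+ (y :- y') :* x' := x :* y :- x' :* y') refl x (s x) y (s y) ⟩
      x * y - s x * s y                 ≈⟨ +-congˡ (-‿cong (*-homo x y)) ⟨
      x * y - s (x * y)                 ∎) (∣-+ (∣-*ʳ y p) (∣-*ʳ (s x) q))

    difference-invariant : ∀ {d x} → s x ≈ x → d ∣ (x - s x)
    difference-invariant p = ∣-resp (sym (x≈y⇒x-y≈0 (sym p))) ∣-0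

    difference-self : ∀ {d x} → s (s x) ≈ x → d ∣ (x - s x) → d ∣ (s x - s (s x))
    difference-self {d} {x} p q = ∣-resp (begin
      - (x - s x)       ≈⟨ solve 2 (λ x x' → :- (x :- x') := x' :- x) refl x (s x) ⟩
      s x - x           ≈⟨ +-congˡ (-‿cong p) ⟨
      s x - s (s x)     ∎) (∣-neg q)

    -- Since `t' ∘ s` agrees with `s ∘ t`, the reflection `t'` is the conjugate of `t` by `s`;
    -- applying `s` to the divisibility for `t` and `d` turns it into the one for `t'` and `d'`.
    difference-conj : ∀ {d d' x} (t t' : Carrier → Carrier) → s d ≈ d' → t' (s x) ≈ s (t x) →
      d ∣ (x - t x) → d' ∣ (s x - t' (s x))
    difference-conj {d} {d'} {x} t t' p q (u , r) = s u , (begin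
      s x - t' (s x)   ≈⟨ +-congˡ (-‿cong q) ⟩
      s x - s (t x)    ≈⟨ s-minus x (t x) ⟨
      s (x - t x)      ≈⟨ ⟦⟧-cong r ⟩
      s (d * u)        ≈⟨ *-homo d u ⟩
      s d * s u        ≈⟨ *-congʳ p ⟩
      d' * s u         ∎)

    s-⟦⟧* : (∀ q → s ⟦ q ⟧ ≈ ⟦ q ⟧) → ∀ q {x y} → s x ≈ y → s (⟦ q ⟧ * x) ≈ ⟦ q ⟧ * y
    s-⟦⟧* p q {x} e = trans (*-homo ⟦ q ⟧ x) (*-cong (p q) e)

    invariant-+ : ∀ {x y} → s x ≈ x → s y ≈ y → s (x + y) ≈ x + y
    invariant-+ {x} {y} p q = trans (+-homo x y) (+-cong p q)

    invariant-* : ∀ {x y} → s x ≈ x → s y ≈ y → s (x * y) ≈ x * y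
    invariant-* {x} {y} p q = trans (*-homo x y) (*-cong p q)

    invariant-neg : ∀ {x} → s x ≈ x → s (- x) ≈ - x
    invariant-neg {x} p = trans (-‿homo x) (-‿cong p)

    -- Both x = D y and D are anti-invariant, and D is regular.
    quotient-invariant : ∀ {x y} → s D ≈ - D → x ≈ D * y → s x ≈ - x → s y ≈ y
    quotient-invariant {x} {y} sD p q = D-cancel (begin
      D * s y         ≈⟨ solve 2 (λ d y → d :* y := :- (:- d :* y)) refl D (s y) ⟩
      - (- D * s y)   ≈⟨ -‿cong (*-congʳ sD) ⟨
      - (s D * s y)   ≈⟨ -‿cong (*-homo D y) ⟨
      - s (D * y)     ≈⟨ -‿cong (⟦⟧-cong p) ⟨
      - s x           ≈⟨ -‿cong q ⟩
      - - x           ≈⟨ solve 1 (λ x → :- :- x := x) refl x ⟩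
      x               ≈⟨ p ⟩
      D * y           ∎)

  private
    module R₁₂ = Reflection s₁₂ s₁₂-hom
    module R₁₃ = Reflection s₁₃ s₁₃-hom
    module R₂₃ = Reflection s₂₃ s₂₃-hom

  QI-resp : ∀ {x y} → x ≈ y → QI x → QI y
  QI-resp p (a , b , c) = R₁₂.difference-resp p a , R₁₃.difference-resp p b , R₂₃.difference-resp p c

  QI-+ : ∀ {x y} → QI x → QI y → QI (x + y)
  QI-+ (a , b , c) (a' , b' , c') = R₁₂.difference-+ a a' , R₁₃.difference-+ b b' , R₂₃.difference-+ c c'

  QI-* : ∀ {x y} → QI x → QI y → QI (x * y)
  QI-* (a , b , c) (a' , b' , c') = R₁₂.difference-* a a' , R₁₃.difference-* b b' , R₂₃.difference-* c c'

  QI-neg : ∀ {x} → QI x → QI (- x)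
  QI-neg (a , b , c) = R₁₂.difference-neg a , R₁₃.difference-neg b , R₂₃.difference-neg c

  QI-symmetric : ∀ {x} → Symmetric x → QI x
  QI-symmetric (a , b , c) = R₁₂.difference-invariant a , R₁₃.difference-invariant b , R₂₃.difference-invariant c

  Symmetric-+ : ∀ {x y} → Symmetric x → Symmetric y → Symmetric (x + y)
  Symmetric-+ (a , b , c) (a' , b' , c') = R₁₂.invariant-+ a a' , R₁₃.invariant-+ b b' , R₂₃.invariant-+ c c'

  Symmetric-* : ∀ {x y} → Symmetric x → Symmetric y → Symmetric (x * y)
  Symmetric-* (a , b , c) (a' , b' , c') = R₁₂.invariant-* a a' , R₁₃.invariant-* b b' , R₂₃.invariant-* c c'

  Symmetric-neg : ∀ {x} → Symmetric x → Symmetric (- x)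
  Symmetric-neg (a , b , c) = R₁₂.invariant-neg a , R₁₃.invariant-neg b , R₂₃.invariant-neg c

  Symmetric-⟦⟧ : ∀ q → Symmetric ⟦ q ⟧
  Symmetric-⟦⟧ q = s₁₂-⟦⟧ q , s₁₃-⟦⟧ q , s₂₃-⟦⟧ q

  QI-s₁₂ : ∀ {x} → QI x → QI (s₁₂ x)
  QI-s₁₂ {x} (a , b , c) = R₁₂.difference-self (s₁₂² x) a
    , R₁₂.difference-conj s₂₃ s₁₃ s₁₂-D₂₃ (s₁₃s₁₂ x) c
    , R₁₂.difference-conj s₁₃ s₂₃ s₁₂-D₁₃ (s₂₃s₁₂ x) b

  QI-s₂₃ : ∀ {x} → QI x → QI (s₂₃ x)
  QI-s₂₃ {x} (a , b , c) = R₂₃.difference-conj s₁₃ s₁₂ s₂₃-D₁₃ (sym (s₂₃s₁₃ x)) b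
    , R₂₃.difference-conj s₁₂ s₁₃ s₂₃-D₁₂ (trans (s₁₃s₂₃ x) (sym (s₂₃s₁₂ x))) a
    , R₂₃.difference-self (s₂₃² x) c

  -- The record prescribes the action on the D_ij and x_i for `s₁₂` and `s₂₃` only; the action of
  -- `s₁₃` is recovered from this word.
  s₁₂s₂₃s₁₂ : ∀ x → s₁₂ (s₂₃ (s₁₂ x)) ≈ s₁₃ x
  s₁₂s₂₃s₁₂ x = trans (H₁₂.⟦⟧-cong (s₂₃s₁₂ x)) (s₁₂² (s₁₃ x))

  QI-s₁₃ : ∀ {x} → QI x → QI (s₁₃ x)
  QI-s₁₃ {x} p = QI-resp (s₁₂s₂₃s₁₂ x) (QI-s₁₂ (QI-s₂₃ (QI-s₁₂ p)))

  -- The two 3-cycles. With the identity they are the even elements of S₃, which explains the signs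
  -- in `Alt`.
  r₁ r₂ : Carrier → Carrier
  r₁ x = s₁₂ (s₂₃ x)
  r₂ x = s₁₂ (s₁₃ x)

  Alt Sym : Carrier → Carrier
  Alt x = x + r₁ x + r₂ x - (s₁₂ x + s₁₃ x + s₂₃ x)
  Sym x = x + r₁ x + r₂ x + (s₁₂ x + s₁₃ x + s₂₃ x)

  s₁₂r₁ : ∀ x → s₁₂ (r₁ x) ≈ s₂₃ x
  s₁₂r₁ x = s₁₂² (s₂₃ x)

  s₁₂r₂ : ∀ x → s₁₂ (r₂ x) ≈ s₁₃ x
  s₁₂r₂ x = s₁₂² (s₁₃ x)

  s₁₃r₁ : ∀ x → s₁₃ (r₁ x) ≈ s₁₂ x
  s₁₃r₁ x = trans (H₁₃.⟦⟧-cong (sym (s₁₃s₁₂ x))) (s₁₃² (s₁₂ x))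

  s₁₃r₂ : ∀ x → s₁₃ (r₂ x) ≈ s₂₃ x
  s₁₃r₂ x = trans (H₁₃.⟦⟧-cong (sym (s₁₃s₂₃ x))) (s₁₃² (s₂₃ x))

  s₂₃r₁ : ∀ x → s₂₃ (r₁ x) ≈ s₁₃ x
  s₂₃r₁ x = trans (H₂₃.⟦⟧-cong (sym (s₂₃s₁₃ x))) (s₂₃² (s₁₃ x))

  s₂₃r₂ : ∀ x → s₂₃ (r₂ x) ≈ s₁₂ x
  s₂₃r₂ x = trans (H₂₃.⟦⟧-cong (sym (s₂₃s₁₂ x))) (s₂₃² (s₁₂ x))

  +₃-cong : ∀ {x x' y y' z z'} → x ≈ x' → y ≈ y' → z ≈ z' → x + y + z ≈ x' + y' + z'
  +₃-cong p q r = +-cong (+-cong p q) r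

  -₂-cong : ∀ {x x' y y'} → x ≈ x' → y ≈ y' → x - y ≈ x' - y'
  -₂-cong p q = +-cong p (-‿cong q)

  r₁-cong : ∀ {x y} → x ≈ y → r₁ x ≈ r₁ y
  r₁-cong p = H₁₂.⟦⟧-cong (H₂₃.⟦⟧-cong p)

  r₂-cong : ∀ {x y} → x ≈ y → r₂ x ≈ r₂ y
  r₂-cong p = H₁₂.⟦⟧-cong (H₁₃.⟦⟧-cong p)

  r₁-+ : ∀ x y → r₁ (x + y) ≈ r₁ x + r₁ y
  r₁-+ x y = trans (H₁₂.⟦⟧-cong (H₂₃.+-homo x y)) (H₁₂.+-homo _ _)

  r₂-+ : ∀ x y → r₂ (x + y) ≈ r₂ x + r₂ y
  r₂-+ x y = trans (H₁₂.⟦⟧-cong (H₁₃.+-homo x y)) (H₁₂.+-homo _ _)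

  r₁-* : ∀ x y → r₁ (x * y) ≈ r₁ x * r₁ y
  r₁-* x y = trans (H₁₂.⟦⟧-cong (H₂₃.*-homo x y)) (H₁₂.*-homo _ _)

  r₂-* : ∀ x y → r₂ (x * y) ≈ r₂ x * r₂ y
  r₂-* x y = trans (H₁₂.⟦⟧-cong (H₁₃.*-homo x y)) (H₁₂.*-homo _ _)

  Alt-cong : ∀ {x y} → x ≈ y → Alt x ≈ Alt y
  Alt-cong p = -₂-cong (+₃-cong p (r₁-cong p) (r₂-cong p)) (+₃-cong (H₁₂.⟦⟧-cong p) (H₁₃.⟦⟧-cong p) (H₂₃.⟦⟧-cong p))

  Sym-cong : ∀ {x y} → x ≈ y → Sym x ≈ Sym y
  Sym-cong p = +-cong (+₃-cong p (r₁-cong p) (r₂-cong p)) (+₃-cong (H₁₂.⟦⟧-cong p) (H₁₃.⟦⟧-cong p) (H₂₃.⟦⟧-cong p))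

  Alt-antisymmetric : ∀ x → Antisymmetric (Alt x)
  Alt-antisymmetric x =
      (begin
        s₁₂ (Alt x) ≈⟨ trans (R₁₂.s-minus _ _) (-₂-cong (R₁₂.s-+₃ _ _ _) (R₁₂.s-+₃ _ _ _)) ⟩
        s₁₂ x + s₁₂ (r₁ x) + s₁₂ (r₂ x) - (s₁₂ (s₁₂ x) + s₁₂ (s₁₃ x) + s₁₂ (s₂₃ x))
          ≈⟨ -₂-cong (+₃-cong refl (s₁₂r₁ x) (s₁₂r₂ x)) (+₃-cong (s₁₂² x) refl refl) ⟩
        s₁₂ x + s₂₃ x + s₁₃ x - (x + r₂ x + r₁ x)
          ≈⟨ solve 6 (λ a b c d e f → d :+ f :+ e :- (a :+ c :+ b) := :- (a :+ b :+ c :- (d :+ e :+ f))) refl x (r₁ x) (r₂ x) (s₁₂ x) (s₁₃ x) (s₂₃ x) ⟩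
        - Alt x ∎)
    , (begin
        s₁₃ (Alt x) ≈⟨ trans (R₁₃.s-minus _ _) (-₂-cong (R₁₃.s-+₃ _ _ _) (R₁₃.s-+₃ _ _ _)) ⟩
        s₁₃ x + s₁₃ (r₁ x) + s₁₃ (r₂ x) - (s₁₃ (s₁₂ x) + s₁₃ (s₁₃ x) + s₁₃ (s₂₃ x))
          ≈⟨ -₂-cong (+₃-cong refl (s₁₃r₁ x) (s₁₃r₂ x)) (+₃-cong (s₁₃s₁₂ x) (s₁₃² x) (s₁₃s₂₃ x)) ⟩
        s₁₃ x + s₁₂ x + s₂₃ x - (r₁ x + x + r₂ x)
          ≈⟨ solve 6 (λ a b c d e f → e :+ d :+ f :- (b :+ a :+ c) := :- (a :+ b :+ c :- (d :+ e :+ f))) refl x (r₁ x) (r₂ x) (s₁₂ x) (s₁₃ x) (s₂₃ x) ⟩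
        - Alt x ∎)
    , (begin
        s₂₃ (Alt x) ≈⟨ trans (R₂₃.s-minus _ _) (-₂-cong (R₂₃.s-+₃ _ _ _) (R₂₃.s-+₃ _ _ _)) ⟩
        s₂₃ x + s₂₃ (r₁ x) + s₂₃ (r₂ x) - (s₂₃ (s₁₂ x) + s₂₃ (s₁₃ x) + s₂₃ (s₂₃ x))
          ≈⟨ -₂-cong (+₃-cong refl (s₂₃r₁ x) (s₂₃r₂ x)) (+₃-cong (s₂₃s₁₂ x) (s₂₃s₁₃ x) (s₂₃² x)) ⟩
        s₂₃ x + s₁₃ x + s₁₂ x - (r₂ x + r₁ x + x)
          ≈⟨ solve 6 (λ a b c d e f → f :+ e :+ d :- (c :+ b :+ a) := :- (a :+ b :+ c :- (d :+ e :+ f))) refl x (r₁ x) (r₂ x) (s₁₂ x) (s₁₃ x) (s₂₃ x) ⟩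
        - Alt x ∎)

  Sym-symmetric : ∀ x → Symmetric (Sym x)
  Sym-symmetric x =
      (begin
        s₁₂ (Sym x) ≈⟨ trans (H₁₂.+-homo _ _) (+-cong (R₁₂.s-+₃ _ _ _) (R₁₂.s-+₃ _ _ _)) ⟩
        s₁₂ x + s₁₂ (r₁ x) + s₁₂ (r₂ x) + (s₁₂ (s₁₂ x) + s₁₂ (s₁₃ x) + s₁₂ (s₂₃ x))
          ≈⟨ +-cong (+₃-cong refl (s₁₂r₁ x) (s₁₂r₂ x)) (+₃-cong (s₁₂² x) refl refl) ⟩
        s₁₂ x + s₂₃ x + s₁₃ x + (x + r₂ x + r₁ x)
          ≈⟨ solve 6 (λ a b c d e f → d :+ f :+ e :+ (a :+ c :+ b) := a :+ b :+ c :+ (d :+ e :+ f)) refl x (r₁ x) (r₂ x) (s₁₂ x) (s₁₃ x) (s₂₃ x) ⟩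
        Sym x ∎)
    , (begin
        s₁₃ (Sym x) ≈⟨ trans (H₁₃.+-homo _ _) (+-cong (R₁₃.s-+₃ _ _ _) (R₁₃.s-+₃ _ _ _)) ⟩
        s₁₃ x + s₁₃ (r₁ x) + s₁₃ (r₂ x) + (s₁₃ (s₁₂ x) + s₁₃ (s₁₃ x) + s₁₃ (s₂₃ x))
          ≈⟨ +-cong (+₃-cong refl (s₁₃r₁ x) (s₁₃r₂ x)) (+₃-cong (s₁₃s₁₂ x) (s₁₃² x) (s₁₃s₂₃ x)) ⟩
        s₁₃ x + s₁₂ x + s₂₃ x + (r₁ x + x + r₂ x)
          ≈⟨ solve 6 (λ a b c d e f → e :+ d :+ f :+ (b :+ a :+ c) := a :+ b :+ c :+ (d :+ e :+ f)) refl x (r₁ x) (r₂ x) (s₁₂ x) (s₁₃ x) (s₂₃ x) ⟩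
        Sym x ∎)
    , (begin
        s₂₃ (Sym x) ≈⟨ trans (H₂₃.+-homo _ _) (+-cong (R₂₃.s-+₃ _ _ _) (R₂₃.s-+₃ _ _ _)) ⟩
        s₂₃ x + s₂₃ (r₁ x) + s₂₃ (r₂ x) + (s₂₃ (s₁₂ x) + s₂₃ (s₁₃ x) + s₂₃ (s₂₃ x))
          ≈⟨ +-cong (+₃-cong refl (s₂₃r₁ x) (s₂₃r₂ x)) (+₃-cong (s₂₃s₁₂ x) (s₂₃s₁₃ x) (s₂₃² x)) ⟩
        s₂₃ x + s₁₃ x + s₁₂ x + (r₂ x + r₁ x + x)
          ≈⟨ solve 6 (λ a b c d e f → f :+ e :+ d :+ (c :+ b :+ a) := a :+ b :+ c :+ (d :+ e :+ f)) refl x (r₁ x) (r₂ x) (s₁₂ x) (s₁₃ x) (s₂₃ x) ⟩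
        Sym x ∎)

  s₁₃-via : ∀ {x y z w} → s₁₂ x ≈ y → s₂₃ y ≈ z → s₁₂ z ≈ w → s₁₃ x ≈ w
  s₁₃-via {x} p q r = trans (sym (s₁₂s₂₃s₁₂ x)) (trans (H₁₂.⟦⟧-cong (trans (H₂₃.⟦⟧-cong p) q)) r)

  D-antisymmetric : Antisymmetric D
  D-antisymmetric = sD₁₂ , s₁₃-via sD₁₂ s₂₃-D sD₁₂ , sD₂₃
    where
    sD₁₂ : s₁₂ D ≈ - D
    sD₁₂ = begin
      s₁₂ (D₁₂ * D₁₃ * D₂₃)         ≈⟨ trans (H₁₂.*-homo _ _) (*-congʳ (H₁₂.*-homo _ _)) ⟩
      s₁₂ D₁₂ * s₁₂ D₁₃ * s₁₂ D₂₃   ≈⟨ *-cong (*-cong s₁₂-D₁₂ s₁₂-D₁₃) s₁₂-D₂₃ ⟩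
      - D₁₂ * D₂₃ * D₁₃             ≈⟨ solve 3 (λ x y z → :- x :* z :* y := :- (x :* y :* z)) refl D₁₂ D₁₃ D₂₃ ⟩
      - (D₁₂ * D₁₃ * D₂₃)           ∎
    sD₂₃ : s₂₃ D ≈ - D
    sD₂₃ = begin
      s₂₃ (D₁₂ * D₁₃ * D₂₃)         ≈⟨ trans (H₂₃.*-homo _ _) (*-congʳ (H₂₃.*-homo _ _)) ⟩
      s₂₃ D₁₂ * s₂₃ D₁₃ * s₂₃ D₂₃   ≈⟨ *-cong (*-cong s₂₃-D₁₂ s₂₃-D₁₃) s₂₃-D₂₃ ⟩
      D₁₃ * D₁₂ * - D₂₃             ≈⟨ solve 3 (λ x y z → y :* x :* :- z := :- (x :* y :* z)) refl D₁₂ D₁₃ D₂₃ ⟩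
      - (D₁₂ * D₁₃ * D₂₃)           ∎
    s₂₃-D : s₂₃ (- D) ≈ D
    s₂₃-D = trans (H₂₃.-‿homo D) (trans (-‿cong sD₂₃) (solve 1 (λ x → :- :- x := x) refl D))

  QI-D : QI D
  QI-D = double (proj₁ D-antisymmetric) (D₁₃ * D₂₃ , *-assoc _ _ _)
    , double (proj₁ (proj₂ D-antisymmetric)) (D₁₂ * D₂₃ , solve 3 (λ x y z → x :* y :* z := y :* (x :* z)) refl D₁₂ D₁₃ D₂₃)
    , double (proj₂ (proj₂ D-antisymmetric)) (D₁₂ * D₁₃ , *-comm _ _)
    where
    double : ∀ {d x y} → y ≈ - x → d ∣ x → d ∣ (x - y)
    double {d} {x} {y} p q = ∣-resp (trans (solve 1 (λ x → x :+ x := x :- :- x) refl x) (+-congˡ (-‿cong (sym p)))) (∣-+ q q)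

  -- For antisymmetric `x` each difference x - s x is 2x, so quasiinvariance makes `x` itself
  -- divisible by every D_ij and hence by `D`. A quotient of two antisymmetric elements is
  -- symmetric.
  antisymmetric-QI : ∀ {x} → Antisymmetric x → QI x → ∃ λ h → Symmetric h × x ≈ D * h
  antisymmetric-QI {x} (a , b , c) (u , v , w) =
    let h , p = D-lcm x (halve a u) (halve b v) (halve c w)
    in h , (R₁₂.quotient-invariant (proj₁ D-antisymmetric) p a
          , R₁₃.quotient-invariant (proj₁ (proj₂ D-antisymmetric)) p b
          , R₂₃.quotient-invariant (proj₂ (proj₂ D-antisymmetric)) p c) , p
    where
    halve : ∀ {d y} → y ≈ - x → d ∣ (x - y) → d ∣ x
    halve {d} {y} p q = ∣-resp (begin
      (x - y) * ⟦ ℚ.½ ⟧     ≈⟨ *-congʳ (+-congˡ (-‿cong p)) ⟩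
      (x - - x) * ⟦ ℚ.½ ⟧   ≈⟨ solve 1 (λ x → (x :- :- x) :* con ℚ.½ := x) refl x ⟩
      x                     ∎) (∣-*ʳ ⟦ ℚ.½ ⟧ q)

  QI-Alt : ∀ {x} → QI x → QI (Alt x)
  QI-Alt p = QI-+ (QI-+ (QI-+ p (QI-s₁₂ (QI-s₂₃ p))) (QI-s₁₂ (QI-s₁₃ p)))
    (QI-neg (QI-+ (QI-+ (QI-s₁₂ p) (QI-s₁₃ p)) (QI-s₂₃ p)))

  Alt-QI : ∀ {x} → QI x → ∃ λ h → Symmetric h × Alt x ≈ D * h
  Alt-QI {x} p = antisymmetric-QI (Alt-antisymmetric x) (QI-Alt p)

  Alt-+ : ∀ x y → Alt (x + y) ≈ Alt x + Alt y
  Alt-+ x y = trans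
    (-₂-cong (+₃-cong refl (r₁-+ x y) (r₂-+ x y)) (+₃-cong (H₁₂.+-homo x y) (H₁₃.+-homo x y) (H₂₃.+-homo x y)))
    (solve 12 (λ a b c d e f a' b' c' d' e' f' →
      (a :+ a') :+ (b :+ b') :+ (c :+ c') :- ((d :+ d') :+ (e :+ e') :+ (f :+ f'))
        := a :+ b :+ c :- (d :+ e :+ f) :+ (a' :+ b' :+ c' :- (d' :+ e' :+ f'))) refl
      x (r₁ x) (r₂ x) (s₁₂ x) (s₁₃ x) (s₂₃ x) y (r₁ y) (r₂ y) (s₁₂ y) (s₁₃ y) (s₂₃ y))

  Sym-+ : ∀ x y → Sym (x + y) ≈ Sym x + Sym y
  Sym-+ x y = trans
    (+-cong (+₃-cong refl (r₁-+ x y) (r₂-+ x y)) (+₃-cong (H₁₂.+-homo x y) (H₁₃.+-homo x y) (H₂₃.+-homo x y)))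
    (solve 12 (λ a b c d e f a' b' c' d' e' f' →
      (a :+ a') :+ (b :+ b') :+ (c :+ c') :+ ((d :+ d') :+ (e :+ e') :+ (f :+ f'))
        := a :+ b :+ c :+ (d :+ e :+ f) :+ (a' :+ b' :+ c' :+ (d' :+ e' :+ f'))) refl
      x (r₁ x) (r₂ x) (s₁₂ x) (s₁₃ x) (s₂₃ x) y (r₁ y) (r₂ y) (s₁₂ y) (s₁₃ y) (s₂₃ y))

  private
    s-*ˡ : ∀ {σ} → Symmetric σ → ∀ x → (s₁₂ (σ * x) ≈ σ * s₁₂ x) × (s₁₃ (σ * x) ≈ σ * s₁₃ x) × (s₂₃ (σ * x) ≈ σ * s₂₃ x)
    s-*ˡ {σ} (a , b , c) x = trans (H₁₂.*-homo σ x) (*-congʳ a) , trans (H₁₃.*-homo σ x) (*-congʳ b) , trans (H₂₃.*-homo σ x) (*-congʳ c)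

    r-*ˡ : ∀ {σ} → Symmetric σ → ∀ x → (r₁ (σ * x) ≈ σ * r₁ x) × (r₂ (σ * x) ≈ σ * r₂ x)
    r-*ˡ {σ} p x = trans (H₁₂.⟦⟧-cong (proj₂ (proj₂ (s-*ˡ p x)))) (proj₁ (s-*ˡ p (s₂₃ x)))
      , trans (H₁₂.⟦⟧-cong (proj₁ (proj₂ (s-*ˡ p x)))) (proj₁ (s-*ˡ p (s₁₃ x)))

  Alt-*ˡ : ∀ {σ} → Symmetric σ → ∀ x → Alt (σ * x) ≈ σ * Alt x
  Alt-*ˡ {σ} p x = trans
    (-₂-cong (+₃-cong refl (proj₁ (r-*ˡ p x)) (proj₂ (r-*ˡ p x)))
      (+₃-cong (proj₁ (s-*ˡ p x)) (proj₁ (proj₂ (s-*ˡ p x))) (proj₂ (proj₂ (s-*ˡ p x)))))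
    (solve 7 (λ σ a b c d e f → σ :* a :+ σ :* b :+ σ :* c :- (σ :* d :+ σ :* e :+ σ :* f) := σ :* (a :+ b :+ c :- (d :+ e :+ f)))
      refl σ x (r₁ x) (r₂ x) (s₁₂ x) (s₁₃ x) (s₂₃ x))

  Sym-*ˡ : ∀ {σ} → Symmetric σ → ∀ x → Sym (σ * x) ≈ σ * Sym x
  Sym-*ˡ {σ} p x = trans
    (+-cong (+₃-cong refl (proj₁ (r-*ˡ p x)) (proj₂ (r-*ˡ p x)))
      (+₃-cong (proj₁ (s-*ˡ p x)) (proj₁ (proj₂ (s-*ˡ p x))) (proj₂ (proj₂ (s-*ˡ p x)))))
    (solve 7 (λ σ a b c d e f → σ :* a :+ σ :* b :+ σ :* c :+ (σ :* d :+ σ :* e :+ σ :* f) := σ :* (a :+ b :+ c :+ (d :+ e :+ f)))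
      refl σ x (r₁ x) (r₂ x) (s₁₂ x) (s₁₃ x) (s₂₃ x))

  private
    pairs-cancel : ∀ {x y z u v w} → u + v + w ≈ x + y + z → x + y + z - (u + v + w) ≈ 0#
    pairs-cancel p = x≈y⇒x-y≈0 (sym p)

  -- Right multiplication by a reflection that fixes `x` matches each even element of S₃ with an odd
  -- one having the same image, so the sum cancels. This and its two analogues make most of the Gram
  -- matrix vanish.
  Alt-s₁₂-invariant : ∀ {x} → s₁₂ x ≈ x → Alt x ≈ 0#
  Alt-s₁₂-invariant {x} p = pairs-cancel (+₃-cong p
    (trans (H₁₃.⟦⟧-cong (sym p)) (s₁₃s₁₂ x)) (trans (H₂₃.⟦⟧-cong (sym p)) (s₂₃s₁₂ x)))

  Alt-s₁₃-invariant : ∀ {x} → s₁₃ x ≈ x → Alt x ≈ 0#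
  Alt-s₁₃-invariant {x} p = pairs-cancel (trans
    (+₃-cong (H₁₂.⟦⟧-cong (sym p)) p (trans (H₂₃.⟦⟧-cong (sym p)) (s₂₃s₁₃ x)))
    (solve 3 (λ x y z → z :+ x :+ y := x :+ y :+ z) refl x (r₁ x) (r₂ x)))

  Alt-s₂₃-invariant : ∀ {x} → s₂₃ x ≈ x → Alt x ≈ 0#
  Alt-s₂₃-invariant {x} p = pairs-cancel (trans
    (+₃-cong (H₁₂.⟦⟧-cong (sym p)) (trans (H₁₃.⟦⟧-cong (sym p)) (s₁₃s₂₃ x)) p)
    (solve 3 (λ x y z → y :+ z :+ x := x :+ y :+ z) refl x (r₁ x) (r₂ x)))

  r₂s₁₂ : ∀ x → r₂ (s₁₂ x) ≈ s₂₃ x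
  r₂s₁₂ x = trans (H₁₂.⟦⟧-cong (s₁₃s₁₂ x)) (s₁₂² (s₂₃ x))

  Alt-s₁₂ : ∀ x → Alt (s₁₂ x) ≈ - Alt x
  Alt-s₁₂ x = trans
    (-₂-cong (+₃-cong refl (s₁₂s₂₃s₁₂ x) (r₂s₁₂ x)) (+₃-cong (s₁₂² x) (s₁₃s₁₂ x) (s₂₃s₁₂ x)))
    (solve 6 (λ a b c d e f → d :+ e :+ f :- (a :+ b :+ c) := :- (a :+ b :+ c :- (d :+ e :+ f))) refl x (r₁ x) (r₂ x) (s₁₂ x) (s₁₃ x) (s₂₃ x))

  -- Orbits of s₂₃-invariant elements and Cramer's rule

  module Orbit {a : Carrier} (s₂₃a : s₂₃ a ≈ a) where
    -- The orbit is permuted like the indices 1, 2, 3: `a` belongs to 1, `b` to 2 and `c` to 3, each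
    -- being fixed by the transposition of the other two.
    b c : Carrier
    b = s₁₂ a
    c = s₁₃ a

    r₁a : r₁ a ≈ b
    r₁a = H₁₂.⟦⟧-cong s₂₃a

    r₂a : r₂ a ≈ c
    r₂a = trans (sym (s₁₃s₂₃ a)) (H₁₃.⟦⟧-cong s₂₃a)

    r₂b : r₂ b ≈ a
    r₂b = trans (r₂s₁₂ a) s₂₃a

    s₁₃b : s₁₃ b ≈ b
    s₁₃b = trans (s₁₃s₁₂ a) r₁a

    s₂₃b : s₂₃ b ≈ c
    s₂₃b = trans (s₂₃s₁₂ a) r₂a

    s₂₃c : s₂₃ c ≈ b
    s₂₃c = trans (s₂₃s₁₃ a) r₁a

    Alt-*a : ∀ p → Alt (p * a) ≈ p * a + r₁ p * b + r₂ p * c - (s₁₂ p * b + s₁₃ p * c + s₂₃ p * a)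
    Alt-*a p = -₂-cong
      (+₃-cong refl (trans (r₁-* p a) (*-congˡ r₁a)) (trans (r₂-* p a) (*-congˡ r₂a)))
      (+₃-cong (H₁₂.*-homo p a) (H₁₃.*-homo p a) (trans (H₂₃.*-homo p a) (*-congˡ s₂₃a)))

    Alt-*b : ∀ p → Alt (p * b) ≈ p * b + r₁ p * c + r₂ p * a - (s₁₂ p * a + s₁₃ p * b + s₂₃ p * c)
    Alt-*b p = -₂-cong
      (+₃-cong refl (trans (r₁-* p b) (*-congˡ (s₁₂s₂₃s₁₂ a))) (trans (r₂-* p b) (*-congˡ r₂b)))
      (+₃-cong (trans (H₁₂.*-homo p b) (*-congˡ (s₁₂² a))) (trans (H₁₃.*-homo p b) (*-congˡ s₁₃b))
        (trans (H₂₃.*-homo p b) (*-congˡ s₂₃b)))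

    t : Carrier
    t = a + b + c

    t-symmetric : Symmetric t
    t-symmetric =
        trans (R₁₂.s-+₃ _ _ _) (trans (+₃-cong refl (s₁₂² a) r₂a)
          (solve 3 (λ a b c → b :+ a :+ c := a :+ b :+ c) refl a b c))
      , trans (R₁₃.s-+₃ _ _ _) (trans (+₃-cong refl s₁₃b (s₁₃² a))
          (solve 3 (λ a b c → c :+ b :+ a := a :+ b :+ c) refl a b c))
      , trans (R₂₃.s-+₃ _ _ _) (trans (+₃-cong s₂₃a s₂₃b s₂₃c)
          (solve 3 (λ a b c → a :+ c :+ b := a :+ b :+ c) refl a b c))

    -- Three times the projection of a to the trace-free part.
    α : Carrier
    α = ⟦ 3ℚ ⟧ * a - t

    s₂₃α : s₂₃ α ≈ α
    s₂₃α = trans (R₂₃.s-minus _ _) (-₂-cong (R₂₃.s-⟦⟧* s₂₃-⟦⟧ _ s₂₃a) (proj₂ (proj₂ t-symmetric)))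

    s₁₂α : s₁₂ α ≈ ⟦ 3ℚ ⟧ * b - t
    s₁₂α = trans (R₁₂.s-minus _ _) (-₂-cong (R₁₂.s-⟦⟧* s₁₂-⟦⟧ _ refl) (proj₁ t-symmetric))

    s₁₃α : s₁₃ α ≈ ⟦ 3ℚ ⟧ * c - t
    s₁₃α = trans (R₁₃.s-minus _ _) (-₂-cong (R₁₃.s-⟦⟧* s₁₃-⟦⟧ _ refl) (proj₁ (proj₂ t-symmetric)))

    -- Trace zero lets the third orbit element be eliminated. This is what reduces the expansion to
    -- two unknowns per orbit and to a 2 × 2 determinant.
    α-traceless : s₁₃ α ≈ - (α + s₁₂ α)
    α-traceless = trans s₁₃α (trans
      (solve 3 (λ a b c → let t = a :+ b :+ c in
        con 3ℚ :* c :- t := :- ((con 3ℚ :* a :- t) :+ (con 3ℚ :* b :- t))) refl a b c)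
      (-‿cong (+-congˡ (sym s₁₂α))))

    α-QI : QI a → QI α
    α-QI p = QI-+ (QI-* (QI-symmetric (Symmetric-⟦⟧ _)) p) (QI-neg (QI-symmetric t-symmetric))

    private
      congruent : ∀ {p₁ p₂ p₃ p₄ p₅ p₆ x y z w} → z ≈ w →
        (p₁ * x + p₂ * y + p₃ * z - (p₄ * y + p₅ * z + p₆ * x) ≈ p₁ * x + p₂ * y + p₃ * w - (p₄ * y + p₅ * w + p₆ * x))
        × (p₁ * y + p₂ * z + p₃ * x - (p₄ * x + p₅ * y + p₆ * z) ≈ p₁ * y + p₂ * w + p₃ * x - (p₄ * x + p₅ * y + p₆ * w))
      congruent p = -₂-cong (+₃-cong refl refl (*-congˡ p)) (+₃-cong refl (*-congˡ p) refl)
        , -₂-cong (+₃-cong refl (*-congˡ p) refl) (+₃-cong refl refl (*-congˡ p))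

    Alt-*a-traceless : c ≈ - (a + b) → ∀ p →
      Alt (p * a) ≈ p * a + r₁ p * b + r₂ p * - (a + b) - (s₁₂ p * b + s₁₃ p * - (a + b) + s₂₃ p * a)
    Alt-*a-traceless q p = trans (Alt-*a p) (proj₁ (congruent q))

    Alt-*b-traceless : c ≈ - (a + b) → ∀ p →
      Alt (p * b) ≈ p * b + r₁ p * - (a + b) + r₂ p * a - (s₁₂ p * a + s₁₃ p * b + s₂₃ p * - (a + b))
    Alt-*b-traceless q p = trans (Alt-*b p) (proj₂ (congruent q))

  -- Cramer's rule for the traceless pair (a, a'), in terms of the pairing Alt.
  reproducing : ∀ {a a'} → s₂₃ a ≈ a → s₂₃ a' ≈ a' → s₁₃ a ≈ - (a + s₁₂ a) → s₁₃ a' ≈ - (a' + s₁₂ a') → ∀ p →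
    Alt (p * s₁₂ a') * a - Alt (p * a') * s₁₂ a - Alt (p * s₁₂ a) * a' + Alt (p * a) * s₁₂ a'
      ≈ (a * s₁₂ a' - s₁₂ a * a') * (⟦ 3ℚ ⟧ * p - (p + r₁ p + r₂ p))
  reproducing {a} {a'} i i' tr tr' p = trans
    (+-cong (-₂-cong (-₂-cong (*-congʳ (Orbit.Alt-*b-traceless i' tr' p)) (*-congʳ (Orbit.Alt-*a-traceless i' tr' p)))
      (*-congʳ (Orbit.Alt-*b-traceless i tr p))) (*-congʳ (Orbit.Alt-*a-traceless i tr p)))
    (solve 10 (λ p₀ p₁ p₂ q₁₂ q₁₃ q₂₃ a b a' b' →
      let c = :- (a :+ b)
          c' = :- (a' :+ b')
          Alt-a' = p₀ :* a' :+ p₁ :* b' :+ p₂ :* c' :- (q₁₂ :* b' :+ q₁₃ :* c' :+ q₂₃ :* a')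
          Alt-b' = p₀ :* b' :+ p₁ :* c' :+ p₂ :* a' :- (q₁₂ :* a' :+ q₁₃ :* b' :+ q₂₃ :* c')
          Alt-a = p₀ :* a :+ p₁ :* b :+ p₂ :* c :- (q₁₂ :* b :+ q₁₃ :* c :+ q₂₃ :* a)
          Alt-b = p₀ :* b :+ p₁ :* c :+ p₂ :* a :- (q₁₂ :* a :+ q₁₃ :* b :+ q₂₃ :* c)
      in Alt-b' :* a :- Alt-a' :* b :- Alt-b :* a' :+ Alt-a :* b'
           := (a :* b' :- b :* a') :* (con 3ℚ :* p₀ :- (p₀ :+ p₁ :+ p₂))) refl
      p (r₁ p) (r₂ p) (s₁₂ p) (s₁₃ p) (s₂₃ p) a (s₁₂ a) a' (s₁₂ a'))

  -- Nested to the right and in the order of `six`, so that with scalar coefficients it matches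
  -- `lincomb` summand by summand.
  comb : (a a' σ₀ σ₁ σ₂ σ₃ σ₄ σ₅ : Carrier) → Carrier
  comb a a' σ₀ σ₁ σ₂ σ₃ σ₄ σ₅ = σ₀ * 1# + (σ₁ * a + (σ₂ * s₁₂ a + (σ₃ * a' + (σ₄ * s₁₂ a' + σ₅ * D))))

  Alt-comb : ∀ {a a' σ₀ σ₁ σ₂ σ₃ σ₄ σ₅} → Symmetric σ₀ → Symmetric σ₁ → Symmetric σ₂ → Symmetric σ₃ → Symmetric σ₄ → Symmetric σ₅ → ∀ y →
    Alt (comb a a' σ₀ σ₁ σ₂ σ₃ σ₄ σ₅ * y)
      ≈ σ₀ * Alt y + (σ₁ * Alt (a * y) + (σ₂ * Alt (s₁₂ a * y) + (σ₃ * Alt (a' * y) + (σ₄ * Alt (s₁₂ a' * y) + σ₅ * Alt (D * y)))))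
  Alt-comb {a} {a'} {σ₀} p₀ p₁ p₂ p₃ p₄ p₅ y =
    first (term p₁ (term p₂ (term p₃ (term p₄ (trans (Alt-cong (*-assoc _ _ _)) (Alt-*ˡ p₅ _))))))
    where
    term : ∀ {σ x z w} → Symmetric σ → Alt (z * y) ≈ w → Alt ((σ * x + z) * y) ≈ σ * Alt (x * y) + w
    term {σ} {x} {z} {w} p q = begin
      Alt ((σ * x + z) * y)                ≈⟨ Alt-cong (trans (distribʳ _ _ _) (+-congʳ (*-assoc _ _ _))) ⟩
      Alt (σ * (x * y) + z * y)            ≈⟨ Alt-+ _ _ ⟩
      Alt (σ * (x * y)) + Alt (z * y)      ≈⟨ +-cong (Alt-*ˡ p (x * y)) q ⟩
      σ * Alt (x * y) + w                  ∎
    first : ∀ {z w} → Alt (z * y) ≈ w → Alt ((σ₀ * 1# + z) * y) ≈ σ₀ * Alt y + w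
    first q = trans (term p₀ q) (+-congʳ (*-congˡ (Alt-cong (*-identityˡ y))))

  Alt-D : Alt (D * 1#) ≈ ⟦ 6ℚ ⟧ * D
  Alt-D = trans (Alt-cong (*-identityʳ D)) (trans
    (-₂-cong (+₃-cong refl (trans (H₁₂.⟦⟧-cong c) (neg a)) (trans (H₁₂.⟦⟧-cong b) (neg a))) (+₃-cong a b c))
    (solve 1 (λ d → d :+ d :+ d :- (:- d :+ :- d :+ :- d) := con 6ℚ :* d) refl D))
    where
    a = proj₁ D-antisymmetric
    b = proj₁ (proj₂ D-antisymmetric)
    c = proj₂ (proj₂ D-antisymmetric)
    neg : s₁₂ D ≈ - D → s₁₂ (- D) ≈ D
    neg p = trans (H₁₂.-‿homo D) (trans (-‿cong p) (solve 1 (λ x → :- :- x := x) refl D))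

  -- Expansion of quasiinvariants with symmetric coefficients

  Combination : (a a' x : Carrier) → Set
  Combination a a' x = ∃ λ σ₀ → ∃ λ σ₁ → ∃ λ σ₂ → ∃ λ σ₃ → ∃ λ σ₄ → ∃ λ σ₅ →
    Symmetric σ₀ × Symmetric σ₁ × Symmetric σ₂ × Symmetric σ₃ × Symmetric σ₄ × Symmetric σ₅
      × x ≈ comb a a' σ₀ σ₁ σ₂ σ₃ σ₄ σ₅

  private
    distrib₄ : ∀ d h₁ h₂ h₃ h₄ x y z w → d * (h₁ * x - h₂ * y - h₃ * z + h₄ * w)
      ≈ d * h₁ * x - d * h₂ * y - d * h₃ * z + d * h₄ * w
    distrib₄ d h₁ h₂ h₃ h₄ x y z w = trans (split d (h₁ * x) (h₂ * y) (h₃ * z) (h₄ * w))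
      (+-cong (-₂-cong (-₂-cong (sym (*-assoc _ _ _)) (sym (*-assoc _ _ _))) (sym (*-assoc _ _ _))) (sym (*-assoc _ _ _)))
      where
      split : ∀ d x y z w → d * (x - y - z + w) ≈ d * x - d * y - d * z + d * w
      split = solve 5 (λ d x y z w → d :* (x :- y :- z :+ w) := d :* x :- d :* y :- d :* z :+ d :* w) refl

    -- With `t` the sum over the even and `q` over the odd elements, Sym is t + q and Alt is t - q,
    -- so a sixth of their sum is the average ⅓ t. The factor ⅑ undoes the two factors 3, one from
    -- the determinant and one from 3p - t. `i` stands for the inverse of `κ`, whose product with
    -- `κ` is simplified later.
    average : ∀ κ i p t q → ⟦ ⅙ ⟧ * (t + q + (t - q)) + ⟦ ⅑ ⟧ * i * (⟦ 3ℚ ⟧ * κ * (⟦ 3ℚ ⟧ * p - t))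
      ≈ ⟦ ⅓ ⟧ * t + κ * i * (p - ⟦ ⅓ ⟧ * t)
    average = solve 5 (λ κ i p t q →
      con ⅙ :* (t :+ q :+ (t :- q)) :+ con ⅑ :* i :* (con 3ℚ :* κ :* (con 3ℚ :* p :- t))
        := con ⅓ :* t :+ κ :* i :* (p :- con ⅓ :* t)) refl

    -- From α = 3x - t one gets x = (α + t)/3. This splits a summand of the combination into its
    -- trace-free part and a symmetric part; ⅓ and ⅑ become the constants `k` and `j` of the
    -- expansion.
    scale : ∀ i h x t → ⟦ ⅓ ⟧ * i * h * x ≈ ⟦ ⅑ ⟧ * i * (h * (⟦ 3ℚ ⟧ * x - t)) + ⟦ ⅑ ⟧ * i * (h * t)
    scale = solve 4 (λ i h x t → con ⅓ :* i :* h :* x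
      := con ⅑ :* i :* (h :* (con 3ℚ :* x :- t)) :+ con ⅑ :* i :* (h :* t)) refl

    -- The v_i are the symmetric parts split off by `scale`. The coefficient of 1 carries them with
    -- the opposite sign, so only the trace-free w_i survive.
    collect : ∀ j S h d {y₁ y₂ y₃ y₄ u₁ u₂ u₃ u₄ w₁ w₂ w₃ w₄ v₁ v₂ v₃ v₄} → u₁ * y₁ ≈ j * w₁ + j * v₁ → u₂ * y₂ ≈ j * w₂ + j * v₂ →
      u₃ * y₃ ≈ j * w₃ + j * v₃ → u₄ * y₄ ≈ j * w₄ + j * v₄ →
      ⟦ ⅙ ⟧ * S + j * (v₂ - v₁ + (v₃ - v₄)) + (u₁ * y₁ + (- u₂ * y₂ + (- u₃ * y₃ + (u₄ * y₄ + ⟦ ⅙ ⟧ * h * d))))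
        ≈ ⟦ ⅙ ⟧ * (S + d * h) + j * (w₁ - w₂ - w₃ + w₄)
    collect j S h d {y₁} {y₂} {y₃} {y₄} {u₁} {u₂} {u₃} {u₄} {w₁} {w₂} {w₃} {w₄} {v₁} {v₂} {v₃} {v₄} p₁ p₂ p₃ p₄ = begin
      ⟦ ⅙ ⟧ * S + j * (v₂ - v₁ + (v₃ - v₄)) + (u₁ * y₁ + (- u₂ * y₂ + (- u₃ * y₃ + (u₄ * y₄ + ⟦ ⅙ ⟧ * h * d))))
        ≈⟨ +-cong (+-congˡ (solve 5 (λ j v₁ v₂ v₃ v₄ → j :* (v₂ :- v₁ :+ (v₃ :- v₄)) := j :* v₂ :- j :* v₁ :+ (j :* v₃ :- j :* v₄)) refl j v₁ v₂ v₃ v₄))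
             (+-cong p₁ (+-cong (neg p₂) (+-cong (neg p₃) (+-congʳ p₄)))) ⟩
      ⟦ ⅙ ⟧ * S + (j * v₂ - j * v₁ + (j * v₃ - j * v₄)) + (j * w₁ + j * v₁ + (- (j * w₂ + j * v₂) + (- (j * w₃ + j * v₃) + (j * w₄ + j * v₄ + ⟦ ⅙ ⟧ * h * d))))
        ≈⟨ solve 10 (λ S hd v₁ v₂ v₃ v₄ w₁ w₂ w₃ w₄ →
             S :+ (v₂ :- v₁ :+ (v₃ :- v₄)) :+ (w₁ :+ v₁ :+ (:- (w₂ :+ v₂) :+ (:- (w₃ :+ v₃) :+ (w₄ :+ v₄ :+ hd))))
             := S :+ hd :+ (w₁ :- w₂ :- w₃ :+ w₄)) refl (⟦ ⅙ ⟧ * S) (⟦ ⅙ ⟧ * h * d) (j * v₁) (j * v₂) (j * v₃) (j * v₄) (j * w₁) (j * w₂) (j * w₃) (j * w₄) ⟩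
      ⟦ ⅙ ⟧ * S + ⟦ ⅙ ⟧ * h * d + (j * w₁ - j * w₂ - j * w₃ + j * w₄)
        ≈⟨ +-cong (solve 3 (λ S h d → con ⅙ :* S :+ con ⅙ :* h :* d := con ⅙ :* (S :+ d :* h)) refl S h d)
             (solve 5 (λ j w₁ w₂ w₃ w₄ → j :* w₁ :- j :* w₂ :- j :* w₃ :+ j :* w₄ := j :* (w₁ :- w₂ :- w₃ :+ w₄)) refl j w₁ w₂ w₃ w₄) ⟩
      ⟦ ⅙ ⟧ * (S + d * h) + j * (w₁ - w₂ - w₃ + w₄) ∎
      where
      neg : ∀ {x y z} → x * y ≈ z → - x * y ≈ - z
      neg {x} {y} p = trans (solve 2 (λ x y → :- x :* y := :- (x :* y)) refl x y) (-‿cong p)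

  module Duality {a a' : Carrier} (QI-a : QI a) (QI-a' : QI a') (s₂₃a : s₂₃ a ≈ a) (s₂₃a' : s₂₃ a' ≈ a')
    (κ κ⁻¹ : ℚ) (κκ⁻¹ : κ ℚ.* κ⁻¹ ≡ 1ℚ) (gram : Alt (a * s₁₂ a') ≈ ⟦ κ ⟧ * D) where
    private
      module O = Orbit s₂₃a
      module O' = Orbit s₂₃a'

    -- Subtracting the traces only makes the expression cyclic: both the 2 × 2 determinant and Alt
    -- (a * s₁₂ a') expand into the six products of different members of the two orbits, and they
    -- differ by the factor 3.
    determinant : O.α * s₁₂ O'.α - s₁₂ O.α * O'.α ≈ ⟦ 3ℚ ⟧ * (⟦ κ ⟧ * D)
    determinant = begin
      O.α * s₁₂ O'.α - s₁₂ O.α * O'.α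
        ≈⟨ -₂-cong (*-congˡ O'.s₁₂α) (*-congʳ O.s₁₂α) ⟩
      (⟦ 3ℚ ⟧ * a - O.t) * (⟦ 3ℚ ⟧ * O'.b - O'.t) - (⟦ 3ℚ ⟧ * O.b - O.t) * (⟦ 3ℚ ⟧ * a' - O'.t)
        ≈⟨ solve 6 (λ a b c a' b' c' → let t = a :+ b :+ c ; t' = a' :+ b' :+ c' ; three = con 3ℚ in
             (three :* a :- t) :* (three :* b' :- t') :- (three :* b :- t) :* (three :* a' :- t')
               := three :* (a :* b' :+ b :* c' :+ c :* a' :- (b :* a' :+ c :* b' :+ a :* c'))) refl a O.b O.c a' O'.b O'.c ⟩
      ⟦ 3ℚ ⟧ * (a * O'.b + O.b * O'.c + O.c * a' - (O.b * a' + O.c * O'.b + a * O'.c))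
        ≈⟨ *-congˡ (-₂-cong (+₃-cong refl (*-congʳ O.r₁a) (*-congʳ O.r₂a)) (+₃-cong refl refl (*-congʳ s₂₃a))) ⟨
      ⟦ 3ℚ ⟧ * (a * O'.b + r₁ a * O'.c + r₂ a * a' - (s₁₂ a * a' + s₁₃ a * O'.b + s₂₃ a * O'.c))
        ≈⟨ *-congˡ (O'.Alt-*b a) ⟨
      ⟦ 3ℚ ⟧ * Alt (a * s₁₂ a')
        ≈⟨ *-congˡ gram ⟩
      ⟦ 3ℚ ⟧ * (⟦ κ ⟧ * D) ∎

    private
      j k : Carrier
      j = ⟦ ⅑ ⟧ * ⟦ κ⁻¹ ⟧
      k = ⟦ ⅓ ⟧ * ⟦ κ⁻¹ ⟧

      j-sym : Symmetric j
      j-sym = Symmetric-* (Symmetric-⟦⟧ _) (Symmetric-⟦⟧ _)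

      k-sym : Symmetric k
      k-sym = Symmetric-* (Symmetric-⟦⟧ _) (Symmetric-⟦⟧ _)

      -- In `reproducing` the left side is a multiple of `D` through the four pairings, the right
      -- side through the determinant. Cancelling the regular element `D` leaves the quotients h_i
      -- as coefficients.
      dual-expansion : ∀ {p h₁ h₂ h₃ h₄} → Alt (p * s₁₂ O'.α) ≈ D * h₁ → Alt (p * O'.α) ≈ D * h₂ →
        Alt (p * s₁₂ O.α) ≈ D * h₃ → Alt (p * O.α) ≈ D * h₄ →
        h₁ * O.α - h₂ * s₁₂ O.α - h₃ * O'.α + h₄ * s₁₂ O'.α ≈ ⟦ 3ℚ ⟧ * ⟦ κ ⟧ * (⟦ 3ℚ ⟧ * p - (p + r₁ p + r₂ p))
      dual-expansion {p} {h₁} {h₂} {h₃} {h₄} eq₁ eq₂ eq₃ eq₄ = D-cancel (begin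
        D * (h₁ * O.α - h₂ * s₁₂ O.α - h₃ * O'.α + h₄ * s₁₂ O'.α)
          ≈⟨ distrib₄ D h₁ h₂ h₃ h₄ O.α (s₁₂ O.α) O'.α (s₁₂ O'.α) ⟩
        D * h₁ * O.α - D * h₂ * s₁₂ O.α - D * h₃ * O'.α + D * h₄ * s₁₂ O'.α
          ≈⟨ +-cong (-₂-cong (-₂-cong (*-congʳ eq₁) (*-congʳ eq₂)) (*-congʳ eq₃)) (*-congʳ eq₄) ⟨
        Alt (p * s₁₂ O'.α) * O.α - Alt (p * O'.α) * s₁₂ O.α - Alt (p * s₁₂ O.α) * O'.α + Alt (p * O.α) * s₁₂ O'.α
          ≈⟨ reproducing O.s₂₃α O'.s₂₃α O.α-traceless O'.α-traceless p ⟩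
        (O.α * s₁₂ O'.α - s₁₂ O.α * O'.α) * (⟦ 3ℚ ⟧ * p - (p + r₁ p + r₂ p))
          ≈⟨ *-congʳ determinant ⟩
        ⟦ 3ℚ ⟧ * (⟦ κ ⟧ * D) * (⟦ 3ℚ ⟧ * p - (p + r₁ p + r₂ p))
          ≈⟨ rotate ⟦ 3ℚ ⟧ ⟦ κ ⟧ D _ ⟩
        D * (⟦ 3ℚ ⟧ * ⟦ κ ⟧ * (⟦ 3ℚ ⟧ * p - (p + r₁ p + r₂ p))) ∎)
        where
        rotate : ∀ x y d z → x * (y * d) * z ≈ d * (x * y * z)
        rotate = solve 4 (λ x y d z → x :* (y :* d) :* z := d :* (x :* y :* z)) refl

      -- The average of `p` over the rotations is ⅙ (Sym p + Alt p), supplied by the coefficients of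
      -- 1 and `D`; the rest of `p` is the trace-free expansion. The multiples of the traces in the
      -- coefficient of 1 compensate for using `a` in place of `O.α`, and likewise for the other
      -- three.
      expansion : ∀ {p h₀ h₁ h₂ h₃ h₄} → Alt p ≈ D * h₀ →
        h₁ * O.α - h₂ * s₁₂ O.α - h₃ * O'.α + h₄ * s₁₂ O'.α ≈ ⟦ 3ℚ ⟧ * ⟦ κ ⟧ * (⟦ 3ℚ ⟧ * p - (p + r₁ p + r₂ p)) →
        comb a a' (⟦ ⅙ ⟧ * Sym p + j * (h₂ * O.t - h₁ * O.t + (h₃ * O'.t - h₄ * O'.t)))
          (k * h₁) (- (k * h₂)) (- (k * h₃)) (k * h₄) (⟦ ⅙ ⟧ * h₀) ≈ p
      expansion {p} {h₀} {h₁} {h₂} {h₃} {h₄} eq₀ eq = begin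
        comb a a' (⟦ ⅙ ⟧ * Sym p + j * (h₂ * O.t - h₁ * O.t + (h₃ * O'.t - h₄ * O'.t)))
          (k * h₁) (- (k * h₂)) (- (k * h₃)) (k * h₄) (⟦ ⅙ ⟧ * h₀)
          ≈⟨ +-congʳ (*-identityʳ _) ⟩
        ⟦ ⅙ ⟧ * Sym p + j * (h₂ * O.t - h₁ * O.t + (h₃ * O'.t - h₄ * O'.t)) + (k * h₁ * a + (- (k * h₂) * O.b + (- (k * h₃) * a' + (k * h₄ * O'.b + ⟦ ⅙ ⟧ * h₀ * D))))
          ≈⟨ collect j (Sym p) h₀ D (scale ⟦ κ⁻¹ ⟧ h₁ a O.t) (scale ⟦ κ⁻¹ ⟧ h₂ O.b O.t) (scale ⟦ κ⁻¹ ⟧ h₃ a' O'.t) (scale ⟦ κ⁻¹ ⟧ h₄ O'.b O'.t) ⟩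
        ⟦ ⅙ ⟧ * (Sym p + D * h₀) + j * (h₁ * O.α - h₂ * (⟦ 3ℚ ⟧ * O.b - O.t) - h₃ * O'.α + h₄ * (⟦ 3ℚ ⟧ * O'.b - O'.t))
          ≈⟨ +-cong (*-congˡ (+-congˡ eq₀)) (*-congˡ (+-cong (-₂-cong (-₂-cong refl (*-congˡ O.s₁₂α)) refl) (*-congˡ O'.s₁₂α))) ⟨
        ⟦ ⅙ ⟧ * (Sym p + Alt p) + j * (h₁ * O.α - h₂ * s₁₂ O.α - h₃ * O'.α + h₄ * s₁₂ O'.α)
          ≈⟨ +-congˡ (*-congˡ eq) ⟩
        ⟦ ⅙ ⟧ * (Sym p + Alt p) + j * (⟦ 3ℚ ⟧ * ⟦ κ ⟧ * (⟦ 3ℚ ⟧ * p - (p + r₁ p + r₂ p)))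
          ≈⟨ average ⟦ κ ⟧ ⟦ κ⁻¹ ⟧ p (p + r₁ p + r₂ p) (s₁₂ p + s₁₃ p + s₂₃ p) ⟩
        ⟦ ⅓ ⟧ * (p + r₁ p + r₂ p) + ⟦ κ ⟧ * ⟦ κ⁻¹ ⟧ * (p - ⟦ ⅓ ⟧ * (p + r₁ p + r₂ p))
          ≈⟨ +-congˡ (*-congʳ (trans (sym (⟦⟧-* κ κ⁻¹)) (≡.subst (λ q → ⟦ κ ℚ.* κ⁻¹ ⟧ ≈ ⟦ q ⟧) κκ⁻¹ refl))) ⟩
        ⟦ ⅓ ⟧ * (p + r₁ p + r₂ p) + ⟦ 1ℚ ⟧ * (p - ⟦ ⅓ ⟧ * (p + r₁ p + r₂ p))
          ≈⟨ solve 2 (λ p t → con ⅓ :* t :+ con 1ℚ :* (p :- con ⅓ :* t) := p) refl p _ ⟩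
        p ∎

    spanning : ∀ {p} → QI p → Combination a a' p
    spanning {p} QI-p =
      let h₀ , sy₀ , eq₀ = Alt-QI QI-p
          h₁ , sy₁ , eq₁ = Alt-QI (QI-* QI-p (QI-s₁₂ (O'.α-QI QI-a')))
          h₂ , sy₂ , eq₂ = Alt-QI (QI-* QI-p (O'.α-QI QI-a'))
          h₃ , sy₃ , eq₃ = Alt-QI (QI-* QI-p (QI-s₁₂ (O.α-QI QI-a)))
          h₄ , sy₄ , eq₄ = Alt-QI (QI-* QI-p (O.α-QI QI-a))
      in ⟦ ⅙ ⟧ * Sym p + j * (h₂ * O.t - h₁ * O.t + (h₃ * O'.t - h₄ * O'.t))
      , k * h₁ , - (k * h₂) , - (k * h₃) , k * h₄ , ⟦ ⅙ ⟧ * h₀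
      , Symmetric-+ (Symmetric-* (Symmetric-⟦⟧ _) (Sym-symmetric p))
          (Symmetric-* j-sym (Symmetric-+
            (Symmetric-+ (Symmetric-* sy₂ O.t-symmetric) (Symmetric-neg (Symmetric-* sy₁ O.t-symmetric)))
            (Symmetric-+ (Symmetric-* sy₃ O'.t-symmetric) (Symmetric-neg (Symmetric-* sy₄ O'.t-symmetric)))))
      , Symmetric-* k-sym sy₁ , Symmetric-neg (Symmetric-* k-sym sy₂) , Symmetric-neg (Symmetric-* k-sym sy₃)
      , Symmetric-* k-sym sy₄ , Symmetric-* (Symmetric-⟦⟧ _) sy₀
      , sym (expansion eq₀ (dual-expansion eq₁ eq₂ eq₃ eq₄))

-- The quotient by e₁, e₂, e₃

module Coinvariants (S : S₃Algebra) where
  open S₃Algebra S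
  open QuasiInvariants S
  open RingMorphisms rawRing rawRing using (IsRingHomomorphism)
  open Algebra.Properties.Semiring.Exp semiring using (_^_)
  open Relation.Binary.Reasoning.Setoid setoid
  private
    module H₁₂ = IsRingHomomorphism s₁₂-hom
    module H₁₃ = IsRingHomomorphism s₁₃-hom
    module H₂₃ = IsRingHomomorphism s₂₃-hom
    module R₁₂ = Reflection s₁₂ s₁₂-hom
    module R₁₃ = Reflection s₁₃ s₁₃-hom
    module R₂₃ = Reflection s₂₃ s₂₃-hom

  s₁₃-x₁ : s₁₃ x₁ ≈ x₃
  s₁₃-x₁ = s₁₃-via s₁₂-x₁ s₂₃-x₂ s₁₂-x₃

  s₁₃-x₂ : s₁₃ x₂ ≈ x₂
  s₁₃-x₂ = s₁₃-via s₁₂-x₂ s₂₃-x₁ s₁₂-x₁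

  s₁₃-x₃ : s₁₃ x₃ ≈ x₁
  s₁₃-x₃ = s₁₃-via s₁₂-x₃ s₂₃-x₃ s₁₂-x₂

  e₁-symmetric : Symmetric e₁
  e₁-symmetric =
      trans (R₁₂.s-+₃ _ _ _) (trans (+₃-cong s₁₂-x₁ s₁₂-x₂ s₁₂-x₃) (solve 3 (λ x y z → y :+ x :+ z := x :+ y :+ z) refl x₁ x₂ x₃))
    , trans (R₁₃.s-+₃ _ _ _) (trans (+₃-cong s₁₃-x₁ s₁₃-x₂ s₁₃-x₃) (solve 3 (λ x y z → z :+ y :+ x := x :+ y :+ z) refl x₁ x₂ x₃))
    , trans (R₂₃.s-+₃ _ _ _) (trans (+₃-cong s₂₃-x₁ s₂₃-x₂ s₂₃-x₃) (solve 3 (λ x y z → x :+ z :+ y := x :+ y :+ z) refl x₁ x₂ x₃))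

  private
    s-* : ∀ {s} → IsRingHomomorphism s → ∀ {x y x' y'} → s x ≈ x' → s y ≈ y' → s (x * y) ≈ x' * y'
    s-* h p q = trans (IsRingHomomorphism.*-homo h _ _) (*-cong p q)

    s-^ : ∀ {s} → IsRingHomomorphism s → ∀ {x y} → s x ≈ y → ∀ n → s (x ^ n) ≈ y ^ n
    s-^ h p zero = IsRingHomomorphism.1#-homo h
    s-^ h p (suc n) = s-* h p (s-^ h p n)

  e₂-symmetric : Symmetric e₂
  e₂-symmetric =
      trans (R₁₂.s-+₃ _ _ _) (trans (+₃-cong (s-* s₁₂-hom s₁₂-x₁ s₁₂-x₂) (s-* s₁₂-hom s₁₂-x₁ s₁₂-x₃) (s-* s₁₂-hom s₁₂-x₂ s₁₂-x₃))
        (solve 3 (λ x y z → y :* x :+ y :* z :+ x :* z := x :* y :+ x :* z :+ y :* z) refl x₁ x₂ x₃))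
    , trans (R₁₃.s-+₃ _ _ _) (trans (+₃-cong (s-* s₁₃-hom s₁₃-x₁ s₁₃-x₂) (s-* s₁₃-hom s₁₃-x₁ s₁₃-x₃) (s-* s₁₃-hom s₁₃-x₂ s₁₃-x₃))
        (solve 3 (λ x y z → z :* y :+ z :* x :+ y :* x := x :* y :+ x :* z :+ y :* z) refl x₁ x₂ x₃))
    , trans (R₂₃.s-+₃ _ _ _) (trans (+₃-cong (s-* s₂₃-hom s₂₃-x₁ s₂₃-x₂) (s-* s₂₃-hom s₂₃-x₁ s₂₃-x₃) (s-* s₂₃-hom s₂₃-x₂ s₂₃-x₃))
        (solve 3 (λ x y z → x :* z :+ x :* y :+ z :* y := x :* y :+ x :* z :+ y :* z) refl x₁ x₂ x₃))

  e₃-symmetric : Symmetric e₃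
  e₃-symmetric =
      trans (s-* s₁₂-hom (s-* s₁₂-hom s₁₂-x₁ s₁₂-x₂) s₁₂-x₃) (solve 3 (λ x y z → y :* x :* z := x :* y :* z) refl x₁ x₂ x₃)
    , trans (s-* s₁₃-hom (s-* s₁₃-hom s₁₃-x₁ s₁₃-x₂) s₁₃-x₃) (solve 3 (λ x y z → z :* y :* x := x :* y :* z) refl x₁ x₂ x₃)
    , trans (s-* s₂₃-hom (s-* s₂₃-hom s₂₃-x₁ s₂₃-x₂) s₂₃-x₃) (solve 3 (λ x y z → x :* z :* y := x :* y :* z) refl x₁ x₂ x₃)

  InIdeal : Carrier → Set
  InIdeal x = Σ Carrier λ q₁ → Σ Carrier λ q₂ → Σ Carrier λ q₃ →
    QI q₁ × QI q₂ × QI q₃ × (x ≈ e₁ * q₁ + e₂ * q₂ + e₃ * q₃)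

  -- `Alt` is linear over symmetric elements, so it carries e_i q_i y to e_i times a multiple of
  -- `D`. After cancelling `D`, the scalar lies in the ideal of the e_i, where only 0 does.
  InIdeal-Alt : ∀ {x y q} → InIdeal x → QI y → Alt (x * y) ≈ ⟦ q ⟧ * D → q ≡ 0ℚ
  InIdeal-Alt {x} {y} {q} (q₁ , q₂ , q₃ , p₁ , p₂ , p₃ , eq) py eqq =
    let h₁ , _ , eq₁ = Alt-QI (QI-* p₁ py)
        h₂ , _ , eq₂ = Alt-QI (QI-* p₂ py)
        h₃ , _ , eq₃ = Alt-QI (QI-* p₃ py)
    in no-constants q h₁ h₂ h₃ (D-cancel (begin
    D * ⟦ q ⟧        ≈⟨ *-comm D ⟦ q ⟧ ⟩
    ⟦ q ⟧ * D        ≈⟨ eqq ⟨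
    Alt (x * y)      ≈⟨ Alt-cong (trans (*-congʳ eq) (solve 7 (λ e₁ e₂ e₃ q₁ q₂ q₃ y →
                          (e₁ :* q₁ :+ e₂ :* q₂ :+ e₃ :* q₃) :* y := e₁ :* (q₁ :* y) :+ e₂ :* (q₂ :* y) :+ e₃ :* (q₃ :* y))
                          refl e₁ e₂ e₃ q₁ q₂ q₃ y)) ⟩
    Alt (e₁ * (q₁ * y) + e₂ * (q₂ * y) + e₃ * (q₃ * y))
                     ≈⟨ trans (Alt-+ _ _) (+-congʳ (Alt-+ _ _)) ⟩
    Alt (e₁ * (q₁ * y)) + Alt (e₂ * (q₂ * y)) + Alt (e₃ * (q₃ * y))
                     ≈⟨ +₃-cong (trans (Alt-*ˡ e₁-symmetric _) (*-congˡ eq₁)) (trans (Alt-*ˡ e₂-symmetric _) (*-congˡ eq₂))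
                          (trans (Alt-*ˡ e₃-symmetric _) (*-congˡ eq₃)) ⟩
    e₁ * (D * h₁) + e₂ * (D * h₂) + e₃ * (D * h₃)
                     ≈⟨ solve 7 (λ d e₁ e₂ e₃ q₁ q₂ q₃ → e₁ :* (d :* q₁) :+ e₂ :* (d :* q₂) :+ e₃ :* (d :* q₃)
                          := d :* (e₁ :* q₁ :+ e₂ :* q₂ :+ e₃ :* q₃)) refl D e₁ e₂ e₃ h₁ h₂ h₃ ⟩
    D * (e₁ * h₁ + e₂ * h₂ + e₃ * h₃) ∎))

  private
    s-swap : ∀ x → s₁₂ (x * s₁₂ x) ≈ x * s₁₂ x
    s-swap x = trans (s-* s₁₂-hom refl (s₁₂² x)) (*-comm _ _)

    s-swap′ : ∀ x → s₁₂ (s₁₂ x * x) ≈ s₁₂ x * x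
    s-swap′ x = trans (s-* s₁₂-hom (s₁₂² x) refl) (*-comm _ _)

    InIdeal-extract : ∀ {x y} c r r⁻¹ → r ℚ.* r⁻¹ ≡ 1ℚ → InIdeal x → QI y → Alt (x * y) ≈ ⟦ c ⟧ * (⟦ r ⟧ * D) → c ≡ 0ℚ
    InIdeal-extract c r r⁻¹ p i qy eq = invertible-cancelʳ c r r⁻¹ p
      (InIdeal-Alt i qy (trans eq (trans (sym (*-assoc _ _ _)) (*-congʳ (sym (⟦⟧-* c r))))))

  module Independence {a a' : Carrier} (QI-a : QI a) (QI-a' : QI a') (s₂₃a : s₂₃ a ≈ a) (s₂₃a' : s₂₃ a' ≈ a')
    (κ κ⁻¹ : ℚ) (κκ⁻¹ : κ ℚ.* κ⁻¹ ≡ 1ℚ) (gram : Alt (a * s₁₂ a') ≈ ⟦ κ ⟧ * D) where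
    private
      module O = Orbit s₂₃a
      module O' = Orbit s₂₃a'
      b = s₁₂ a
      b' = s₁₂ a'

      -κκ⁻¹ : (ℚ.- κ) ℚ.* (ℚ.- κ⁻¹) ≡ 1ℚ
      -κκ⁻¹ = ≡.trans (ℚ-Solver.solve 2 (λ x y → ℚ-Solver.:- x ℚ-Solver.:* ℚ-Solver.:- y ℚ-Solver.:= x ℚ-Solver.:* y) ≡.refl κ κ⁻¹) κκ⁻¹

      gram⁻ : Alt (b * a') ≈ ⟦ ℚ.- κ ⟧ * D
      gram⁻ = begin
        Alt (s₁₂ a * a')       ≈⟨ Alt-cong (s-* s₁₂-hom refl (s₁₂² a')) ⟨
        Alt (s₁₂ (a * s₁₂ a')) ≈⟨ Alt-s₁₂ _ ⟩
        - Alt (a * s₁₂ a')     ≈⟨ -‿cong gram ⟩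
        - (⟦ κ ⟧ * D)          ≈⟨ solve 2 (λ k d → :- (k :* d) := (:- k) :* d) refl ⟦ κ ⟧ D ⟩
        - ⟦ κ ⟧ * D            ≈⟨ *-congʳ (⟦⟧-neg κ) ⟨
        ⟦ ℚ.- κ ⟧ * D          ∎
      Alt-s₁₃-product : ∀ {x y} → s₁₃ x ≈ x → s₁₃ y ≈ y → Alt (x * y) ≈ 0#
      Alt-s₁₃-product p q = Alt-s₁₃-invariant (s-* s₁₃-hom p q)
      Alt-s₂₃-product : ∀ {x y} → s₂₃ x ≈ x → s₂₃ y ≈ y → Alt (x * y) ≈ 0#
      Alt-s₂₃-product p q = Alt-s₂₃-invariant (s-* s₂₃-hom p q)

    -- The test elements 1, b', a', b, a isolate `D`, a, b, a', b' in turn: every other product of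
    -- orbit elements is fixed by some reflection. The order matters. The products of `D` with orbit
    -- elements are not covered by this rule, so `c₅` is removed first; `c₀` comes last, when the
    -- combination has become a scalar.
    independence : ∀ c₀ c₁ c₂ c₃ c₄ c₅ → InIdeal (comb a a' ⟦ c₀ ⟧ ⟦ c₁ ⟧ ⟦ c₂ ⟧ ⟦ c₃ ⟧ ⟦ c₄ ⟧ ⟦ c₅ ⟧) →
      c₀ ≡ 0ℚ × c₁ ≡ 0ℚ × c₂ ≡ 0ℚ × c₃ ≡ 0ℚ × c₄ ≡ 0ℚ × c₅ ≡ 0ℚ
    independence c₀ c₁ c₂ c₃ c₄ c₅ i = c₀≡0 , c₁≡0 , c₂≡0 , c₃≡0 , c₄≡0 , c₅≡0
      where
      X = comb a a' ⟦ c₀ ⟧ ⟦ c₁ ⟧ ⟦ c₂ ⟧ ⟦ c₃ ⟧ ⟦ c₄ ⟧ ⟦ c₅ ⟧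
      pairing : ∀ y {v₀ v₁ v₂ v₃ v₄ v₅} → Alt y ≈ v₀ → Alt (a * y) ≈ v₁ → Alt (b * y) ≈ v₂ → Alt (a' * y) ≈ v₃ → Alt (b' * y) ≈ v₄ →
        ⟦ c₅ ⟧ * Alt (D * y) ≈ v₅ →
        Alt (X * y) ≈ ⟦ c₀ ⟧ * v₀ + (⟦ c₁ ⟧ * v₁ + (⟦ c₂ ⟧ * v₂ + (⟦ c₃ ⟧ * v₃ + (⟦ c₄ ⟧ * v₄ + v₅))))
      pairing y p₀ p₁ p₂ p₃ p₄ p₅ = trans
        (Alt-comb (Symmetric-⟦⟧ c₀) (Symmetric-⟦⟧ c₁) (Symmetric-⟦⟧ c₂) (Symmetric-⟦⟧ c₃) (Symmetric-⟦⟧ c₄) (Symmetric-⟦⟧ c₅) y)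
        (+-cong (*-congˡ p₀) (+-cong (*-congˡ p₁) (+-cong (*-congˡ p₂) (+-cong (*-congˡ p₃) (+-cong (*-congˡ p₄) p₅)))))
      drop : ∀ {x y z} → y ≈ z → x * 0# + y ≈ z
      drop {x} p = trans (+-congʳ (zeroʳ x)) (trans (+-identityˡ _) p)
      keep : ∀ {x y} → y ≈ 0# → x + y ≈ x
      keep {x} p = trans (+-congˡ p) (+-identityʳ x)

      c₅≡0 : c₅ ≡ 0ℚ
      c₅≡0 = InIdeal-extract c₅ 6ℚ ⅙ ≡.refl i (QI-symmetric 1-symmetric)
        (trans (pairing 1# (Alt-s₁₂-invariant H₁₂.1#-homo) (Alt-s₂₃-product s₂₃a H₂₃.1#-homo) (Alt-s₁₃-product O.s₁₃b H₁₃.1#-homo)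
          (Alt-s₂₃-product s₂₃a' H₂₃.1#-homo) (Alt-s₁₃-product O'.s₁₃b H₁₃.1#-homo) (*-congˡ Alt-D))
          (drop (drop (drop (drop (drop refl))))))
        where
        1-symmetric : Symmetric 1#
        1-symmetric = H₁₂.1#-homo , H₁₃.1#-homo , H₂₃.1#-homo

      last : ∀ x → ⟦ c₅ ⟧ * x ≈ 0#
      last x = trans (*-congʳ (≡.subst (λ q → ⟦ q ⟧ ≈ 0#) (≡.sym c₅≡0) ⟦⟧-0)) (zeroˡ x)

      c₁≡0 : c₁ ≡ 0ℚ
      c₁≡0 = InIdeal-extract c₁ κ κ⁻¹ κκ⁻¹ i (QI-s₁₂ QI-a')
        (trans (pairing b' (Alt-s₁₃-invariant O'.s₁₃b) gram (Alt-s₁₃-product O.s₁₃b O'.s₁₃b) (Alt-s₁₂-invariant (s-swap a'))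
          (Alt-s₁₃-product O'.s₁₃b O'.s₁₃b) (last _))
          (drop (keep (drop (drop (drop refl))))))

      c₂≡0 : c₂ ≡ 0ℚ
      c₂≡0 = InIdeal-extract c₂ (ℚ.- κ) (ℚ.- κ⁻¹) -κκ⁻¹ i QI-a'
        (trans (pairing a' (Alt-s₂₃-invariant s₂₃a') (Alt-s₂₃-product s₂₃a s₂₃a') gram⁻ (Alt-s₂₃-product s₂₃a' s₂₃a')
          (Alt-s₁₂-invariant (s-swap′ a')) (last _))
          (drop (drop (keep (drop (drop refl))))))

      c₃≡0 : c₃ ≡ 0ℚ
      c₃≡0 = InIdeal-extract c₃ (ℚ.- κ) (ℚ.- κ⁻¹) -κκ⁻¹ i (QI-s₁₂ QI-a)
        (trans (pairing b (Alt-s₁₃-invariant O.s₁₃b) (Alt-s₁₂-invariant (s-swap a)) (Alt-s₁₃-product O.s₁₃b O.s₁₃b)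
          (trans (Alt-cong (*-comm _ _)) gram⁻) (Alt-s₁₃-product O'.s₁₃b O.s₁₃b) (last _))
          (drop (drop (drop (keep (drop refl))))))

      c₄≡0 : c₄ ≡ 0ℚ
      c₄≡0 = InIdeal-extract c₄ κ κ⁻¹ κκ⁻¹ i QI-a
        (trans (pairing a (Alt-s₂₃-invariant s₂₃a) (Alt-s₂₃-product s₂₃a s₂₃a) (Alt-s₁₂-invariant (s-swap′ a)) (Alt-s₂₃-product s₂₃a' s₂₃a)
          (trans (Alt-cong (*-comm _ _)) gram) (last _))
          (drop (drop (drop (drop (keep refl))))))

      vanish : ∀ {c} → c ≡ 0ℚ → ∀ x → ⟦ c ⟧ * x ≈ 0#
      vanish ≡.refl x = trans (*-congʳ ⟦⟧-0) (zeroˡ x)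

      c₀≡0 : c₀ ≡ 0ℚ
      c₀≡0 = let q₁ , q₂ , q₃ , _ , _ , _ , eq = i in no-constants c₀ q₁ q₂ q₃ (trans (sym (begin
        X ≈⟨ +-cong (*-identityʳ _) (+-cong (vanish c₁≡0 a) (+-cong (vanish c₂≡0 b) (+-cong (vanish c₃≡0 a') (+-cong (vanish c₄≡0 b') (vanish c₅≡0 D))))) ⟩
        ⟦ c₀ ⟧ + (0# + (0# + (0# + (0# + 0#)))) ≈⟨ keep (trans (+-identityˡ _) (trans (+-identityˡ _) (trans (+-identityˡ _) (+-identityˡ _)))) ⟩
        ⟦ c₀ ⟧ ∎)) eq)

  -- Symmetric elements modulo e₁, e₂, e₃

  Generated : Carrier → Set
  Generated x = Σ ℚ λ q → ∃ λ q₁ → ∃ λ q₂ → ∃ λ q₃ →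
    Symmetric q₁ × Symmetric q₂ × Symmetric q₃ × x ≈ ⟦ q ⟧ + (e₁ * q₁ + e₂ * q₂ + e₃ * q₃)

  Generated-resp : ∀ {x y} → x ≈ y → Generated x → Generated y
  Generated-resp p (q , q₁ , q₂ , q₃ , s₁ , s₂ , s₃ , eq) = q , q₁ , q₂ , q₃ , s₁ , s₂ , s₃ , trans (sym p) eq

  Generated-+ : ∀ {x y} → Generated x → Generated y → Generated (x + y)
  Generated-+ (q , q₁ , q₂ , q₃ , s₁ , s₂ , s₃ , eq) (r , r₁ , r₂ , r₃ , t₁ , t₂ , t₃ , eq') =
    q ℚ.+ r , q₁ + r₁ , q₂ + r₂ , q₃ + r₃ , Symmetric-+ s₁ t₁ , Symmetric-+ s₂ t₂ , Symmetric-+ s₃ t₃ ,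
    trans (+-cong eq eq') (trans
      (solve 11 (λ q r e₁ e₂ e₃ q₁ q₂ q₃ r₁ r₂ r₃ →
        q :+ (e₁ :* q₁ :+ e₂ :* q₂ :+ e₃ :* q₃) :+ (r :+ (e₁ :* r₁ :+ e₂ :* r₂ :+ e₃ :* r₃))
        := q :+ r :+ (e₁ :* (q₁ :+ r₁) :+ e₂ :* (q₂ :+ r₂) :+ e₃ :* (q₃ :+ r₃))) refl ⟦ q ⟧ ⟦ r ⟧ e₁ e₂ e₃ q₁ q₂ q₃ r₁ r₂ r₃)
      (+-congʳ (sym (⟦⟧-+ q r))))

  Generated-⟦⟧* : ∀ c {x} → Generated x → Generated (⟦ c ⟧ * x)
  Generated-⟦⟧* c (q , q₁ , q₂ , q₃ , s₁ , s₂ , s₃ , eq) =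
    c ℚ.* q , ⟦ c ⟧ * q₁ , ⟦ c ⟧ * q₂ , ⟦ c ⟧ * q₃ ,
    Symmetric-* (Symmetric-⟦⟧ c) s₁ , Symmetric-* (Symmetric-⟦⟧ c) s₂ , Symmetric-* (Symmetric-⟦⟧ c) s₃ ,
    trans (*-congˡ eq) (trans
      (solve 8 (λ c q e₁ e₂ e₃ q₁ q₂ q₃ → c :* (q :+ (e₁ :* q₁ :+ e₂ :* q₂ :+ e₃ :* q₃))
        := c :* q :+ (e₁ :* (c :* q₁) :+ e₂ :* (c :* q₂) :+ e₃ :* (c :* q₃))) refl ⟦ c ⟧ ⟦ q ⟧ e₁ e₂ e₃ q₁ q₂ q₃)
      (+-congʳ (sym (⟦⟧-* c q))))

  monomial : ℕ → ℕ → ℕ → Carrier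
  monomial a b c = x₁ ^ a * x₂ ^ b * x₃ ^ c

  private
    -- Vieta's relation x³ = e₁x² - e₂x + e₃, multiplied by y.
    IsRoot : Carrier → Set
    IsRoot x = ∀ y → x * (x * (x * y)) ≈ e₁ * (x * (x * y)) + e₂ * (- (x * y)) + e₃ * y

    root₁ : IsRoot x₁
    root₁ y = solve 4 (λ x₁ x₂ x₃ y → x₁ :* (x₁ :* (x₁ :* y)) := (x₁ :+ x₂ :+ x₃) :* (x₁ :* (x₁ :* y))
      :+ (x₁ :* x₂ :+ x₁ :* x₃ :+ x₂ :* x₃) :* (:- (x₁ :* y)) :+ x₁ :* x₂ :* x₃ :* y) refl x₁ x₂ x₃ y

    root₂ : IsRoot x₂
    root₂ y = solve 4 (λ x₁ x₂ x₃ y → x₂ :* (x₂ :* (x₂ :* y)) := (x₁ :+ x₂ :+ x₃) :* (x₂ :* (x₂ :* y))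
      :+ (x₁ :* x₂ :+ x₁ :* x₃ :+ x₂ :* x₃) :* (:- (x₂ :* y)) :+ x₁ :* x₂ :* x₃ :* y) refl x₁ x₂ x₃ y

    root₃ : IsRoot x₃
    root₃ y = solve 4 (λ x₁ x₂ x₃ y → x₃ :* (x₃ :* (x₃ :* y)) := (x₁ :+ x₂ :+ x₃) :* (x₃ :* (x₃ :* y))
      :+ (x₁ :* x₂ :+ x₁ :* x₃ :+ x₂ :* x₃) :* (:- (x₃ :* y)) :+ x₁ :* x₂ :* x₃ :* y) refl x₁ x₂ x₃ y

    -- Linearity of `Sym` over symmetric elements replaces arbitrary cofactors by symmetric ones.
    -- Thus it is enough to reduce a monomial in the whole ring before symmetrizing.
    Sym-e : ∀ q₁ q₂ q₃ → Generated (Sym (e₁ * q₁ + e₂ * q₂ + e₃ * q₃))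
    Sym-e q₁ q₂ q₃ = 0ℚ , Sym q₁ , Sym q₂ , Sym q₃ , Sym-symmetric q₁ , Sym-symmetric q₂ , Sym-symmetric q₃ , (begin
      Sym (e₁ * q₁ + e₂ * q₂ + e₃ * q₃)                 ≈⟨ trans (Sym-+ _ _) (+-congʳ (Sym-+ _ _)) ⟩
      Sym (e₁ * q₁) + Sym (e₂ * q₂) + Sym (e₃ * q₃)     ≈⟨ +₃-cong (Sym-*ˡ e₁-symmetric q₁) (Sym-*ˡ e₂-symmetric q₂) (Sym-*ˡ e₃-symmetric q₃) ⟩
      e₁ * Sym q₁ + e₂ * Sym q₂ + e₃ * Sym q₃           ≈⟨ +-identityˡ _ ⟨
      0# + (e₁ * Sym q₁ + e₂ * Sym q₂ + e₃ * Sym q₃)    ≈⟨ +-congʳ ⟦⟧-0 ⟨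
      ⟦ 0ℚ ⟧ + (e₁ * Sym q₁ + e₂ * Sym q₂ + e₃ * Sym q₃) ∎)

    Sym-cube : ∀ {x y z} → IsRoot x → z ≈ x * (x * (x * y)) → Generated (Sym z)
    Sym-cube {x} {y} r p = Generated-resp (Sym-cong (sym (trans p (r y)))) (Sym-e _ _ _)

    Sym-monomial : ∀ a b c → Sym (monomial a b c)
      ≈ monomial a b c + monomial c a b + monomial b c a + (monomial b a c + monomial c b a + monomial a c b)
    Sym-monomial a b c = +-cong
      (+₃-cong refl
        (trans (act s₂₃-hom s₂₃-x₁ s₂₃-x₂ s₂₃-x₃ s₁₂-hom s₁₂-x₁ s₁₂-x₃ s₁₂-x₂) (rearrange (x₂ ^ a) (x₃ ^ b) (x₁ ^ c)))
        (trans (act s₁₃-hom s₁₃-x₁ s₁₃-x₂ s₁₃-x₃ s₁₂-hom s₁₂-x₃ s₁₂-x₂ s₁₂-x₁) (rearrange′ (x₃ ^ a) (x₁ ^ b) (x₂ ^ c))))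
      (+₃-cong
        (trans (act₁ s₁₂-hom s₁₂-x₁ s₁₂-x₂ s₁₂-x₃) (*-congʳ (*-comm _ _)))
        (trans (act₁ s₁₃-hom s₁₃-x₁ s₁₃-x₂ s₁₃-x₃) (solve 3 (λ x y z → x :* y :* z := z :* y :* x) refl (x₃ ^ a) (x₂ ^ b) (x₁ ^ c)))
        (trans (act₁ s₂₃-hom s₂₃-x₁ s₂₃-x₂ s₂₃-x₃) (solve 3 (λ x y z → x :* y :* z := x :* z :* y) refl (x₁ ^ a) (x₃ ^ b) (x₂ ^ c))))
      where
      act₁ : ∀ {s} (h : IsRingHomomorphism s) {x y z x' y' z'} → s x ≈ x' → s y ≈ y' → s z ≈ z' →
        s (x ^ a * y ^ b * z ^ c) ≈ x' ^ a * y' ^ b * z' ^ c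
      act₁ h p q r = s-* h (s-* h (s-^ h p a) (s-^ h q b)) (s-^ h r c)
      act : ∀ {s} (h : IsRingHomomorphism s) {x y z x' y' z'} → s x ≈ x' → s y ≈ y' → s z ≈ z' →
        ∀ {t} (k : IsRingHomomorphism t) {x″ y″ z″} → t x' ≈ x″ → t y' ≈ y″ → t z' ≈ z″ →
        t (s (x ^ a * y ^ b * z ^ c)) ≈ x″ ^ a * y″ ^ b * z″ ^ c
      act h p q r k p' q' r' = trans (IsRingHomomorphism.⟦⟧-cong k (act₁ h p q r)) (act₁ k p' q' r')
      rearrange : ∀ x y z → x * y * z ≈ z * x * y
      rearrange = solve 3 (λ x y z → x :* y :* z := z :* x :* y) refl
      rearrange′ : ∀ x y z → x * y * z ≈ y * z * x
      rearrange′ = solve 3 (λ x y z → x :* y :* z := y :* z :* x) refl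

    monomialₚ : (x y z : Polynomial 3) → ℕ → ℕ → ℕ → Polynomial 3
    monomialₚ x y z a b c = x :^ a :* y :^ b :* z :^ c

    orbitₚ : (x y z : Polynomial 3) → ℕ → ℕ → ℕ → Polynomial 3
    orbitₚ x y z a b c = m a b c :+ m c a b :+ m b c a :+ (m b a c :+ m c b a :+ m a c b)
      where
      m = monomialₚ x y z

    e₁ₚ e₂ₚ e₃ₚ : (x y z : Polynomial 3) → Polynomial 3
    e₁ₚ x y z = x :+ y :+ z
    e₂ₚ x y z = x :* y :+ x :* z :+ y :* z
    e₃ₚ x y z = x :* y :* z

    constant : ∀ {x} q → x ≈ ⟦ q ⟧ + (e₁ * ⟦ 0ℚ ⟧ + e₂ * ⟦ 0ℚ ⟧ + e₃ * ⟦ 0ℚ ⟧) → Generated x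
    constant q p = q , _ , _ , _ , Symmetric-⟦⟧ _ , Symmetric-⟦⟧ _ , Symmetric-⟦⟧ _ , p

    -- The sum runs over all six permutations, so a monomial with two equal exponents is counted
    -- twice. Power sums then give the cofactors: twice e₁, twice e₁² - 2e₂, twice e₂, once e₁e₂ -
    -- 3e₃, and twice e₂² - 2e₁e₃ for the five exponent types below.
    type₁₀₀ : ∀ {x} → x ≈ ⟦ 0ℚ ⟧ + (e₁ * ⟦ 2ℚ ⟧ + e₂ * ⟦ 0ℚ ⟧ + e₃ * ⟦ 0ℚ ⟧) → Generated x
    type₁₀₀ p = _ , _ , _ , _ , Symmetric-⟦⟧ _ , Symmetric-⟦⟧ _ , Symmetric-⟦⟧ _ , p

    type₂₀₀ : ∀ {x} → x ≈ ⟦ 0ℚ ⟧ + (e₁ * (⟦ 2ℚ ⟧ * e₁) + e₂ * ⟦ -4ℚ ⟧ + e₃ * ⟦ 0ℚ ⟧) → Generated x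
    type₂₀₀ p = _ , _ , _ , _ , Symmetric-* (Symmetric-⟦⟧ _) e₁-symmetric , Symmetric-⟦⟧ _ , Symmetric-⟦⟧ _ , p

    type₁₁₀ : ∀ {x} → x ≈ ⟦ 0ℚ ⟧ + (e₁ * ⟦ 0ℚ ⟧ + e₂ * ⟦ 2ℚ ⟧ + e₃ * ⟦ 0ℚ ⟧) → Generated x
    type₁₁₀ p = _ , _ , _ , _ , Symmetric-⟦⟧ _ , Symmetric-⟦⟧ _ , Symmetric-⟦⟧ _ , p

    type₂₁₀ : ∀ {x} → x ≈ ⟦ 0ℚ ⟧ + (e₁ * e₂ + e₂ * ⟦ 0ℚ ⟧ + e₃ * ⟦ -3ℚ ⟧) → Generated x
    type₂₁₀ p = _ , _ , _ , _ , e₂-symmetric , Symmetric-⟦⟧ _ , Symmetric-⟦⟧ _ , p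

    type₂₂₀ : ∀ {x} → x ≈ ⟦ 0ℚ ⟧ + (e₁ * ⟦ 0ℚ ⟧ + e₂ * (⟦ 2ℚ ⟧ * e₂) + e₃ * (⟦ -4ℚ ⟧ * e₁)) → Generated x
    type₂₂₀ p = _ , _ , _ , _ , Symmetric-⟦⟧ _ , Symmetric-* (Symmetric-⟦⟧ _) e₂-symmetric , Symmetric-* (Symmetric-⟦⟧ _) e₁-symmetric , p

    rhs₁₀₀ rhs₂₀₀ rhs₁₁₀ rhs₂₁₀ rhs₂₂₀ : (x y z : Polynomial 3) → Polynomial 3
    rhs₁₀₀ x y z = con 0ℚ :+ (e₁ₚ x y z :* con 2ℚ :+ e₂ₚ x y z :* con 0ℚ :+ e₃ₚ x y z :* con 0ℚ)
    rhs₂₀₀ x y z = con 0ℚ :+ (e₁ₚ x y z :* (con 2ℚ :* e₁ₚ x y z) :+ e₂ₚ x y z :* con -4ℚ :+ e₃ₚ x y z :* con 0ℚ)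
    rhs₁₁₀ x y z = con 0ℚ :+ (e₁ₚ x y z :* con 0ℚ :+ e₂ₚ x y z :* con 2ℚ :+ e₃ₚ x y z :* con 0ℚ)
    rhs₂₁₀ x y z = con 0ℚ :+ (e₁ₚ x y z :* e₂ₚ x y z :+ e₂ₚ x y z :* con 0ℚ :+ e₃ₚ x y z :* con -3ℚ)
    rhs₂₂₀ x y z = con 0ℚ :+ (e₁ₚ x y z :* con 0ℚ :+ e₂ₚ x y z :* (con 2ℚ :* e₂ₚ x y z) :+ e₃ₚ x y z :* (con -4ℚ :* e₁ₚ x y z))

  -- An exponent of at least 3 is lowered by Vieta's relation, and three positive exponents give a
  -- multiple of e₃. There remain the 27 - 8 = 19 triples with entries at most 2 and some entry 0.
  Sym-monomial-generated : ∀ a b c → Generated (Sym (monomial a b c))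
  Sym-monomial-generated (suc (suc (suc a))) b c = Sym-cube root₁
    (solve 4 (λ x u v w → x :* (x :* (x :* u)) :* v :* w := x :* (x :* (x :* (u :* v :* w)))) refl x₁ (x₁ ^ a) (x₂ ^ b) (x₃ ^ c))
  Sym-monomial-generated a (suc (suc (suc b))) c = Sym-cube root₂
    (solve 4 (λ x u v w → u :* (x :* (x :* (x :* v))) :* w := x :* (x :* (x :* (u :* v :* w)))) refl x₂ (x₁ ^ a) (x₂ ^ b) (x₃ ^ c))
  Sym-monomial-generated a b (suc (suc (suc c))) = Sym-cube root₃
    (solve 4 (λ x u v w → u :* v :* (x :* (x :* (x :* w))) := x :* (x :* (x :* (u :* v :* w)))) refl x₃ (x₁ ^ a) (x₂ ^ b) (x₃ ^ c))
  Sym-monomial-generated (suc a) (suc b) (suc c) = Generated-resp (Sym-cong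
    (solve 8 (λ e₁ e₂ x y z u v w → e₁ :* con 0ℚ :+ e₂ :* con 0ℚ :+ x :* y :* z :* (u :* v :* w) := x :* u :* (y :* v) :* (z :* w))
      refl e₁ e₂ x₁ x₂ x₃ (x₁ ^ a) (x₂ ^ b) (x₃ ^ c))) (Sym-e ⟦ 0ℚ ⟧ ⟦ 0ℚ ⟧ _)
  Sym-monomial-generated 0 0 0 = constant 6ℚ (trans (Sym-monomial 0 0 0)
    (solve 3 (λ x y z → orbitₚ x y z 0 0 0 := con 6ℚ :+ (e₁ₚ x y z :* con 0ℚ :+ e₂ₚ x y z :* con 0ℚ :+ e₃ₚ x y z :* con 0ℚ)) refl x₁ x₂ x₃))
  Sym-monomial-generated 0 0 1 = type₁₀₀ (trans (Sym-monomial 0 0 1)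
    (solve 3 (λ x y z → orbitₚ x y z 0 0 1 := rhs₁₀₀ x y z) refl x₁ x₂ x₃))
  Sym-monomial-generated 0 0 2 = type₂₀₀ (trans (Sym-monomial 0 0 2)
    (solve 3 (λ x y z → orbitₚ x y z 0 0 2 := rhs₂₀₀ x y z) refl x₁ x₂ x₃))
  Sym-monomial-generated 0 1 0 = type₁₀₀ (trans (Sym-monomial 0 1 0)
    (solve 3 (λ x y z → orbitₚ x y z 0 1 0 := rhs₁₀₀ x y z) refl x₁ x₂ x₃))
  Sym-monomial-generated 0 1 1 = type₁₁₀ (trans (Sym-monomial 0 1 1)
    (solve 3 (λ x y z → orbitₚ x y z 0 1 1 := rhs₁₁₀ x y z) refl x₁ x₂ x₃))
  Sym-monomial-generated 0 1 2 = type₂₁₀ (trans (Sym-monomial 0 1 2)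
    (solve 3 (λ x y z → orbitₚ x y z 0 1 2 := rhs₂₁₀ x y z) refl x₁ x₂ x₃))
  Sym-monomial-generated 0 2 0 = type₂₀₀ (trans (Sym-monomial 0 2 0)
    (solve 3 (λ x y z → orbitₚ x y z 0 2 0 := rhs₂₀₀ x y z) refl x₁ x₂ x₃))
  Sym-monomial-generated 0 2 1 = type₂₁₀ (trans (Sym-monomial 0 2 1)
    (solve 3 (λ x y z → orbitₚ x y z 0 2 1 := rhs₂₁₀ x y z) refl x₁ x₂ x₃))
  Sym-monomial-generated 0 2 2 = type₂₂₀ (trans (Sym-monomial 0 2 2)
    (solve 3 (λ x y z → orbitₚ x y z 0 2 2 := rhs₂₂₀ x y z) refl x₁ x₂ x₃))
  Sym-monomial-generated 1 0 0 = type₁₀₀ (trans (Sym-monomial 1 0 0)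
    (solve 3 (λ x y z → orbitₚ x y z 1 0 0 := rhs₁₀₀ x y z) refl x₁ x₂ x₃))
  Sym-monomial-generated 1 0 1 = type₁₁₀ (trans (Sym-monomial 1 0 1)
    (solve 3 (λ x y z → orbitₚ x y z 1 0 1 := rhs₁₁₀ x y z) refl x₁ x₂ x₃))
  Sym-monomial-generated 1 0 2 = type₂₁₀ (trans (Sym-monomial 1 0 2)
    (solve 3 (λ x y z → orbitₚ x y z 1 0 2 := rhs₂₁₀ x y z) refl x₁ x₂ x₃))
  Sym-monomial-generated 1 1 0 = type₁₁₀ (trans (Sym-monomial 1 1 0)
    (solve 3 (λ x y z → orbitₚ x y z 1 1 0 := rhs₁₁₀ x y z) refl x₁ x₂ x₃))
  Sym-monomial-generated 1 2 0 = type₂₁₀ (trans (Sym-monomial 1 2 0)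
    (solve 3 (λ x y z → orbitₚ x y z 1 2 0 := rhs₂₁₀ x y z) refl x₁ x₂ x₃))
  Sym-monomial-generated 2 0 0 = type₂₀₀ (trans (Sym-monomial 2 0 0)
    (solve 3 (λ x y z → orbitₚ x y z 2 0 0 := rhs₂₀₀ x y z) refl x₁ x₂ x₃))
  Sym-monomial-generated 2 0 1 = type₂₁₀ (trans (Sym-monomial 2 0 1)
    (solve 3 (λ x y z → orbitₚ x y z 2 0 1 := rhs₂₁₀ x y z) refl x₁ x₂ x₃))
  Sym-monomial-generated 2 0 2 = type₂₂₀ (trans (Sym-monomial 2 0 2)
    (solve 3 (λ x y z → orbitₚ x y z 2 0 2 := rhs₂₂₀ x y z) refl x₁ x₂ x₃))
  Sym-monomial-generated 2 1 0 = type₂₁₀ (trans (Sym-monomial 2 1 0)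
    (solve 3 (λ x y z → orbitₚ x y z 2 1 0 := rhs₂₁₀ x y z) refl x₁ x₂ x₃))
  Sym-monomial-generated 2 2 0 = type₂₂₀ (trans (Sym-monomial 2 2 0)
    (solve 3 (λ x y z → orbitₚ x y z 2 2 0 := rhs₂₂₀ x y z) refl x₁ x₂ x₃))

  symmetric-generated : ∀ {σ} → Symmetric σ → Generated (Sym σ) → Generated σ
  symmetric-generated {σ} (a , b , c) g = Generated-resp (begin
    ⟦ ⅙ ⟧ * Sym σ   ≈⟨ *-congˡ (+-cong (+₃-cong refl (trans (H₁₂.⟦⟧-cong c) a) (trans (H₁₂.⟦⟧-cong b) a)) (+₃-cong a b c)) ⟩
    ⟦ ⅙ ⟧ * (σ + σ + σ + (σ + σ + σ)) ≈⟨ solve 1 (λ x → con ⅙ :* (x :+ x :+ x :+ (x :+ x :+ x)) := x) refl σ ⟩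
    σ ∎) (Generated-⟦⟧* ⅙ g)

  InIdeal-resp : ∀ {x y} → x ≈ y → InIdeal x → InIdeal y
  InIdeal-resp p (q₁ , q₂ , q₃ , s₁ , s₂ , s₃ , eq) = q₁ , q₂ , q₃ , s₁ , s₂ , s₃ , trans (sym p) eq

  InIdeal-+ : ∀ {x y} → InIdeal x → InIdeal y → InIdeal (x + y)
  InIdeal-+ (q₁ , q₂ , q₃ , s₁ , s₂ , s₃ , eq) (r₁ , r₂ , r₃ , t₁ , t₂ , t₃ , eq') =
    q₁ + r₁ , q₂ + r₂ , q₃ + r₃ , QI-+ s₁ t₁ , QI-+ s₂ t₂ , QI-+ s₃ t₃ , trans (+-cong eq eq')
      (solve 9 (λ e₁ e₂ e₃ q₁ q₂ q₃ r₁ r₂ r₃ →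
        e₁ :* q₁ :+ e₂ :* q₂ :+ e₃ :* q₃ :+ (e₁ :* r₁ :+ e₂ :* r₂ :+ e₃ :* r₃)
        := e₁ :* (q₁ :+ r₁) :+ e₂ :* (q₂ :+ r₂) :+ e₃ :* (q₃ :+ r₃)) refl e₁ e₂ e₃ q₁ q₂ q₃ r₁ r₂ r₃)

  InIdeal-+- : ∀ {x x' y y'} → InIdeal (x - x') → InIdeal (y - y') → InIdeal (x + y - (x' + y'))
  InIdeal-+- {x} {x'} {y} {y'} p q = InIdeal-resp
    (solve 4 (λ x x' y y' → x :- x' :+ (y :- y') := x :+ y :- (x' :+ y')) refl x x' y y') (InIdeal-+ p q)

  -- Here the symmetry of the cofactors pays off: their products with the quasiinvariant `v` are
  -- again quasiinvariant, as the ideal of QI_m demands.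
  Generated-InIdeal : ∀ {σ v} → Generated σ → QI v → Σ ℚ λ c → InIdeal (σ * v - ⟦ c ⟧ * v)
  Generated-InIdeal {σ} {v} (q , q₁ , q₂ , q₃ , s₁ , s₂ , s₃ , eq) p =
    q , q₁ * v , q₂ * v , q₃ * v , QI-* (QI-symmetric s₁) p , QI-* (QI-symmetric s₂) p , QI-* (QI-symmetric s₃) p ,
    trans (+-congʳ (*-congʳ eq)) (solve 8 (λ q e₁ e₂ e₃ q₁ q₂ q₃ v → (q :+ (e₁ :* q₁ :+ e₂ :* q₂ :+ e₃ :* q₃)) :* v :- q :* v
      := e₁ :* (q₁ :* v) :+ e₂ :* (q₂ :* v) :+ e₃ :* (q₃ :* v)) refl ⟦ q ⟧ e₁ e₂ e₃ q₁ q₂ q₃ v)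

  Combination-InIdeal : (∀ x → Generated (Sym x)) → ∀ {a a' p} → QI a → QI a' → Combination a a' p →
    Σ ℚ λ c₀ → Σ ℚ λ c₁ → Σ ℚ λ c₂ → Σ ℚ λ c₃ → Σ ℚ λ c₄ → Σ ℚ λ c₅ →
      InIdeal (p - comb a a' ⟦ c₀ ⟧ ⟦ c₁ ⟧ ⟦ c₂ ⟧ ⟦ c₃ ⟧ ⟦ c₄ ⟧ ⟦ c₅ ⟧)
  Combination-InIdeal gen QI-a QI-a' (σ₀ , σ₁ , σ₂ , σ₃ , σ₄ , σ₅ , y₀ , y₁ , y₂ , y₃ , y₄ , y₅ , eq) =
    let c₀ , i₀ = reduce y₀ (QI-symmetric (H₁₂.1#-homo , H₁₃.1#-homo , H₂₃.1#-homo))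
        c₁ , i₁ = reduce y₁ QI-a
        c₂ , i₂ = reduce y₂ (QI-s₁₂ QI-a)
        c₃ , i₃ = reduce y₃ QI-a'
        c₄ , i₄ = reduce y₄ (QI-s₁₂ QI-a')
        c₅ , i₅ = reduce y₅ QI-D
    in c₀ , c₁ , c₂ , c₃ , c₄ , c₅ , InIdeal-resp (+-congʳ (sym eq))
         (InIdeal-+- i₀ (InIdeal-+- i₁ (InIdeal-+- i₂ (InIdeal-+- i₃ (InIdeal-+- i₄ i₅)))))
    where
    reduce : ∀ {σ v} → Symmetric σ → QI v → Σ ℚ λ c → InIdeal (σ * v - ⟦ c ⟧ * v)
    reduce {σ} y = Generated-InIdeal (symmetric-generated y (gen σ))

-- Divisibility by powers of a linear form

module Divisibility (R : CommutativeRing 0ℓ 0ℓ) where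
  open CommutativeRing R
  open RingMorphisms rawRing rawRing using (IsRingHomomorphism)
  open Algebra.Properties.Semiring.Exp semiring using (_^_)
  open Algebra.Properties.Ring ring using (-‿distribʳ-*; -‿distribˡ-*)
  open Algebra.Properties.Group +-group using (⁻¹-involutive)
  open Relation.Binary.Reasoning.Setoid setoid

  infix 4 _∣_
  _∣_ : Carrier → Carrier → Set
  d ∣ x = ∃ λ u → x ≈ d * u

  Regular : Carrier → Set
  Regular x = ∀ y → x * y ≈ 0# → y ≈ 0#

  Regular-* : ∀ {x y} → Regular x → Regular y → Regular (x * y)
  Regular-* {x} {y} p q z e = q z (p (y * z) (trans (sym (*-assoc x y z)) e))

  Regular-1 : Regular 1#
  Regular-1 y p = trans (sym (*-identityˡ y)) p

  Regular-^ : ∀ {x} → Regular x → ∀ n → Regular (x ^ n)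
  Regular-^ p zero = Regular-1
  Regular-^ p (suc n) = Regular-* p (Regular-^ p n)

  Regular-cancel : ∀ {x} → Regular x → ∀ {y z} → x * y ≈ x * z → y ≈ z
  Regular-cancel {x} p {y} {z} e = begin
    y              ≈⟨ +-identityʳ y ⟨
    y + 0#         ≈⟨ +-congˡ (-‿inverseˡ z) ⟨
    y + (- z + z)  ≈⟨ +-assoc y (- z) z ⟨
    y - z + z      ≈⟨ +-congʳ (p (y - z) (begin
      x * (y - z)        ≈⟨ distribˡ x y (- z) ⟩
      x * y + x * - z    ≈⟨ +-cong e (sym (-‿distribʳ-* x z)) ⟩
      x * z - x * z      ≈⟨ -‿inverseʳ (x * z) ⟩
      0#                 ∎)) ⟩
    0# + z         ≈⟨ +-identityˡ z ⟩
    z              ∎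

  Regular-conjugate : ∀ {s x} → IsRingHomomorphism s → (∀ y → s (s y) ≈ y) → Regular x → Regular (s x)
  Regular-conjugate {s} {x} s-hom s² p y e = begin
    y         ≈⟨ s² y ⟨
    s (s y)   ≈⟨ ⟦⟧-cong (p (s y) (begin
      x * s y            ≈⟨ *-congʳ (s² x) ⟨
      s (s x) * s y      ≈⟨ *-homo (s x) y ⟨
      s (s x * y)        ≈⟨ ⟦⟧-cong e ⟩
      s 0#               ≈⟨ 0#-homo ⟩
      0#                 ∎)) ⟩
    s 0#      ≈⟨ 0#-homo ⟩
    0#        ∎
    where open IsRingHomomorphism s-hom using (*-homo; ⟦⟧-cong; 0#-homo)

  -- ρ plays the role of the reduction modulo ℓ, realised as a substitution.
  record LinearForm (ℓ : Carrier) : Set where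
    field
      ρ : Carrier → Carrier
      ρ-hom : IsRingHomomorphism ρ
      ρℓ≈0 : ρ ℓ ≈ 0#
      factor : ∀ {x} → ρ x ≈ 0# → ℓ ∣ x
      regular : Regular ℓ

    open IsRingHomomorphism ρ-hom using (*-homo; ⟦⟧-cong)

    -- One factor of `ℓ` at a time: modulo `ℓ` the product of `u` and `x` vanishes, and regularity
    -- of `ρ u` forces `ℓ` to divide `x`. Cancelling `ℓ` on both sides lowers the exponent.
    coprime-∣ : ∀ {u} → Regular (ρ u) → ∀ k {x y} → u * x ≈ ℓ ^ k * y → ℓ ^ k ∣ x
    coprime-∣ r zero {x} e = x , sym (*-identityˡ x)
    coprime-∣ {u} r (suc k) {x} {y} e =
      let v , x≈ℓv = factor (r (ρ x) (begin
            ρ u * ρ x             ≈⟨ *-homo u x ⟨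
            ρ (u * x)             ≈⟨ ⟦⟧-cong (trans e (*-assoc ℓ (ℓ ^ k) y)) ⟩
            ρ (ℓ * (ℓ ^ k * y))   ≈⟨ *-homo ℓ _ ⟩
            ρ ℓ * ρ (ℓ ^ k * y)   ≈⟨ *-congʳ ρℓ≈0 ⟩
            0# * ρ (ℓ ^ k * y)    ≈⟨ zeroˡ _ ⟩
            0#                    ∎))
          w , v≈ℓw = coprime-∣ r k (Regular-cancel regular (begin
            ℓ * (u * v)         ≈⟨ *-assoc ℓ u v ⟨
            ℓ * u * v           ≈⟨ *-congʳ (*-comm ℓ u) ⟩
            u * ℓ * v           ≈⟨ *-assoc u ℓ v ⟩
            u * (ℓ * v)         ≈⟨ *-congˡ x≈ℓv ⟨
            u * x               ≈⟨ e ⟩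
            ℓ * ℓ ^ k * y       ≈⟨ *-assoc ℓ (ℓ ^ k) y ⟩
            ℓ * (ℓ ^ k * y)     ∎))
      in w , trans x≈ℓv (trans (*-congˡ v≈ℓw) (sym (*-assoc ℓ (ℓ ^ k) w)))

    -- An invariant factor comes out of the difference: x - s x = u (y - s y), so coprimality of `u`
    -- and `ℓ` moves the divisibility to `y`.
    coprime-difference : ∀ {s u} → IsRingHomomorphism s → s u ≈ u → Regular (ρ u) → ∀ k {x y} → x ≈ u * y →
      ℓ ^ k ∣ (x - s x) → ℓ ^ k ∣ (y - s y)
    coprime-difference {s} {u} s-hom su r k {x} {y} e (v , q) = coprime-∣ r k (begin
      u * (y - s y)           ≈⟨ distribˡ u y (- s y) ⟩
      u * y + u * - s y       ≈⟨ +-congˡ (-‿distribʳ-* u (s y)) ⟨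
      u * y - u * s y         ≈⟨ +-congˡ (-‿cong (*-congʳ su)) ⟨
      u * y - s u * s y       ≈⟨ +-congˡ (-‿cong (IsRingHomomorphism.*-homo s-hom u y)) ⟨
      u * y - s (u * y)       ≈⟨ +-cong e (-‿cong (IsRingHomomorphism.⟦⟧-cong s-hom e)) ⟨
      x - s x                 ≈⟨ q ⟩
      ℓ ^ k * v               ∎)

  -- Lets the explicit division by x₁ - x₂ serve for the other two forms as well.
  conjugate : ∀ {s ℓ} → IsRingHomomorphism s → (∀ x → s (s x) ≈ x) → LinearForm ℓ → LinearForm (s ℓ)
  conjugate {s} {ℓ} s-hom s² F = record
    { ρ = λ x → s (ρ (s x))
    ; ρ-hom = Composition.isRingHomomorphism trans (Composition.isRingHomomorphism trans s-hom ρ-hom) s-hom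
    ; ρℓ≈0 = trans (⟦⟧-cong (trans (IsRingHomomorphism.⟦⟧-cong ρ-hom (s² ℓ)) ρℓ≈0)) 0#-homo
    ; factor = λ {x} p →
        let u , e = factor {s x} (trans (sym (s² _)) (trans (⟦⟧-cong p) 0#-homo))
        in s u , trans (sym (s² x)) (trans (⟦⟧-cong e) (*-homo ℓ u))
    ; regular = Regular-conjugate s-hom s² regular
    }
    where
    open LinearForm F
    open IsRingHomomorphism s-hom using (*-homo; ⟦⟧-cong; 0#-homo)

  neg-^ : ∀ x n → (- x) ^ (n ℕ.+ n) ≈ x ^ (n ℕ.+ n)
  neg-^ x zero = refl
  neg-^ x (suc n) = begin
    - x * (- x) ^ (n ℕ.+ suc n)        ≡⟨ ≡.cong (λ k → - x * (- x) ^ k) (ℕₚ.+-suc n n) ⟩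
    - x * (- x * (- x) ^ (n ℕ.+ n))    ≈⟨ *-congˡ (*-congˡ (neg-^ x n)) ⟩
    - x * (- x * x ^ (n ℕ.+ n))        ≈⟨ *-assoc (- x) (- x) _ ⟨
    - x * - x * x ^ (n ℕ.+ n)          ≈⟨ *-congʳ (trans (sym (-‿distribˡ-* x (- x))) (trans (-‿cong (sym (-‿distribʳ-* x x))) (⁻¹-involutive (x * x)))) ⟩
    x * x * x ^ (n ℕ.+ n)              ≈⟨ *-assoc x x _ ⟩
    x * (x * x ^ (n ℕ.+ n))            ≡⟨ ≡.cong (λ k → x * x ^ k) (ℕₚ.+-suc n n) ⟨
    x * x ^ (n ℕ.+ suc n)              ∎

  -- The oddness of 2m + 1 is the source of the minus signs in the action on `D₁₂` and `D₂₃`, and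
  -- thus of the antisymmetry of `D`.
  neg-^-odd : ∀ x m → (- x) ^ (2 ℕ.* m ℕ.+ 1) ≈ - (x ^ (2 ℕ.* m ℕ.+ 1))
  neg-^-odd x m rewrite ℕₚ.+-comm (m ℕ.+ (m ℕ.+ 0)) 1 | ℕₚ.+-identityʳ m =
    trans (*-congˡ (neg-^ x m)) (sym (-‿distribˡ-* x _))

  hom-^ : ∀ {s} → IsRingHomomorphism s → ∀ x n → s (x ^ n) ≈ s x ^ n
  hom-^ h x zero = IsRingHomomorphism.1#-homo h
  hom-^ h x (suc n) = trans (IsRingHomomorphism.*-homo h x (x ^ n)) (*-congˡ (hom-^ h x n))

-- Polynomials in three variables

open import Defs
open import Algebra.Properties.CommutativeSemigroup ℕₚ.+-commutativeSemigroup using (interchange)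
open import Data.Bool using (true; false; if_then_else_)
open import Data.Fin using (Fin; zero; suc; #_)
open import Data.List using (List; []; _∷_; _++_; map; length; upTo)
open import Data.List.Membership.Propositional using (_∈_)
open import Data.List.Membership.Propositional.Properties using (∈-++⁺ˡ; ∈-++⁺ʳ; ∈-map⁺; ∈-upTo⁺)
open import Data.List.Properties using (++-assoc; ++-identityʳ; length-++; length-map; length-upTo)
open import Data.List.Relation.Unary.All as All using (All; []; _∷_)
open import Data.List.Relation.Unary.All.Properties using (++⁺; map⁺; concat⁺; all-upTo)
open import Data.List.Relation.Unary.Any using (here; there)
open import Data.Nat using (_+_; _*_; _∸_; _≤_; _<_; z≤n; s≤s)
open import Data.Nat.Solver using () renaming (module +-*-Solver to ℕ-Solver)
open import Function using (_∘_)
open import Relation.Nullary using (¬_; Dec; contradiction)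
open ≡ using (_≢_; refl; sym; trans; cong; cong₂; subst; module ≡-Reasoning)
open ℚ-Solver using (solve; _:+_; _:*_; _:-_; :-_; _:=_; con)
open ℕ-Solver using () renaming (solve to ℕ-solve; _:+_ to _:+ⁿ_; _:*_ to _:*ⁿ_; _:=_ to _:=ⁿ_; con to conⁿ)

-- The linear functional with value h e on x^e.  Congruence of ≈ for every term-wise operation reduces to
-- ≈⇒L below: functionals cannot tell ≈-equal lists apart.
L : (Exp → ℚ) → Poly → ℚ
L h [] = 0ℚ
L h ((q , e) ∷ P) = q ℚ.* h e ℚ.+ L h P

eqExp-sound : ∀ e f → eqExp e f ≡ true → e ≡ f
eqExp-sound (a , b , c) (a' , b' , c') p with a ℕₚ.≟ a' | b ℕₚ.≟ b' | c ℕₚ.≟ c'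
eqExp-sound (a , b , c) (a' , b' , c') p  | yes refl | yes refl | yes refl = refl
eqExp-sound (a , b , c) (a' , b' , c') () | yes refl | yes refl | no _
eqExp-sound (a , b , c) (a' , b' , c') () | yes refl | no _ | _
eqExp-sound (a , b , c) (a' , b' , c') () | no _ | _ | _

eqExp-refl : ∀ e → eqExp e e ≡ true
eqExp-refl (a , b , c) with a ℕₚ.≟ a | b ℕₚ.≟ b | c ℕₚ.≟ c
... | yes _ | yes _ | yes _ = refl
... | yes _ | yes _ | no n = contradiction refl n
... | yes _ | no n | _ = contradiction refl n
... | no n | _ | _ = contradiction refl n

eqExp-false : ∀ e f → eqExp e f ≡ false → e ≢ f
eqExp-false e f p refl with trans (sym (eqExp-refl e)) p
... | ()

eqExp-≢ : ∀ {e f} → e ≢ f → eqExp e f ≡ false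
eqExp-≢ {e} {f} n with eqExp e f in eq
... | true = contradiction (eqExp-sound e f eq) n
... | false = refl

δ : Exp → Exp → ℚ
δ e f = if eqExp f e then 1ℚ else 0ℚ

coeff-L : ∀ P e → coeff P e ≡ L (δ e) P
coeff-L [] e = refl
coeff-L ((q , f) ∷ P) e with eqExp f e
... | true = cong₂ ℚ._+_ (sym (ℚₚ.*-identityʳ q)) (coeff-L P e)
... | false = trans (coeff-L P e) (trans (sym (ℚₚ.+-identityˡ _)) (cong (ℚ._+ L (δ e) P) (sym (ℚₚ.*-zeroʳ q))))

L-cong : ∀ {h k} → (∀ e → h e ≡ k e) → ∀ P → L h P ≡ L k P
L-cong p [] = refl
L-cong p ((q , e) ∷ P) = cong₂ ℚ._+_ (cong (q ℚ.*_) (p e)) (L-cong p P)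

L-zero : ∀ P → L (λ _ → 0ℚ) P ≡ 0ℚ
L-zero [] = refl
L-zero ((q , e) ∷ P) = cong₂ ℚ._+_ (ℚₚ.*-zeroʳ q) (L-zero P)

L-+ : ∀ h k P → L (λ e → h e ℚ.+ k e) P ≡ L h P ℚ.+ L k P
L-+ h k [] = refl
L-+ h k ((q , e) ∷ P) = trans (cong (q ℚ.* (h e ℚ.+ k e) ℚ.+_) (L-+ h k P))
  (solve 5 (λ q x y u v → q :* (x :+ y) :+ (u :+ v) := (q :* x :+ u) :+ (q :* y :+ v)) refl q (h e) (k e) (L h P) (L k P))

L-* : ∀ c h P → L (λ e → c ℚ.* h e) P ≡ c ℚ.* L h P
L-* c h [] = sym (ℚₚ.*-zeroʳ c)
L-* c h ((q , e) ∷ P) = trans (cong (q ℚ.* (c ℚ.* h e) ℚ.+_) (L-* c h P))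
  (solve 4 (λ q c x u → q :* (c :* x) :+ c :* u := c :* (q :* x :+ u)) refl q c (h e) (L h P))

L-⊕ : ∀ h P Q → L h (P ⊕ Q) ≡ L h P ℚ.+ L h Q
L-⊕ h [] Q = sym (ℚₚ.+-identityˡ _)
L-⊕ h ((q , e) ∷ P) Q = trans (cong (q ℚ.* h e ℚ.+_) (L-⊕ h P Q)) (sym (ℚₚ.+-assoc (q ℚ.* h e) (L h P) (L h Q)))

L-· : ∀ h c P → L h (c · P) ≡ c ℚ.* L h P
L-· h c [] = sym (ℚₚ.*-zeroʳ c)
L-· h c ((q , e) ∷ P) = trans (cong (c ℚ.* q ℚ.* h e ℚ.+_) (L-· h c P))
  (solve 4 (λ c q x u → c :* q :* x :+ c :* u := c :* (q :* x :+ u)) refl c q (h e) (L h P))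

private
  -- A list may repeat an exponent, so its terms are regrouped: all terms of one exponent are taken
  -- out together, and they contribute that coefficient times the value of the functional.
  without : Exp → Poly → Poly
  without e [] = []
  without e ((q , f) ∷ P) = if eqExp f e then without e P else (q , f) ∷ without e P

  without-length : ∀ e P → length (without e P) ℕ.≤ length P
  without-length e [] = z≤n
  without-length e ((q , f) ∷ P) with eqExp f e
  ... | true = ℕₚ.m≤n⇒m≤1+n (without-length e P)
  ... | false = s≤s (without-length e P)

  L-without : ∀ h e P → L h P ≡ coeff P e ℚ.* h e ℚ.+ L h (without e P)
  L-without h e [] = sym (trans (ℚₚ.+-identityʳ _) (ℚₚ.*-zeroˡ (h e)))
  L-without h e ((q , f) ∷ P) with eqExp f e in eq
  ... | true rewrite eqExp-sound f e eq = trans (cong (q ℚ.* h e ℚ.+_) (L-without h e P))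
    (solve 4 (λ q c x u → q :* x :+ (c :* x :+ u) := (q :+ c) :* x :+ u) refl q (coeff P e) (h e) (L h (without e P)))
  ... | false = trans (cong (q ℚ.* h f ℚ.+_) (L-without h e P))
    (solve 3 (λ q c u → q :+ (c :+ u) := c :+ (q :+ u)) refl (q ℚ.* h f) (coeff P e ℚ.* h e) (L h (without e P)))

  coeff-without-≡ : ∀ e P → coeff (without e P) e ≡ 0ℚ
  coeff-without-≡ e [] = refl
  coeff-without-≡ e ((q , f) ∷ P) with eqExp f e in eq
  ... | true = coeff-without-≡ e P
  ... | false rewrite eq = coeff-without-≡ e P

  coeff-without-≢ : ∀ e g P → g ≢ e → coeff (without e P) g ≡ coeff P g
  coeff-without-≢ e g [] n = refl
  coeff-without-≢ e g ((q , f) ∷ P) n with eqExp f e in eq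
  ... | true rewrite eqExp-sound f e eq | eqExp-≢ (n ∘ sym) = coeff-without-≢ e g P n
  ... | false with eqExp f g
  ...   | true = cong (q ℚ.+_) (coeff-without-≢ e g P n)
  ...   | false = coeff-without-≢ e g P n

  -- The induction is on a length bound, since removing an exponent from the list does not yield a
  -- subterm.
  L-vanish′ : ∀ n h P → length P ℕ.≤ n → (∀ e → coeff P e ℚ.* h e ≡ 0ℚ) → L h P ≡ 0ℚ
  L-vanish′ n h [] _ v = refl
  L-vanish′ (suc n) h P@((q , e) ∷ P₀) (s≤s le) v =
    trans (L-without h e P) (cong₂ ℚ._+_ (v e) (L-vanish′ n h (without e P) le′ v′))
    where
    le′ : length (without e P) ℕ.≤ n
    le′ rewrite eqExp-refl e = ℕₚ.≤-trans (without-length e P₀) le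
    v′ : ∀ g → coeff (without e P) g ℚ.* h g ≡ 0ℚ
    v′ g with eqExp g e in eq
    ... | true rewrite eqExp-sound g e eq = trans (cong (ℚ._* h e) (coeff-without-≡ e P)) (ℚₚ.*-zeroˡ (h e))
    ... | false = trans (cong (ℚ._* h g) (coeff-without-≢ e g P (eqExp-false g e eq))) (v g)

L-vanish : ∀ h P → (∀ e → coeff P e ℚ.* h e ≡ 0ℚ) → L h P ≡ 0ℚ
L-vanish h P = L-vanish′ (length P) h P ℕₚ.≤-refl

coeff-⊕ : ∀ P Q e → coeff (P ⊕ Q) e ≡ coeff P e ℚ.+ coeff Q e
coeff-⊕ P Q e = trans (coeff-L (P ⊕ Q) e) (trans (L-⊕ (δ e) P Q) (sym (cong₂ ℚ._+_ (coeff-L P e) (coeff-L Q e))))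

coeff-· : ∀ c P e → coeff (c · P) e ≡ c ℚ.* coeff P e
coeff-· c P e = trans (coeff-L (c · P) e) (trans (L-· (δ e) c P) (cong (c ℚ.*_) (sym (coeff-L P e))))

coeff-⊖ : ∀ P Q e → coeff (P ⊖ Q) e ≡ coeff P e ℚ.- coeff Q e
coeff-⊖ P Q e = trans (coeff-⊕ P ((ℚ.- 1ℚ) · Q) e) (cong (coeff P e ℚ.+_)
  (trans (coeff-· (ℚ.- 1ℚ) Q e) (solve 1 (λ x → con (ℚ.- 1ℚ) :* x := :- x) refl (coeff Q e))))

L-⊖ : ∀ h P Q → L h (P ⊖ Q) ≡ L h P ℚ.- L h Q
L-⊖ h P Q = trans (L-⊕ h P ((ℚ.- 1ℚ) · Q)) (cong (L h P ℚ.+_)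
  (trans (L-· h (ℚ.- 1ℚ) Q) (solve 1 (λ x → con (ℚ.- 1ℚ) :* x := :- x) refl (L h Q))))

x-y≡0⇒x≡y : ∀ x y → x ℚ.- y ≡ 0ℚ → x ≡ y
x-y≡0⇒x≡y x y p = trans (solve 2 (λ x y → x := (x :+ :- y) :+ y) refl x y) (trans (cong (ℚ._+ y) p) (ℚₚ.+-identityˡ y))

≈⇒L : ∀ P Q → P ≈ Q → ∀ h → L h P ≡ L h Q
≈⇒L P Q p h = x-y≡0⇒x≡y _ _ (trans (sym (L-⊖ h P Q)) (L-vanish h (P ⊖ Q) λ e →
  trans (cong (ℚ._* h e) (trans (coeff-⊖ P Q e) (trans (cong (ℚ._- coeff Q e) (p e)) (ℚₚ.+-inverseʳ (coeff Q e))))) (ℚₚ.*-zeroˡ (h e))))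

L⇒≈ : ∀ P Q → (∀ h → L h P ≡ L h Q) → P ≈ Q
L⇒≈ P Q p e = trans (coeff-L P e) (trans (p (δ e)) (sym (coeff-L Q e)))

L-map : ∀ h k (F : ℚ × Exp → ℚ × Exp) →
  (∀ q e → proj₁ (F (q , e)) ℚ.* h (proj₂ (F (q , e))) ≡ q ℚ.* k e) → ∀ P → L h (map F P) ≡ L k P
L-map h k F p [] = refl
L-map h k F p ((q , e) ∷ P) = cong₂ ℚ._+_ (p q e) (L-map h k F p P)

L-⊗ : ∀ h P Q → L h (P ⊗ Q) ≡ L (λ e → L (λ f → h (addExp e f)) Q) P
L-⊗ h [] Q = refl
L-⊗ h ((q , e) ∷ P) Q = trans (L-⊕ h (map _ Q) (P ⊗ Q)) (cong₂ ℚ._+_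
  (trans (L-map h (λ f → q ℚ.* h (addExp e f)) _
      (λ r f → solve 3 (λ q r x → q :* r :* x := r :* (q :* x)) refl q r (h (addExp e f))) Q)
    (L-* q _ Q))
  (L-⊗ h P Q))

L-swap : ∀ (H : Exp → Exp → ℚ) P Q → L (λ e → L (H e) Q) P ≡ L (λ f → L (λ e → H e f) P) Q
L-swap H [] Q = sym (L-zero Q)
L-swap H ((q , e) ∷ P) Q = trans (cong₂ ℚ._+_ (sym (L-* q (H e) Q)) (L-swap H P Q)) (sym (L-+ _ _ Q))

addExp-comm : ∀ e f → addExp e f ≡ addExp f e
addExp-comm (a , b , c) (a' , b' , c') = cong₂ _,_ (ℕₚ.+-comm a a') (cong₂ _,_ (ℕₚ.+-comm b b') (ℕₚ.+-comm c c'))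

addExp-assoc : ∀ e f g → addExp (addExp e f) g ≡ addExp e (addExp f g)
addExp-assoc (a , b , c) (a' , b' , c') (a″ , b″ , c″) =
  cong₂ _,_ (ℕₚ.+-assoc a a' a″) (cong₂ _,_ (ℕₚ.+-assoc b b' b″) (ℕₚ.+-assoc c c' c″))

⊕-cong : ∀ P P' Q Q' → P ≈ P' → Q ≈ Q' → P ⊕ Q ≈ P' ⊕ Q'
⊕-cong P P' Q Q' p q e = trans (coeff-⊕ P Q e) (trans (cong₂ ℚ._+_ (p e) (q e)) (sym (coeff-⊕ P' Q' e)))

·-cong : ∀ c P P' → P ≈ P' → c · P ≈ c · P'
·-cong c P P' p e = trans (coeff-· c P e) (trans (cong (c ℚ.*_) (p e)) (sym (coeff-· c P' e)))

⊗-comm : ∀ P Q → P ⊗ Q ≈ Q ⊗ P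
⊗-comm P Q = L⇒≈ (P ⊗ Q) (Q ⊗ P) λ h → trans (L-⊗ h P Q) (trans (L-swap _ P Q)
  (trans (L-cong (λ f → L-cong (λ e → cong h (addExp-comm e f)) P) Q) (sym (L-⊗ h Q P))))

⊗-cong : ∀ P P' Q Q' → P ≈ P' → Q ≈ Q' → P ⊗ Q ≈ P' ⊗ Q'
⊗-cong P P' Q Q' p q = L⇒≈ (P ⊗ Q) (P' ⊗ Q') λ h → trans (L-⊗ h P Q)
  (trans (≈⇒L P P' p _) (trans (L-cong (λ e → ≈⇒L Q Q' q _) P') (sym (L-⊗ h P' Q'))))

⊗-assoc : ∀ P Q R → (P ⊗ Q) ⊗ R ≈ P ⊗ (Q ⊗ R)
⊗-assoc P Q R = L⇒≈ ((P ⊗ Q) ⊗ R) (P ⊗ (Q ⊗ R)) λ h → begin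
  L h ((P ⊗ Q) ⊗ R)                                              ≡⟨ L-⊗ h (P ⊗ Q) R ⟩
  L (λ g → L (λ k → h (addExp g k)) R) (P ⊗ Q)                    ≡⟨ L-⊗ _ P Q ⟩
  L (λ e → L (λ f → L (λ k → h (addExp (addExp e f) k)) R) Q) P   ≡⟨ L-cong (λ e → L-cong (λ f → L-cong (λ k → cong h (addExp-assoc e f k)) R) Q) P ⟩
  L (λ e → L (λ f → L (λ k → h (addExp e (addExp f k))) R) Q) P   ≡⟨ L-cong (λ e → L-⊗ _ Q R) P ⟨
  L (λ e → L (λ f → h (addExp e f)) (Q ⊗ R)) P                    ≡⟨ L-⊗ h P (Q ⊗ R) ⟨
  L h (P ⊗ (Q ⊗ R)) ∎
  where open ≡-Reasoning

⊗-distribʳ : ∀ P Q R → (Q ⊕ R) ⊗ P ≈ Q ⊗ P ⊕ R ⊗ P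
⊗-distribʳ P Q R = L⇒≈ ((Q ⊕ R) ⊗ P) (Q ⊗ P ⊕ R ⊗ P) λ h → trans (L-⊗ h (Q ⊕ R) P) (trans (L-⊕ _ Q R)
  (trans (sym (cong₂ ℚ._+_ (L-⊗ h Q P) (L-⊗ h R P))) (sym (L-⊕ h (Q ⊗ P) (R ⊗ P)))))

⊗-identityˡ : ∀ P → oneP ⊗ P ≈ P
⊗-identityˡ P = L⇒≈ (oneP ⊗ P) P λ h → trans (L-⊗ h oneP P)
  (solve 1 (λ x → con 1ℚ :* x :+ con 0ℚ := x) refl (L h P))

⊕-comm : ∀ P Q → P ⊕ Q ≈ Q ⊕ P
⊕-comm P Q e = trans (coeff-⊕ P Q e) (trans (ℚₚ.+-comm (coeff P e) (coeff Q e)) (sym (coeff-⊕ Q P e)))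

⊖-inverseʳ : ∀ P → P ⊖ P ≈ zeroP
⊖-inverseʳ P e = trans (coeff-⊖ P P e) (ℚₚ.+-inverseʳ (coeff P e))

⊗-identityʳ : ∀ P → P ⊗ oneP ≈ P
⊗-identityʳ P e = trans (⊗-comm P oneP e) (⊗-identityˡ P e)

⊗-distribˡ : ∀ P Q R → P ⊗ (Q ⊕ R) ≈ P ⊗ Q ⊕ P ⊗ R
⊗-distribˡ P Q R e = trans (⊗-comm P (Q ⊕ R) e) (trans (⊗-distribʳ P Q R e)
  (⊕-cong (Q ⊗ P) (P ⊗ Q) (R ⊗ P) (P ⊗ R) (⊗-comm Q P) (⊗-comm R P) e))

-- The polynomial ring and its reflections

polyRing : CommutativeRing 0ℓ 0ℓ
polyRing = record
  { Carrier = Poly ; _≈_ = _≈_ ; _+_ = _⊕_ ; _*_ = _⊗_ ; -_ = (ℚ.- 1ℚ) ·_ ; 0# = zeroP ; 1# = oneP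
  ; isCommutativeRing = record
    { isRing = record
      { +-isAbelianGroup = record
        { isGroup = record
          { isMonoid = record
            { isSemigroup = record
              { isMagma = record
                { isEquivalence = record
                  { refl = λ e → refl ; sym = λ p e → sym (p e) ; trans = λ p q e → trans (p e) (q e) }
                ; ∙-cong = λ {P} {P'} {Q} {Q'} → ⊕-cong P P' Q Q' }
              ; assoc = λ P Q R e → cong (λ S → coeff S e) (++-assoc P Q R) }
            ; identity = (λ P e → refl) , (λ P e → cong (λ S → coeff S e) (++-identityʳ P)) }
          ; inverse = (λ P e → trans (⊕-comm ((ℚ.- 1ℚ) · P) P e) (⊖-inverseʳ P e)) , ⊖-inverseʳ
          ; ⁻¹-cong = λ {P} {P'} → ·-cong (ℚ.- 1ℚ) P P' }
        ; comm = ⊕-comm }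
      ; *-cong = λ {P} {P'} {Q} {Q'} → ⊗-cong P P' Q Q'
      ; *-assoc = ⊗-assoc
      ; *-identity = ⊗-identityˡ , ⊗-identityʳ
      ; distrib = ⊗-distribˡ , ⊗-distribʳ }
    ; *-comm = ⊗-comm } }

module Rₚ = CommutativeRing polyRing
open RingMorphisms Rₚ.rawRing Rₚ.rawRing using (IsRingHomomorphism)
open Divisibility polyRing using (Regular; Regular-*; Regular-^; Regular-conjugate; LinearForm; conjugate; neg-^-odd; hom-^)
open Algebra.Properties.Semiring.Exp Rₚ.semiring using () renaming (_^_ to _^ᴿ_; ^-congˡ to ^ᴿ-congˡ)

-- An additive map of exponents that fixes 0 induces a ring homomorphism of the monoid algebra. The
-- three reflections and the substitution x₂ := x₁ are of this kind.
exponent-hom : (s : Poly → Poly) (f : Exp → Exp) → (∀ h P → L h (s P) ≡ L (h ∘ f) P) →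
  (∀ e g → f (addExp e g) ≡ addExp (f e) (f g)) → f (0 , 0 , 0) ≡ (0 , 0 , 0) → IsRingHomomorphism s
exponent-hom s f Ls f-add f-0 = record
  { isSemiringHomomorphism = record
    { isNearSemiringHomomorphism = record
      { +-isMonoidHomomorphism = record
        { isMagmaHomomorphism = record
          { isRelHomomorphism = record
            { cong = λ {P} {Q} p → L⇒≈ (s P) (s Q) λ h → trans (Ls h P) (trans (≈⇒L P Q p (h ∘ f)) (sym (Ls h Q))) }
          ; homo = λ P Q → L⇒≈ (s (P ⊕ Q)) (s P ⊕ s Q) λ h → trans (Ls h (P ⊕ Q)) (trans (L-⊕ (h ∘ f) P Q)
              (trans (sym (cong₂ ℚ._+_ (Ls h P) (Ls h Q))) (sym (L-⊕ h (s P) (s Q))))) }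
        ; ε-homo = L⇒≈ (s zeroP) zeroP λ h → Ls h zeroP }
      ; *-homo = λ P Q → L⇒≈ (s (P ⊗ Q)) (s P ⊗ s Q) λ h → begin
          L h (s (P ⊗ Q))                                ≡⟨ Ls h (P ⊗ Q) ⟩
          L (h ∘ f) (P ⊗ Q)                              ≡⟨ L-⊗ (h ∘ f) P Q ⟩
          L (λ e → L (λ g → h (f (addExp e g))) Q) P      ≡⟨ L-cong (λ e → L-cong (λ g → cong h (f-add e g)) Q) P ⟩
          L (λ e → L (λ g → h (addExp (f e) (f g))) Q) P  ≡⟨ L-cong (λ e → Ls _ Q) P ⟨
          L (λ e → L (λ g → h (addExp (f e) g)) (s Q)) P  ≡⟨ Ls _ P ⟨
          L (λ e → L (λ g → h (addExp e g)) (s Q)) (s P)  ≡⟨ L-⊗ h (s P) (s Q) ⟨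
          L h (s P ⊗ s Q)                                ∎ }
    ; 1#-homo = L⇒≈ (s oneP) oneP λ h → trans (Ls h oneP) (cong (λ e → 1ℚ ℚ.* h e ℚ.+ 0ℚ) f-0) }
  ; -‿homo = λ P → L⇒≈ (s ((ℚ.- 1ℚ) · P)) ((ℚ.- 1ℚ) · s P) λ h → trans (Ls h ((ℚ.- 1ℚ) · P))
      (trans (L-· (h ∘ f) (ℚ.- 1ℚ) P) (trans (cong (ℚ.- 1ℚ ℚ.*_) (sym (Ls h P))) (sym (L-· h (ℚ.- 1ℚ) (s P))))) }
  where open ≡-Reasoning

sw₁₂ sw₁₃ sw₂₃ : Exp → Exp
sw₁₂ (a , b , c) = (b , a , c)
sw₁₃ (a , b , c) = (c , b , a)
sw₂₃ (a , b , c) = (a , c , b)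

L-s₁₂ : ∀ h P → L h (s₁₂ P) ≡ L (h ∘ sw₁₂) P
L-s₁₂ h = L-map h (h ∘ sw₁₂) _ (λ q e → refl)

L-s₁₃ : ∀ h P → L h (s₁₃ P) ≡ L (h ∘ sw₁₃) P
L-s₁₃ h = L-map h (h ∘ sw₁₃) _ (λ q e → refl)

L-s₂₃ : ∀ h P → L h (s₂₃ P) ≡ L (h ∘ sw₂₃) P
L-s₂₃ h = L-map h (h ∘ sw₂₃) _ (λ q e → refl)

s₁₂-hom : IsRingHomomorphism s₁₂
s₁₂-hom = exponent-hom s₁₂ sw₁₂ L-s₁₂ (λ e g → refl) refl

s₁₃-hom : IsRingHomomorphism s₁₃
s₁₃-hom = exponent-hom s₁₃ sw₁₃ L-s₁₃ (λ e g → refl) refl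

s₂₃-hom : IsRingHomomorphism s₂₃
s₂₃-hom = exponent-hom s₂₃ sw₂₃ L-s₂₃ (λ e g → refl) refl

s₁₂² : ∀ P → s₁₂ (s₁₂ P) ≈ P
s₁₂² P = L⇒≈ (s₁₂ (s₁₂ P)) P λ h → trans (L-s₁₂ h (s₁₂ P)) (L-s₁₂ (h ∘ sw₁₂) P)

s₁₃² : ∀ P → s₁₃ (s₁₃ P) ≈ P
s₁₃² P = L⇒≈ (s₁₃ (s₁₃ P)) P λ h → trans (L-s₁₃ h (s₁₃ P)) (L-s₁₃ (h ∘ sw₁₃) P)

s₂₃² : ∀ P → s₂₃ (s₂₃ P) ≈ P
s₂₃² P = L⇒≈ (s₂₃ (s₂₃ P)) P λ h → trans (L-s₂₃ h (s₂₃ P)) (L-s₂₃ (h ∘ sw₂₃) P)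

s₁₃s₁₂ : ∀ P → s₁₃ (s₁₂ P) ≈ s₁₂ (s₂₃ P)
s₁₃s₁₂ P = L⇒≈ (s₁₃ (s₁₂ P)) (s₁₂ (s₂₃ P)) λ h → trans (trans (L-s₁₃ h (s₁₂ P)) (L-s₁₂ (h ∘ sw₁₃) P)) (sym (trans (L-s₁₂ h (s₂₃ P)) (L-s₂₃ (h ∘ sw₁₂) P)))

s₂₃s₁₃ : ∀ P → s₂₃ (s₁₃ P) ≈ s₁₂ (s₂₃ P)
s₂₃s₁₃ P = L⇒≈ (s₂₃ (s₁₃ P)) (s₁₂ (s₂₃ P)) λ h → trans (trans (L-s₂₃ h (s₁₃ P)) (L-s₁₃ (h ∘ sw₂₃) P)) (sym (trans (L-s₁₂ h (s₂₃ P)) (L-s₂₃ (h ∘ sw₁₂) P)))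

s₁₃s₂₃ : ∀ P → s₁₃ (s₂₃ P) ≈ s₁₂ (s₁₃ P)
s₁₃s₂₃ P = L⇒≈ (s₁₃ (s₂₃ P)) (s₁₂ (s₁₃ P)) λ h → trans (trans (L-s₁₃ h (s₂₃ P)) (L-s₂₃ (h ∘ sw₁₃) P)) (sym (trans (L-s₁₂ h (s₁₃ P)) (L-s₁₃ (h ∘ sw₁₂) P)))

s₂₃s₁₂ : ∀ P → s₂₃ (s₁₂ P) ≈ s₁₂ (s₁₃ P)
s₂₃s₁₂ P = L⇒≈ (s₂₃ (s₁₂ P)) (s₁₂ (s₁₃ P)) λ h → trans (trans (L-s₂₃ h (s₁₂ P)) (L-s₁₂ (h ∘ sw₂₃) P)) (sym (trans (L-s₁₂ h (s₁₃ P)) (L-s₁₃ (h ∘ sw₁₂) P)))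

scalar : ℚ → Poly
scalar q = mono q 0 0 0

L-scalar⊗ : ∀ h q P → L h (scalar q ⊗ P) ≡ q ℚ.* L h P
L-scalar⊗ h q P = trans (L-⊗ h (scalar q) P) (ℚₚ.+-identityʳ (q ℚ.* L h P))

·≈scalar⊗ : ∀ q P → q · P ≈ scalar q ⊗ P
·≈scalar⊗ q P = L⇒≈ (q · P) (scalar q ⊗ P) λ h → trans (L-· h q P) (sym (L-scalar⊗ h q P))

scalars : CommutativeRing.rawRing ℚₚ.+-*-commutativeRing -Raw-AlmostCommutative⟶ fromCommutativeRing polyRing
scalars = record
  { ⟦_⟧ = scalar
  ; +-homo = λ q r → L⇒≈ (scalar (q ℚ.+ r)) (scalar q ⊕ scalar r) λ h →
      solve 3 (λ q r x → (q :+ r) :* x :+ con 0ℚ := q :* x :+ (r :* x :+ con 0ℚ)) refl q r (h (0 , 0 , 0))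
  ; *-homo = λ q r e → refl
  ; -‿homo = λ q → L⇒≈ (scalar (ℚ.- q)) ((ℚ.- 1ℚ) · scalar q) λ h →
      solve 2 (λ q x → (:- q) :* x :+ con 0ℚ := con (ℚ.- 1ℚ) :* q :* x :+ con 0ℚ) refl q (h (0 , 0 , 0))
  ; 0-homo = L⇒≈ (scalar 0ℚ) zeroP λ h → solve 1 (λ x → con 0ℚ :* x :+ con 0ℚ := con 0ℚ) refl (h (0 , 0 , 0))
  ; 1-homo = λ e → refl
  }

-- The linear forms x_i - x_j

δ-≢ : ∀ {e f} → f ≢ e → δ e f ≡ 0ℚ
δ-≢ n rewrite eqExp-≢ n = refl

δ-injective : ∀ (s : Exp → Exp) → (∀ {e f} → s e ≡ s f → e ≡ f) → ∀ e f → δ (s e) (s f) ≡ δ e f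
δ-injective s inj e f with eqExp f e in eq
... | true rewrite eqExp-sound f e eq | eqExp-refl (s e) = refl
... | false rewrite eqExp-≢ (eqExp-false f e eq ∘ inj) = refl

suc₁ suc₂ : Exp → Exp
suc₁ (a , b , c) = (suc a , b , c)
suc₂ (a , b , c) = (a , suc b , c)

δ-suc₁ : ∀ e f → δ (suc₁ e) (suc₁ f) ≡ δ e f
δ-suc₁ = δ-injective suc₁ (λ { refl → refl })

δ-suc₂ : ∀ e f → δ (suc₂ e) (suc₂ f) ≡ δ e f
δ-suc₂ = δ-injective suc₂ (λ { refl → refl })

coeff-x₁⊗ : ∀ P e → coeff (x₁ ⊗ P) (suc₁ e) ≡ coeff P e
coeff-x₁⊗ P e = begin
  coeff (x₁ ⊗ P) (suc₁ e)                      ≡⟨ coeff-L (x₁ ⊗ P) (suc₁ e) ⟩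
  L (δ (suc₁ e)) (x₁ ⊗ P)                      ≡⟨ L-⊗ (δ (suc₁ e)) x₁ P ⟩
  1ℚ ℚ.* L (δ (suc₁ e) ∘ suc₁) P ℚ.+ 0ℚ        ≡⟨ solve 1 (λ x → con 1ℚ :* x :+ con 0ℚ := x) refl (L (δ (suc₁ e) ∘ suc₁) P) ⟩
  L (δ (suc₁ e) ∘ suc₁) P                      ≡⟨ L-cong (δ-suc₁ e) P ⟩
  L (δ e) P                                    ≡⟨ coeff-L P e ⟨
  coeff P e                                    ∎
  where open ≡-Reasoning

x₁-regular : Regular x₁
x₁-regular P p e = trans (sym (coeff-x₁⊗ P e)) (p (suc₁ e))

x₂-regular : Regular x₂
x₂-regular = Regular-conjugate {s₁₂} {x₁} s₁₂-hom s₁₂² x₁-regular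

x₃-regular : Regular x₃
x₃-regular = Regular-conjugate {s₁₃} {x₁} s₁₃-hom s₁₃² x₁-regular

L-x₁⊖x₂ : ∀ h P → L h ((x₁ ⊖ x₂) ⊗ P) ≡ L (h ∘ suc₁) P ℚ.- L (h ∘ suc₂) P
L-x₁⊖x₂ h P = trans (L-⊗ h (x₁ ⊖ x₂) P)
  (solve 2 (λ u v → con 1ℚ :* u :+ (con (ℚ.- 1ℚ) :* con 1ℚ :* v :+ con 0ℚ) := u :- v) refl (L (h ∘ suc₁) P) (L (h ∘ suc₂) P))

-- If the product is 0, coefficients are constant along the antidiagonals (a, b), (a+1, b-1), ...;
-- such a line leaves the quadrant below b = 0, where the coefficient is 0.
x₁⊖x₂-regular : Regular (x₁ ⊖ x₂)
x₁⊖x₂-regular P p (a , b , c) = vanish b a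
  where
  expand : ∀ e → L (δ e ∘ suc₁) P ℚ.- L (δ e ∘ suc₂) P ≡ 0ℚ
  expand e = trans (sym (L-x₁⊖x₂ (δ e) P)) (trans (sym (coeff-L ((x₁ ⊖ x₂) ⊗ P) e)) (p e))
  shift : ∀ e → coeff P e ≡ L (δ (suc₁ e) ∘ suc₂) P
  shift e = trans (coeff-L P e) (trans (sym (L-cong (δ-suc₁ e) P)) (x-y≡0⇒x≡y _ _ (expand (suc₁ e))))
  vanish : ∀ b a → coeff P (a , b , c) ≡ 0ℚ
  vanish zero a = trans (shift (a , 0 , c)) (trans (L-cong (λ e → δ-≢ {suc a , 0 , c} {suc₂ e} λ ()) P) (L-zero P))
  vanish (suc b) a = trans (shift (a , suc b , c)) (trans (L-cong (δ-suc₂ (suc a , b , c)) P)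
    (trans (sym (coeff-L P (suc a , b , c))) (vanish b (suc a))))

-- The substitution x₂ := x₁ on exponents; it realises reduction modulo x₁ - x₂.
merge₁₂ : Exp → Exp
merge₁₂ (a , b , c) = (a + b , 0 , c)

ρ₁₂ : Poly → Poly
ρ₁₂ = map (λ t → proj₁ t , merge₁₂ (proj₂ t))

L-ρ₁₂ : ∀ h P → L h (ρ₁₂ P) ≡ L (h ∘ merge₁₂) P
L-ρ₁₂ h = L-map h (h ∘ merge₁₂) _ (λ q e → refl)

ρ₁₂-hom : IsRingHomomorphism ρ₁₂
ρ₁₂-hom = exponent-hom ρ₁₂ merge₁₂ L-ρ₁₂
  (λ (a , b , c) (a' , b' , c') → cong (_, 0 , c + c') (interchange a a' b b')) refl

-- The telescoping quotient of q (x₁^a x₂^b - x₁^(a+b)) x₃^c by x₁ - x₂; the sign comes from the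
-- order of the difference.
termQuotient : ℚ → ℕ → ℕ → ℕ → Poly
termQuotient q a zero c = []
termQuotient q a (suc b) c = (ℚ.- q , a , b , c) ∷ termQuotient q (suc a) b c

quotient : Poly → Poly
quotient [] = []
quotient ((q , a , b , c) ∷ P) = termQuotient q a b c ⊕ quotient P

L-termQuotient : ∀ h q a b c → L h ((x₁ ⊖ x₂) ⊗ termQuotient q a b c) ≡ q ℚ.* h (a , b , c) ℚ.- q ℚ.* h (a + b , 0 , c)
L-termQuotient h q a zero c rewrite ℕₚ.+-identityʳ a = trans (L-x₁⊖x₂ h []) (sym (ℚₚ.+-inverseʳ (q ℚ.* h (a , 0 , c))))
L-termQuotient h q a (suc b) c = begin
  L h ((x₁ ⊖ x₂) ⊗ termQuotient q a (suc b) c) ≡⟨ L-x₁⊖x₂ h (termQuotient q a (suc b) c) ⟩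
  ((ℚ.- q) ℚ.* h (suc a , b , c) ℚ.+ L (h ∘ suc₁) T) ℚ.- ((ℚ.- q) ℚ.* h (a , suc b , c) ℚ.+ L (h ∘ suc₂) T)
    ≡⟨ solve 5 (λ q x y u v → ((:- q) :* x :+ u) :- ((:- q) :* y :+ v) := q :* y :- q :* x :+ (u :- v)) refl q (h (suc a , b , c)) (h (a , suc b , c)) (L (h ∘ suc₁) T) (L (h ∘ suc₂) T) ⟩
  q ℚ.* h (a , suc b , c) ℚ.- q ℚ.* h (suc a , b , c) ℚ.+ (L (h ∘ suc₁) T ℚ.- L (h ∘ suc₂) T)
    ≡⟨ cong (q ℚ.* h (a , suc b , c) ℚ.- q ℚ.* h (suc a , b , c) ℚ.+_) (trans (sym (L-x₁⊖x₂ h T)) (L-termQuotient h q (suc a) b c)) ⟩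
  q ℚ.* h (a , suc b , c) ℚ.- q ℚ.* h (suc a , b , c) ℚ.+ (q ℚ.* h (suc a , b , c) ℚ.- q ℚ.* h (suc a + b , 0 , c))
    ≡⟨ solve 3 (λ x y z → x :- y :+ (y :- z) := x :- z) refl (q ℚ.* h (a , suc b , c)) (q ℚ.* h (suc a , b , c)) (q ℚ.* h (suc a + b , 0 , c)) ⟩
  q ℚ.* h (a , suc b , c) ℚ.- q ℚ.* h (suc a + b , 0 , c)
    ≡⟨ cong (λ k → q ℚ.* h (a , suc b , c) ℚ.- q ℚ.* h (k , 0 , c)) (sym (ℕₚ.+-suc a b)) ⟩
  q ℚ.* h (a , suc b , c) ℚ.- q ℚ.* h (a + suc b , 0 , c) ∎
  where
  open ≡-Reasoning
  T = termQuotient q (suc a) b c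

L-quotient : ∀ h P → L h ((x₁ ⊖ x₂) ⊗ quotient P) ≡ L h P ℚ.- L (h ∘ merge₁₂) P
L-quotient h [] = trans (L-x₁⊖x₂ h []) refl
L-quotient h ((q , a , b , c) ∷ P) = begin
  L h ((x₁ ⊖ x₂) ⊗ (T ⊕ quotient P))
    ≡⟨ ≈⇒L ((x₁ ⊖ x₂) ⊗ (T ⊕ quotient P)) ((x₁ ⊖ x₂) ⊗ T ⊕ (x₁ ⊖ x₂) ⊗ quotient P) (⊗-distribˡ (x₁ ⊖ x₂) T (quotient P)) h ⟩
  L h ((x₁ ⊖ x₂) ⊗ T ⊕ (x₁ ⊖ x₂) ⊗ quotient P)
    ≡⟨ L-⊕ h ((x₁ ⊖ x₂) ⊗ T) ((x₁ ⊖ x₂) ⊗ quotient P) ⟩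
  L h ((x₁ ⊖ x₂) ⊗ T) ℚ.+ L h ((x₁ ⊖ x₂) ⊗ quotient P)
    ≡⟨ cong₂ ℚ._+_ (L-termQuotient h q a b c) (L-quotient h P) ⟩
  (q ℚ.* h (a , b , c) ℚ.- q ℚ.* h (a + b , 0 , c)) ℚ.+ (L h P ℚ.- L (h ∘ merge₁₂) P)
    ≡⟨ solve 4 (λ x y u v → (x :- y) :+ (u :- v) := (x :+ u) :- (y :+ v)) refl (q ℚ.* h (a , b , c)) (q ℚ.* h (a + b , 0 , c)) (L h P) (L (h ∘ merge₁₂) P) ⟩
  (q ℚ.* h (a , b , c) ℚ.+ L h P) ℚ.- (q ℚ.* h (a + b , 0 , c) ℚ.+ L (h ∘ merge₁₂) P) ∎
  where
  open ≡-Reasoning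
  T = termQuotient q a b c

linear₁₂ : LinearForm (x₁ ⊖ x₂)
linear₁₂ = record
  { ρ = ρ₁₂
  ; ρ-hom = ρ₁₂-hom
  ; ρℓ≈0 = L⇒≈ (ρ₁₂ (x₁ ⊖ x₂)) zeroP λ h →
      solve 1 (λ x → con 1ℚ :* x :+ (con (ℚ.- 1ℚ) :* con 1ℚ :* x :+ con 0ℚ) := con 0ℚ) refl (h (1 , 0 , 0))
  ; factor = λ {P} p → quotient P , L⇒≈ P ((x₁ ⊖ x₂) ⊗ quotient P) λ h → sym (trans (L-quotient h P)
      (trans (cong (λ x → L h P ℚ.- x) (trans (sym (L-ρ₁₂ h P)) (≈⇒L (ρ₁₂ P) zeroP p h))) (solve 1 (λ x → x :- con 0ℚ := x) refl (L h P))))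
  ; regular = x₁⊖x₂-regular
  }

linear₁₃ : LinearForm (x₁ ⊖ x₃)
linear₁₃ = conjugate {s₂₃} {x₁ ⊖ x₂} s₂₃-hom s₂₃² linear₁₂

linear₂₃ : LinearForm (x₂ ⊖ x₃)
linear₂₃ = conjugate {s₁₂} {x₁ ⊖ x₃} s₁₂-hom s₁₂² linear₁₃

^≡^ᴿ : ∀ P n → P ^ n ≡ P ^ᴿ n
^≡^ᴿ P zero = refl
^≡^ᴿ P (suc n) = cong (P ⊗_) (^≡^ᴿ P n)

-- As a functional this takes the constant term. Being evaluation at the origin, it is
-- multiplicative, and it kills each e_i.
ε : Exp → ℚ
ε (0 , 0 , 0) = 1ℚ
ε _ = 0ℚ

ε-addExp : ∀ e f → ε (addExp e f) ≡ ε e ℚ.* ε f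
ε-addExp (0 , 0 , 0) f = sym (ℚₚ.*-identityˡ (ε f))
ε-addExp (0 , 0 , suc c) (0 , 0 , c') = sym (ℚₚ.*-zeroˡ (ε (0 , 0 , c')))
ε-addExp (0 , 0 , suc c) (0 , suc b' , c') = sym (ℚₚ.*-zeroˡ (ε (0 , suc b' , c')))
ε-addExp (0 , 0 , suc c) (suc a' , b' , c') = sym (ℚₚ.*-zeroˡ (ε (suc a' , b' , c')))
ε-addExp (0 , suc b , c) (0 , b' , c') = sym (ℚₚ.*-zeroˡ (ε (0 , b' , c')))
ε-addExp (0 , suc b , c) (suc a' , b' , c') = sym (ℚₚ.*-zeroˡ (ε (suc a' , b' , c')))
ε-addExp (suc a , b , c) f = sym (ℚₚ.*-zeroˡ (ε f))

L-ε-⊗ : ∀ P Q → L ε (P ⊗ Q) ≡ L ε P ℚ.* L ε Q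
L-ε-⊗ P Q = begin
  L ε (P ⊗ Q)                                   ≡⟨ L-⊗ ε P Q ⟩
  L (λ e → L (λ f → ε (addExp e f)) Q) P         ≡⟨ L-cong (λ e → trans (L-cong (ε-addExp e) Q) (L-* (ε e) ε Q)) P ⟩
  L (λ e → ε e ℚ.* L ε Q) P                      ≡⟨ L-cong (λ e → ℚₚ.*-comm (ε e) (L ε Q)) P ⟩
  L (λ e → L ε Q ℚ.* ε e) P                      ≡⟨ L-* (L ε Q) ε P ⟩
  L ε Q ℚ.* L ε P                                ≡⟨ ℚₚ.*-comm (L ε Q) (L ε P) ⟩
  L ε P ℚ.* L ε Q                                ∎
  where open ≡-Reasoning

no-constants : ∀ q h₁ h₂ h₃ → scalar q ≈ e₁ ⊗ h₁ ⊕ e₂ ⊗ h₂ ⊕ e₃ ⊗ h₃ → q ≡ 0ℚ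
no-constants q h₁ h₂ h₃ p = begin
  q                                             ≡⟨ solve 1 (λ x → x := x :* con 1ℚ :+ con 0ℚ) refl q ⟩
  L ε (scalar q)                                ≡⟨ ≈⇒L (scalar q) (e₁ ⊗ h₁ ⊕ e₂ ⊗ h₂ ⊕ e₃ ⊗ h₃) p ε ⟩
  L ε (e₁ ⊗ h₁ ⊕ e₂ ⊗ h₂ ⊕ e₃ ⊗ h₃)             ≡⟨ trans (L-⊕ ε (e₁ ⊗ h₁ ⊕ e₂ ⊗ h₂) (e₃ ⊗ h₃)) (cong (ℚ._+ L ε (e₃ ⊗ h₃)) (L-⊕ ε (e₁ ⊗ h₁) (e₂ ⊗ h₂))) ⟩
  L ε (e₁ ⊗ h₁) ℚ.+ L ε (e₂ ⊗ h₂) ℚ.+ L ε (e₃ ⊗ h₃)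
    ≡⟨ cong₂ ℚ._+_ (cong₂ ℚ._+_ (L-ε-⊗ e₁ h₁) (L-ε-⊗ e₂ h₂)) (L-ε-⊗ e₃ h₃) ⟩
  0ℚ ℚ.* L ε h₁ ℚ.+ 0ℚ ℚ.* L ε h₂ ℚ.+ 0ℚ ℚ.* L ε h₃
    ≡⟨ solve 3 (λ x y z → con 0ℚ :* x :+ con 0ℚ :* y :+ con 0ℚ :* z := con 0ℚ) refl (L ε h₁) (L ε h₂) (L ε h₃) ⟩
  0ℚ ∎
  where open ≡-Reasoning

-- Polynomials as an instance of the abstract setting

module F₁₂ = LinearForm linear₁₂
module F₁₃ = LinearForm linear₁₃
module F₂₃ = LinearForm linear₂₃

s-power : ∀ {s : Poly → Poly} → IsRingHomomorphism s → ∀ P n → s (P ^ n) ≈ s P ^ n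
s-power {s} h P n rewrite ^≡^ᴿ P n | ^≡^ᴿ (s P) n = hom-^ h P n

power-cong : ∀ P Q n → P ≈ Q → P ^ n ≈ Q ^ n
power-cong P Q n p rewrite ^≡^ᴿ P n | ^≡^ᴿ Q n = ^ᴿ-congˡ n {P} {Q} p

power-regular : ∀ P n → Regular P → Regular (P ^ n)
power-regular P n p rewrite ^≡^ᴿ P n = Regular-^ {P} p n

Regular-resp : ∀ P Q → P ≈ Q → Regular P → Regular Q
Regular-resp P Q p r X e = r X (Rₚ.trans {P ⊗ X} {Q ⊗ X} {zeroP} (Rₚ.*-congʳ {X} {P} {Q} p) e)

s-power-≈ : ∀ {s} → IsRingHomomorphism s → ∀ P Q n → s P ≈ Q → s (P ^ n) ≈ Q ^ n
s-power-≈ {s} h P Q n p e = trans (s-power h P n e) (power-cong (s P) Q n p e)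

neg-power : ∀ P m → ((ℚ.- 1ℚ) · P) ^ (2 * m + 1) ≈ (ℚ.- 1ℚ) · (P ^ (2 * m + 1))
neg-power P m rewrite ^≡^ᴿ ((ℚ.- 1ℚ) · P) (2 * m + 1) | ^≡^ᴿ P (2 * m + 1) = neg-^-odd P m

coprime-∣ : ∀ {ℓ} (F : LinearForm ℓ) U k {P Q} → Regular (LinearForm.ρ F U) → U ⊗ P ≈ ℓ ^ k ⊗ Q → ℓ ^ k ∣P P
coprime-∣ {ℓ} F U k {P} {Q} r p rewrite ^≡^ᴿ ℓ k = LinearForm.coprime-∣ F {U} r k {P} {Q} p

ρ-power-regular : ∀ {ℓ} (F : LinearForm ℓ) P k → Regular (LinearForm.ρ F P) → Regular (LinearForm.ρ F (P ^ k))
ρ-power-regular F P k r = Regular-resp (ρ P ^ k) (ρ (P ^ k)) (λ e → sym (s-power ρ-hom P k e)) (power-regular (ρ P) k r)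
  where open LinearForm F

module _ (k : ℕ) where
  private
    D₁₂ D₁₃ D₂₃ : Poly
    D₁₂ = (x₁ ⊖ x₂) ^ k
    D₁₃ = (x₁ ⊖ x₃) ^ k
    D₂₃ = (x₂ ⊖ x₃) ^ k

  Δ-regular : Regular (D₁₂ ⊗ D₁₃ ⊗ D₂₃)
  Δ-regular = Regular-* {D₁₂ ⊗ D₁₃} {D₂₃} (Regular-* {D₁₂} {D₁₃}
    (power-regular (x₁ ⊖ x₂) k F₁₂.regular) (power-regular (x₁ ⊖ x₃) k F₁₃.regular)) (power-regular (x₂ ⊖ x₃) k F₂₃.regular)

  Δ-lcm : ∀ P → D₁₂ ∣P P → D₁₃ ∣P P → D₂₃ ∣P P → (D₁₂ ⊗ D₁₃ ⊗ D₂₃) ∣P P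
  Δ-lcm P (u , p) (v , q) (w , r) =
    let u' , p' = coprime-∣ linear₁₃ D₁₂ k {u} {v} (ρ-power-regular linear₁₃ (x₁ ⊖ x₂) k x₁⊖x₂-regular)
                    (λ e → trans (sym (p e)) (q e))
        p″ : P ≈ (D₁₂ ⊗ D₁₃) ⊗ u'
        p″ = λ e → trans (p e) (trans (⊗-cong D₁₂ D₁₂ u (D₁₃ ⊗ u') (λ _ → refl) p' e) (sym (⊗-assoc D₁₂ D₁₃ u' e)))
        u″ , p‴ = coprime-∣ linear₂₃ (D₁₂ ⊗ D₁₃) k {u'} {w} ρD-regular (λ e → trans (sym (p″ e)) (r e))
    in u″ , λ e → trans (p″ e) (trans (⊗-cong (D₁₂ ⊗ D₁₃) (D₁₂ ⊗ D₁₃) u' (D₂₃ ⊗ u″) (λ _ → refl) p‴ e)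
         (sym (⊗-assoc (D₁₂ ⊗ D₁₃) D₂₃ u″ e)))
    where
    -- Modulo x₂ - x₃ the variable x₃ becomes x₂, so both x₁ - x₂ and x₁ - x₃ reduce to x₁ - x₂.
    ρD-regular : Regular (F₂₃.ρ (D₁₂ ⊗ D₁₃))
    ρD-regular = Regular-resp (F₂₃.ρ D₁₂ ⊗ F₂₃.ρ D₁₃) (F₂₃.ρ (D₁₂ ⊗ D₁₃))
      (λ e → sym (IsRingHomomorphism.*-homo F₂₃.ρ-hom D₁₂ D₁₃ e))
      (Regular-* {F₂₃.ρ D₁₂} {F₂₃.ρ D₁₃}
        (ρ-power-regular linear₂₃ (x₁ ⊖ x₂) k x₁⊖x₂-regular) (ρ-power-regular linear₂₃ (x₁ ⊖ x₃) k x₁⊖x₂-regular))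

quasi : ℕ → S₃Algebra
quasi m = record
  { R = polyRing
  ; scalars = scalars
  ; s₁₂ = s₁₂ ; s₁₃ = s₁₃ ; s₂₃ = s₂₃
  ; s₁₂-hom = s₁₂-hom ; s₁₃-hom = s₁₃-hom ; s₂₃-hom = s₂₃-hom
  ; s₁₂-⟦⟧ = λ q e → refl ; s₁₃-⟦⟧ = λ q e → refl ; s₂₃-⟦⟧ = λ q e → refl
  ; s₁₂² = s₁₂² ; s₁₃² = s₁₃² ; s₂₃² = s₂₃²
  ; s₁₃s₁₂ = s₁₃s₁₂ ; s₂₃s₁₃ = s₂₃s₁₃ ; s₁₃s₂₃ = s₁₃s₂₃ ; s₂₃s₁₂ = s₂₃s₁₂
  ; D₁₂ = (x₁ ⊖ x₂) ^ k ; D₁₃ = (x₁ ⊖ x₃) ^ k ; D₂₃ = (x₂ ⊖ x₃) ^ k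
  ; s₁₂-D₁₂ = λ e → trans (s-power-≈ s₁₂-hom (x₁ ⊖ x₂) ((ℚ.- 1ℚ) · (x₁ ⊖ x₂)) k (flip (0 , 1 , 0) (1 , 0 , 0)) e) (neg-power (x₁ ⊖ x₂) m e)
  ; s₁₂-D₁₃ = s-power s₁₂-hom (x₁ ⊖ x₃) k
  ; s₁₂-D₂₃ = s-power s₁₂-hom (x₂ ⊖ x₃) k
  ; s₂₃-D₁₂ = s-power s₂₃-hom (x₁ ⊖ x₂) k
  ; s₂₃-D₁₃ = s-power s₂₃-hom (x₁ ⊖ x₃) k
  ; s₂₃-D₂₃ = λ e → trans (s-power-≈ s₂₃-hom (x₂ ⊖ x₃) ((ℚ.- 1ℚ) · (x₂ ⊖ x₃)) k (flip (0 , 0 , 1) (0 , 1 , 0)) e) (neg-power (x₂ ⊖ x₃) m e)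
  ; x₁ = x₁ ; x₂ = x₂ ; x₃ = x₃
  ; s₁₂-x₁ = λ e → refl ; s₁₂-x₂ = λ e → refl ; s₁₂-x₃ = λ e → refl
  ; s₂₃-x₁ = λ e → refl ; s₂₃-x₂ = λ e → refl ; s₂₃-x₃ = λ e → refl
  ; D-regular = Δ-regular k
  ; D-lcm = Δ-lcm k
  ; no-constants = no-constants
  }
  where
  k = 2 * m + 1
  flip : ∀ e f → (1ℚ , e) ∷ ((ℚ.- 1ℚ) ℚ.* 1ℚ , f) ∷ [] ≈ (ℚ.- 1ℚ) · ((1ℚ , f) ∷ ((ℚ.- 1ℚ) ℚ.* 1ℚ , e) ∷ [])
  flip e f = L⇒≈ ((1ℚ , e) ∷ ((ℚ.- 1ℚ) ℚ.* 1ℚ , f) ∷ []) ((ℚ.- 1ℚ) · ((1ℚ , f) ∷ ((ℚ.- 1ℚ) ℚ.* 1ℚ , e) ∷ [])) λ h → solve 2 (λ x y → con 1ℚ :* x :+ (con (ℚ.- 1ℚ) :* con 1ℚ :* y :+ con 0ℚ)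
    := con (ℚ.- 1ℚ) :* con 1ℚ :* y :+ (con (ℚ.- 1ℚ) :* (con (ℚ.- 1ℚ) :* con 1ℚ) :* x :+ con 0ℚ)) refl (h e) (h f)

-- Non-vanishing of the pairing

ℚ-inverse : ∀ {r} → r ≢ 0ℚ → ∃ λ r⁻¹ → r ℚ.* r⁻¹ ≡ 1ℚ
ℚ-inverse {r} r≢0 = (ℚ.1/ r) {{ℚ.≢-nonZero r≢0}} , ℚₚ.*-inverseʳ r {{ℚ.≢-nonZero r≢0}}

ℚ-cancelˡ : ∀ {r} c → r ≢ 0ℚ → r ℚ.* c ≡ 0ℚ → c ≡ 0ℚ
ℚ-cancelˡ {r} c r≢0 p = invertible-cancelʳ c r _ (proj₂ (ℚ-inverse r≢0)) (trans (ℚₚ.*-comm c r) p)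

ι : ℕ → ℚ
ι zero = 0ℚ
ι (suc n) = 1ℚ ℚ.+ ι n

0≤ι : ∀ n → 0ℚ ℚ.≤ ι n
0≤ι zero = ℚₚ.≤-refl
0≤ι (suc n) = ℚₚ.+-mono-≤ {0ℚ} {1ℚ} {0ℚ} {ι n} (ℚₚ.nonNegative⁻¹ 1ℚ) (0≤ι n)

ι-suc≢0 : ∀ n → ι (suc n) ≢ 0ℚ
ι-suc≢0 n p = ℚₚ.<-irrefl (sym p) (ℚₚ.+-mono-<-≤ {0ℚ} {1ℚ} {0ℚ} {ι n} (ℚₚ.positive⁻¹ 1ℚ) (0≤ι n))

ι-injective : ∀ a b → ι a ≡ ι b → a ≡ b
ι-injective zero zero p = refl
ι-injective zero (suc b) p = contradiction (sym p) (ι-suc≢0 b)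
ι-injective (suc a) zero p = contradiction p (ι-suc≢0 a)
ι-injective (suc a) (suc b) p = cong suc (ι-injective a b
  (trans (solve 1 (λ x → x := (con 1ℚ :+ x) :- con 1ℚ) refl (ι a)) (trans (cong (ℚ._- 1ℚ) p) (solve 1 (λ x → (con 1ℚ :+ x) :- con 1ℚ := x) refl (ι b)))))

-- Finite differences and sparse multiples of powers of x₁ - x₂

Difference : (ℕ → ℚ) → ℕ → ℚ
Difference p n = p (suc n) ℚ.- p n

-- The k-th differences of p vanish, i.e. p is a polynomial sequence of degree < k.
Degree< : ℕ → (ℕ → ℚ) → Set
Degree< zero p = ∀ n → p n ≡ 0ℚ
Degree< (suc k) p = Degree< k (Difference p)

Degree<-cong : ∀ k p q → (∀ n → p n ≡ q n) → Degree< k p → Degree< k q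
Degree<-cong zero p q e d n = trans (sym (e n)) (d n)
Degree<-cong (suc k) p q e d = Degree<-cong k (Difference p) (Difference q) (λ n → cong₂ ℚ._-_ (e (suc n)) (e n)) d

Degree<-+ : ∀ k p q → Degree< k p → Degree< k q → Degree< k (λ n → p n ℚ.+ q n)
Degree<-+ zero p q d e n = cong₂ ℚ._+_ (d n) (e n)
Degree<-+ (suc k) p q d e = Degree<-cong k (λ n → Difference p n ℚ.+ Difference q n) (Difference (λ n → p n ℚ.+ q n))
  (λ n → solve 4 (λ a b c d → (a :- b) :+ (c :- d) := (a :+ c) :- (b :+ d)) refl (p (suc n)) (p n) (q (suc n)) (q n))
  (Degree<-+ k (Difference p) (Difference q) d e)

Degree<-suc : ∀ k p → Degree< k p → Degree< (suc k) p
Degree<-suc zero p d n = cong₂ ℚ._-_ (d (suc n)) (d n)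
Degree<-suc (suc k) p d = Degree<-suc k (Difference p) d

Degree<-shift : ∀ k p → Degree< k p → Degree< k (p ∘ suc)
Degree<-shift zero p d n = d (suc n)
Degree<-shift (suc k) p d = Degree<-shift k (Difference p) d

linear* : ℚ → (ℕ → ℚ) → ℕ → ℚ
linear* c p n = (ι n ℚ.- c) ℚ.* p n

-- The discrete Leibniz rule: the difference of (n - c) p(n) is (n - c) times the difference of p,
-- plus p(n + 1).
Degree<-linear : ∀ k c p → Degree< k p → Degree< (suc k) (linear* c p)
Degree<-linear zero c p d n = cong₂ ℚ._-_
  (trans (cong ((ι (suc n) ℚ.- c) ℚ.*_) (d (suc n))) (ℚₚ.*-zeroʳ (ι (suc n) ℚ.- c)))
  (trans (cong ((ι n ℚ.- c) ℚ.*_) (d n)) (ℚₚ.*-zeroʳ (ι n ℚ.- c)))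
Degree<-linear (suc k) c p d = Degree<-cong (suc k) (λ n → linear* c (Difference p) n ℚ.+ p (suc n)) (Difference (linear* c p))
  (λ n → solve 4 (λ i c x y → (i :- c) :* (x :- y) :+ x := (con 1ℚ :+ i :- c) :* x :- (i :- c) :* y) refl (ι n) c (p (suc n)) (p n))
  (Degree<-+ (suc k) (linear* c (Difference p)) (p ∘ suc) (Degree<-linear k c (Difference p) d) (Degree<-shift (suc k) p d))

Degree<-≤ : ∀ {j k} p → j ≤ k → Degree< j p → Degree< k p
Degree<-≤ {k = zero} p z≤n d = d
Degree<-≤ {k = suc k} p z≤n d = Degree<-suc k p (Degree<-≤ {k = k} p z≤n d)
Degree<-≤ p (s≤s le) d = Degree<-≤ (Difference p) le d

vanishAt : ℕ → ℕ → ℕ → ℚ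
vanishAt i s n with s ℕₚ.≟ i
... | yes _ = 1ℚ
... | no _ = ι n ℚ.- ι s

vanishAt-≡ : ∀ {i s} → s ≡ i → ∀ n → vanishAt i s n ≡ 1ℚ
vanishAt-≡ {i} {s} p n with s ℕₚ.≟ i
... | yes _ = refl
... | no s≢i = contradiction p s≢i

vanishAt-≢ : ∀ {i s} → s ≢ i → ∀ n → vanishAt i s n ≡ ι n ℚ.- ι s
vanishAt-≢ {i} {s} p n with s ℕₚ.≟ i
... | yes s≡i = contradiction s≡i p
... | no _ = refl

-- The numerator of Lagrange's interpolation polynomial at the node `i`: zero at the other nodes,
-- nonzero at `i`.
vanishOn : ℕ → List ℕ → ℕ → ℚ
vanishOn i [] n = 1ℚ
vanishOn i (s ∷ S) n = vanishAt i s n ℚ.* vanishOn i S n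

Degree<-vanishOn : ∀ i S → Degree< (suc (length S)) (vanishOn i S)
Degree<-vanishOn i [] n = refl
Degree<-vanishOn i (s ∷ S) = cases (s ℕₚ.≟ i)
  where
  cases : Dec (s ≡ i) → Degree< (suc (suc (length S))) (vanishOn i (s ∷ S))
  cases (yes s≡i) = Degree<-cong (suc (suc (length S))) (vanishOn i S) (vanishOn i (s ∷ S))
    (λ n → sym (trans (cong (ℚ._* vanishOn i S n) (vanishAt-≡ s≡i n)) (ℚₚ.*-identityˡ (vanishOn i S n))))
    (Degree<-suc (suc (length S)) (vanishOn i S) (Degree<-vanishOn i S))
  cases (no s≢i) = Degree<-cong (suc (suc (length S))) (linear* (ι s) (vanishOn i S)) (vanishOn i (s ∷ S))
    (λ n → cong (ℚ._* vanishOn i S n) (sym (vanishAt-≢ s≢i n)))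
    (Degree<-linear (suc (length S)) (ι s) (vanishOn i S) (Degree<-vanishOn i S))

vanishOn-≢0 : ∀ i S → vanishOn i S i ≢ 0ℚ
vanishOn-≢0 i [] ()
vanishOn-≢0 i (s ∷ S) p = vanishOn-≢0 i S (ℚ-cancelˡ (vanishOn i S i) vanishAt-≢0 p)
  where
  vanishAt-≢0 : vanishAt i s i ≢ 0ℚ
  vanishAt-≢0 q with s ℕₚ.≟ i
  ... | no s≢i = s≢i (sym (ι-injective i s (x-y≡0⇒x≡y (ι i) (ι s) q)))

vanishOn-∈ : ∀ i S {s} → s ∈ S → s ≢ i → vanishOn i S s ≡ 0ℚ
vanishOn-∈ i (s ∷ S) (here refl) s≢i = trans (cong (ℚ._* vanishOn i S s) (trans (vanishAt-≢ s≢i s) (ℚₚ.+-inverseʳ (ι s)))) (ℚₚ.*-zeroˡ (vanishOn i S s))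
vanishOn-∈ i (t ∷ S) {s} (there s∈S) s≢i = trans (cong (vanishAt i t s ℚ.*_) (vanishOn-∈ i S s∈S s≢i)) (ℚₚ.*-zeroʳ (vanishAt i t s))

onFace : (ℕ → ℚ) → Exp → ℚ
onFace p (a , b , zero) = p a
onFace p (a , b , suc c) = 0ℚ

-- Multiplying by x₁ - x₂ turns the functional of p into that of its difference sequence, so k
-- factors apply k differences. This is the dual form of a zero of order k at x₁ = x₂.
L-onFace-power : ∀ k p → Degree< k p → ∀ Q → L (onFace p) ((x₁ ⊖ x₂) ^ k ⊗ Q) ≡ 0ℚ
L-onFace-power zero p d Q = trans (L-cong zero′ (oneP ⊗ Q)) (L-zero (oneP ⊗ Q))
  where
  zero′ : ∀ e → onFace p e ≡ 0ℚ
  zero′ (a , b , zero) = d a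
  zero′ (a , b , suc c) = refl
L-onFace-power (suc k) p d Q = begin
  L (onFace p) ((ℓ ⊗ ℓ ^ k) ⊗ Q)      ≡⟨ ≈⇒L ((ℓ ⊗ ℓ ^ k) ⊗ Q) (ℓ ⊗ X) (⊗-assoc ℓ (ℓ ^ k) Q) (onFace p) ⟩
  L (onFace p) (ℓ ⊗ X)                ≡⟨ L-x₁⊖x₂ (onFace p) X ⟩
  L (onFace p ∘ suc₁) X ℚ.- L (onFace p ∘ suc₂) X
    ≡⟨ cong (L (onFace p ∘ suc₁) X ℚ.+_) (trans (solve 1 (λ x → :- x := con (ℚ.- 1ℚ) :* x) refl (L (onFace p ∘ suc₂) X)) (sym (L-* (ℚ.- 1ℚ) (onFace p ∘ suc₂) X))) ⟩
  L (onFace p ∘ suc₁) X ℚ.+ L (λ e → (ℚ.- 1ℚ) ℚ.* onFace p (suc₂ e)) X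
    ≡⟨ L-+ (onFace p ∘ suc₁) (λ e → (ℚ.- 1ℚ) ℚ.* onFace p (suc₂ e)) X ⟨
  L (λ e → onFace p (suc₁ e) ℚ.+ (ℚ.- 1ℚ) ℚ.* onFace p (suc₂ e)) X
    ≡⟨ L-cong difference X ⟩
  L (onFace (Difference p)) X         ≡⟨ L-onFace-power k (Difference p) d Q ⟩
  0ℚ                                  ∎
  where
  open ≡-Reasoning
  ℓ = x₁ ⊖ x₂
  X = ℓ ^ k ⊗ Q
  difference : ∀ e → onFace p (suc₁ e) ℚ.+ (ℚ.- 1ℚ) ℚ.* onFace p (suc₂ e) ≡ onFace (Difference p) e
  difference (a , b , zero) = solve 2 (λ x y → x :+ con (ℚ.- 1ℚ) :* y := x :- y) refl (p (suc a)) (p a)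
  difference (a , b , suc c) = refl

-- The functional a ↦ ∏ (a - s) over all terms s but one has degree < k, so it kills multiples of (x₁ - x₂)^k
-- while detecting the coefficient of the remaining term.
sparse-vanishes : ∀ {k d G} (S : List ℕ) → length S < k → (x₁ ⊖ x₂) ^ k ∣P G →
  (∀ a b → coeff G (a , b , 0) ≢ 0ℚ → a ∈ S × a + b ≡ d) → ∀ a b → coeff G (a , b , 0) ≡ 0ℚ
sparse-vanishes {k} {d} {G} S le (Q , eq) supp a b with coeff G (a , b , 0) ℚ.≟ 0ℚ
... | yes p = p
... | no n = ℚ-cancelˡ (coeff G e₀) (vanishOn-≢0 a S) (begin
  p a ℚ.* coeff G e₀                                 ≡⟨ cong (p a ℚ.*_) (coeff-L G e₀) ⟩
  p a ℚ.* L (δ e₀) G                                 ≡⟨ L-* (p a) (δ e₀) G ⟨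
  L (λ e → p a ℚ.* δ e₀ e) G                         ≡⟨ solve 1 (λ x → x := x :+ con 0ℚ) refl (L (λ e → p a ℚ.* δ e₀ e) G) ⟩
  L (λ e → p a ℚ.* δ e₀ e) G ℚ.+ 0ℚ                  ≡⟨ cong (L (λ e → p a ℚ.* δ e₀ e) G ℚ.+_) (L-vanish rest G outside) ⟨
  L (λ e → p a ℚ.* δ e₀ e) G ℚ.+ L rest G            ≡⟨ L-+ (λ e → p a ℚ.* δ e₀ e) rest G ⟨
  L (λ e → p a ℚ.* δ e₀ e ℚ.+ rest e) G              ≡⟨ L-cong (λ e → solve 2 (λ x y → x :+ (y :- x) := y) refl (p a ℚ.* δ e₀ e) (onFace p e)) G ⟩
  L (onFace p) G                                     ≡⟨ ≈⇒L G ((x₁ ⊖ x₂) ^ k ⊗ Q) eq (onFace p) ⟩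
  L (onFace p) ((x₁ ⊖ x₂) ^ k ⊗ Q)                   ≡⟨ L-onFace-power k p (Degree<-≤ p le (Degree<-vanishOn a S)) Q ⟩
  0ℚ                                                 ∎)
  where
  open ≡-Reasoning
  e₀ = (a , b , 0)
  p = vanishOn a S
  rest : Exp → ℚ
  rest e = onFace p e ℚ.- p a ℚ.* δ e₀ e
  off : ∀ e → e ≢ e₀ → coeff G e ℚ.* onFace p e ≡ 0ℚ
  off (a' , b' , suc c') _ = ℚₚ.*-zeroʳ (coeff G (a' , b' , suc c'))
  off (a' , b' , zero) e≢ with coeff G (a' , b' , 0) ℚ.≟ 0ℚ
  ... | yes z = trans (cong (ℚ._* p a') z) (ℚₚ.*-zeroˡ (p a'))
  ... | no nz with a' ℕₚ.≟ a
  ...   | no a'≢a = trans (cong (coeff G (a' , b' , 0) ℚ.*_) (vanishOn-∈ a S (proj₁ (supp a' b' nz)) a'≢a)) (ℚₚ.*-zeroʳ (coeff G (a' , b' , 0)))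
  -- A second term with the same exponent of x₁ would have the same exponent of x₂, as both have
  -- total degree d.
  ...   | yes refl = contradiction (cong (λ x → (a , x , 0)) (ℕₚ.+-cancelˡ-≡ a b' b (trans (proj₂ (supp a' b' nz)) (sym (proj₂ (supp a b n)))))) e≢
  outside : ∀ e → coeff G e ℚ.* rest e ≡ 0ℚ
  outside e with eqExp e e₀ in eqn
  ... | true rewrite eqExp-sound e e₀ eqn = solve 2 (λ c x → c :* (x :- x :* con 1ℚ) := con 0ℚ) refl (coeff G e₀) (p a)
  ... | false = trans (solve 3 (λ c x y → c :* (x :- y :* con 0ℚ) := c :* x) refl (coeff G e) (onFace p e) (p a)) (off e (eqExp-false e e₀ eqn))

-- Supports and the prescribed form

AllE : (Exp → Set) → Poly → Set
AllE X = All (X ∘ proj₂)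

AllE-⊗ : ∀ {X Y Z : Exp → Set} → (∀ {e f} → X e → Y f → Z (addExp e f)) → ∀ P Q → AllE X P → AllE Y Q → AllE Z (P ⊗ Q)
AllE-⊗ f P Q p q = concat⁺ (map⁺ (All.map (λ x → map⁺ (All.map (f x) q)) p))

AllE-· : ∀ {X : Exp → Set} c P → AllE X P → AllE X (c · P)
AllE-· c P p = map⁺ (All.map (λ x → x) p)

AllE-sumP : ∀ {X : Exp → Set} Ps → All (AllE X) Ps → AllE X (sumP Ps)
AllE-sumP [] [] = []
AllE-sumP (P ∷ Ps) (p ∷ ps) = ++⁺ p (AllE-sumP Ps ps)

coeff-outside : ∀ {X : Exp → Set} {P} → AllE X P → ∀ e → ¬ X e → coeff P e ≡ 0ℚ
coeff-outside [] e n = refl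
coeff-outside {P = (q , f) ∷ P} (x ∷ xs) e n with eqExp f e in eq
... | true rewrite eqExp-sound f e eq = contradiction x n
... | false = coeff-outside xs e n

L-congᴬ : ∀ {X : Exp → Set} {h k P} → AllE X P → (∀ {e} → X e → h e ≡ k e) → L h P ≡ L k P
L-congᴬ [] p = refl
L-congᴬ {P = (q , e) ∷ P} (x ∷ xs) p = cong₂ ℚ._+_ (cong (q ℚ.*_) (p x)) (L-congᴬ xs p)

Form : ℕ → ℕ → Exp → Set
Form m d (a , b , c) = b ≤ m × c ≤ m × a + b + c ≡ d

pairs-≤ : ∀ m → All (λ ij → proj₁ ij ≤ m × proj₂ ij ≤ m) (pairs m)
pairs-≤ m = concat⁺ (map⁺ (All.map
  (λ { {j} (s≤s j≤m) → map⁺ (All.map (λ { (s≤s i≤j) → ℕₚ.≤-trans i≤j j≤m , j≤m }) (all-upTo (suc j))) }) (all-upTo (suc m))))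

mij-Form : ∀ m i j → i ≤ m → j ≤ m → AllE (λ e → Form m (i + j) e) (mij i j)
mij-Form m i j i≤m j≤m with i ℕₚ.≟ j
... | yes refl = (i≤m , i≤m , refl) ∷ []
... | no _ = (i≤m , j≤m , refl) ∷ (j≤m , i≤m , ℕₚ.+-comm j i) ∷ []

-- The bound 2m ≤ d keeps the truncated subtraction d ∸ (i + j) exact, so every listed term has
-- degree d.
formSum-Form : ∀ m d C → 2 * m ≤ d → AllE (Form m d) (formSum m d C)
formSum-Form m d C le = AllE-sumP (map _ (pairs m)) (map⁺ (All.map
  (λ { {i , j} (i≤m , j≤m) → AllE-· (C i j) (mono 1ℚ (d ∸ (i + j)) 0 0 ⊗ mij i j) (AllE-⊗ {X = _≡ (d ∸ (i + j) , 0 , 0)} {Y = Form m (i + j)} {Z = Form m d}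
    (λ { {f = a , b , c} refl (p , q , r) → p , q , (begin
      d ∸ (i + j) + a + b + c      ≡⟨ ℕₚ.+-assoc (d ∸ (i + j) + a) b c ⟩
      d ∸ (i + j) + a + (b + c)    ≡⟨ ℕₚ.+-assoc (d ∸ (i + j)) a (b + c) ⟩
      d ∸ (i + j) + (a + (b + c))  ≡⟨ cong (d ∸ (i + j) +_) (trans (sym (ℕₚ.+-assoc a b c)) r) ⟩
      d ∸ (i + j) + (i + j)        ≡⟨ ℕₚ.m∸n+n≡m (ℕₚ.≤-trans (ℕₚ.+-mono-≤ i≤m (ℕₚ.≤-trans j≤m (ℕₚ.≤-reflexive (sym (ℕₚ.+-identityʳ m))))) le) ⟩
      d                            ∎) })
    (mono 1ℚ (d ∸ (i + j)) 0 0) (mij i j) (refl ∷ []) (mij-Form m i j i≤m j≤m)) }) (pairs-≤ m)))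
  where open ≡-Reasoning

coeff-s₁₂ : ∀ P e → coeff (s₁₂ P) e ≡ coeff P (sw₁₂ e)
coeff-s₁₂ P e = trans (coeff-L (s₁₂ P) e) (trans (L-s₁₂ (δ e) P)
  (trans (L-cong (δ-injective sw₁₂ (cong sw₁₂) (sw₁₂ e)) P) (sym (coeff-L P (sw₁₂ e)))))

coeff-s₁₃ : ∀ P e → coeff (s₁₃ P) e ≡ coeff P (sw₁₃ e)
coeff-s₁₃ P e = trans (coeff-L (s₁₃ P) e) (trans (L-s₁₃ (δ e) P)
  (trans (L-cong (δ-injective sw₁₃ (cong sw₁₃) (sw₁₃ e)) P) (sym (coeff-L P (sw₁₃ e)))))

coeff-s₂₃ : ∀ P e → coeff (s₂₃ P) e ≡ coeff P (sw₂₃ e)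
coeff-s₂₃ P e = trans (coeff-L (s₂₃ P) e) (trans (L-s₂₃ (δ e) P)
  (trans (L-cong (δ-injective sw₂₃ (cong sw₂₃) (sw₂₃ e)) P) (sym (coeff-L P (sw₂₃ e)))))

down : Poly → Poly
down [] = []
down ((q , suc a , suc b , suc c) ∷ P) = (q , a , b , c) ∷ down P
down (_ ∷ P) = down P

interior : (Exp → ℚ) → Exp → ℚ
interior h (suc a , suc b , suc c) = h (suc a , suc b , suc c)
interior h _ = 0ℚ

L-down : ∀ h P → L (λ { (a , b , c) → h (suc a , suc b , suc c) }) (down P) ≡ L (interior h) P
L-down h [] = refl
L-down h ((q , suc a , suc b , suc c) ∷ P) = cong (q ℚ.* h (suc a , suc b , suc c) ℚ.+_) (L-down h P)
L-down h ((q , zero , b , c) ∷ P) = skip q (L-down h P)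
  where
  skip : ∀ q {x y} → x ≡ y → x ≡ q ℚ.* 0ℚ ℚ.+ y
  skip q {x} {y} p = trans p (solve 2 (λ q y → y := q :* con 0ℚ :+ y) refl q y)
L-down h ((q , suc a , zero , c) ∷ P) = trans (L-down h P) (solve 2 (λ q y → y := q :* con 0ℚ :+ y) refl q (L (interior h) P))
L-down h ((q , suc a , suc b , zero) ∷ P) = trans (L-down h P) (solve 2 (λ q y → y := q :* con 0ℚ :+ y) refl q (L (interior h) P))

-- The list may contain boundary terms that merely cancel, and `down` discards them. The two sides
-- are therefore compared through functionals, which see only the coefficients.
divide-e₃ : ∀ A → (∀ b c → coeff A (0 , b , c) ≡ 0ℚ) → (∀ a c → coeff A (a , 0 , c) ≡ 0ℚ) → (∀ a b → coeff A (a , b , 0) ≡ 0ℚ) →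
  A ≈ e₃ ⊗ down A
divide-e₃ A p q r = L⇒≈ A (e₃ ⊗ down A) λ h → sym (begin
  L h (e₃ ⊗ down A)                          ≡⟨ L-⊗ h e₃ (down A) ⟩
  1ℚ ℚ.* L (λ e → h (addExp (1 , 1 , 1) e)) (down A) ℚ.+ 0ℚ
    ≡⟨ solve 1 (λ x → con 1ℚ :* x :+ con 0ℚ := x) refl (L (λ e → h (addExp (1 , 1 , 1) e)) (down A)) ⟩
  L (λ e → h (addExp (1 , 1 , 1) e)) (down A) ≡⟨ L-down h A ⟩
  L (interior h) A                           ≡⟨ solve 1 (λ x → x := x :+ con 0ℚ) refl (L (interior h) A) ⟩
  L (interior h) A ℚ.+ 0ℚ                    ≡⟨ cong (L (interior h) A ℚ.+_) (L-vanish (boundary h) A (on-boundary h)) ⟨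
  L (interior h) A ℚ.+ L (boundary h) A      ≡⟨ L-+ (interior h) (boundary h) A ⟨
  L (λ e → interior h e ℚ.+ boundary h e) A  ≡⟨ L-cong (λ e → solve 2 (λ x y → x :+ (y :- x) := y) refl (interior h e) (h e)) A ⟩
  L h A                                      ∎)
  where
  open ≡-Reasoning
  boundary : (Exp → ℚ) → Exp → ℚ
  boundary h e = h e ℚ.- interior h e
  zeroed : ∀ {x} y → x ≡ 0ℚ → x ℚ.* y ≡ 0ℚ
  zeroed y refl = ℚₚ.*-zeroˡ y
  on-boundary : ∀ h e → coeff A e ℚ.* boundary h e ≡ 0ℚ
  on-boundary h (zero , b , c) = zeroed _ (p b c)
  on-boundary h (suc a , zero , c) = zeroed _ (q (suc a) c)
  on-boundary h (suc a , suc b , zero) = zeroed _ (r (suc a) (suc b))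
  on-boundary h (suc a , suc b , suc c) = solve 2 (λ x y → x :* (y :- y) := con 0ℚ) refl (coeff A (suc a , suc b , suc c)) (h (suc a , suc b , suc c))

coprime-difference : ∀ {ℓ} (F : LinearForm ℓ) U {s} → IsRingHomomorphism s → s U ≈ U → Regular (LinearForm.ρ F U) → ∀ k P Q →
  P ≈ U ⊗ Q → (ℓ ^ k) ∣P (P ⊖ s P) → (ℓ ^ k) ∣P (Q ⊖ s Q)
coprime-difference {ℓ} F U h p r k P Q e d rewrite ^≡^ᴿ ℓ k = LinearForm.coprime-difference F {u = U} h p r k {P} {Q} e d

-- Modulo x_i - x_j the invariant e₃ becomes x_i² times the third variable, which is regular; so e₃
-- is coprime to each power and can be divided out of each difference.
QI-divide-e₃ : ∀ m A B → A ≈ e₃ ⊗ B → QI m A → QI m B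
QI-divide-e₃ m A B p (u , v , w) =
    coprime-difference linear₁₂ e₃ s₁₂-hom (λ e → refl) (Regular-* {x₁ ⊗ x₁} {x₃} (Regular-* {x₁} {x₁} x₁-regular x₁-regular) x₃-regular) k A B p u
  , coprime-difference linear₁₃ e₃ s₁₃-hom (λ e → refl) (Regular-* {x₁ ⊗ x₁} {x₂} (Regular-* {x₁} {x₁} x₁-regular x₁-regular) x₂-regular) k A B p v
  , coprime-difference linear₂₃ e₃ s₂₃-hom (λ e → refl) (Regular-* {x₁ ⊗ x₂} {x₂} (Regular-* {x₁} {x₂} x₁-regular x₂-regular) x₂-regular) k A B p w
  where k = 2 * m + 1

-- The face x₃ = 0 and its corners

module _ (m d : ℕ) (A : Poly) (2m<d : 2 * m < d) (H : Hyp m d A) where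
  private
    QI-A = proj₁ H
    homogeneous = proj₁ (proj₂ H)
    form = proj₁ (proj₂ (proj₂ (proj₂ H)))
    s₂₃A = proj₁ (proj₂ (proj₂ (proj₂ (proj₂ H))))
    independent = proj₂ (proj₂ (proj₂ (proj₂ (proj₂ H))))

  -- The representative in which every listed term obeys the form; the list `A` itself may contain
  -- other terms that cancel.
  normalForm : Poly
  normalForm = formSum m d (proj₁ form)

  A≈normalForm : A ≈ normalForm
  A≈normalForm = proj₂ form

  normalForm-Form : AllE (Form m d) normalForm
  normalForm-Form = formSum-Form m d (proj₁ form) (ℕₚ.<⇒≤ 2m<d)

  coeff-Form : ∀ e → ¬ Form m d e → coeff A e ≡ 0ℚ
  coeff-Form e n = trans (A≈normalForm e) (coeff-outside normalForm-Form e n)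

  Form? : ∀ e → Dec (Form m d e)
  Form? (a , b , c) with b ℕₚ.≤? m | c ℕₚ.≤? m | a + b + c ℕₚ.≟ d
  ... | yes p | yes q | yes r = yes (p , q , r)
  ... | no p | _ | _ = no (p ∘ proj₁)
  ... | _ | no q | _ = no (q ∘ proj₁ ∘ proj₂)
  ... | _ | _ | no r = no (r ∘ proj₂ ∘ proj₂)

  ≢0⇒Form : ∀ e → coeff A e ≢ 0ℚ → Form m d e
  ≢0⇒Form e n with Form? e
  ... | yes p = p
  ... | no p = contradiction (coeff-Form e p) n

  small-sum : ∀ {a b} → a ≤ m → b ≤ m → ¬ (a + b ≡ d)
  small-sum a≤m b≤m p = ℕₚ.<⇒≱ 2m<d (ℕₚ.≤-trans (ℕₚ.≤-reflexive (sym p))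
    (ℕₚ.+-mono-≤ a≤m (ℕₚ.≤-trans b≤m (ℕₚ.≤-reflexive (sym (ℕₚ.+-identityʳ m))))))

  face-nonzero : ¬ (∀ a b → coeff A (a , b , 0) ≡ 0ℚ)
  face-nonzero z = contradiction (independent c in-ideal zero) λ ()
    where
    c : Fin 3 → ℚ
    c zero = 1ℚ
    c (suc _) = 0ℚ
    A≈ : A ≈ e₃ ⊗ down A
    -- No term lies on x₁ = 0, where the degree would be at most 2m < d; the face x₂ = 0 is the
    -- image of x₃ = 0 under `s₂₃`.
    A≈ = divide-e₃ A (λ b c → coeff-Form (0 , b , c) λ (p , q , r) → small-sum p q r)
      (λ a c → trans (sym (s₂₃A (a , 0 , c))) (trans (coeff-s₂₃ A (a , 0 , c)) (z a c))) z
    QI-0 : QI m zeroP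
    QI-0 = QuasiInvariants.QI-symmetric (quasi m) {zeroP} ((λ e → refl) , (λ e → refl) , (λ e → refl))
    in-ideal : InIdeal m (lincomb c (three A m))
    in-ideal = zeroP , zeroP , down A , QI-0 , QI-0 , QI-divide-e₃ m A (down A) A≈ QI-A , λ e → begin
      coeff (lincomb c (three A m)) e ≡⟨ lincomb-A e ⟩
      coeff A e                       ≡⟨ A≈ e ⟩
      coeff (e₃ ⊗ down A) e           ∎
      where
      open ≡-Reasoning
      lincomb-A : lincomb c (three A m) ≈ A
      lincomb-A = L⇒≈ (lincomb c (three A m)) A λ h → begin
        L h (1ℚ · A ⊕ (0ℚ · s₁₂ A ⊕ (0ℚ · Δ ^ (2 * m + 1) ⊕ zeroP)))
          ≡⟨ trans (L-⊕ h (1ℚ · A) _) (cong (L h (1ℚ · A) ℚ.+_) (trans (L-⊕ h (0ℚ · s₁₂ A) _) (cong (L h (0ℚ · s₁₂ A) ℚ.+_) (L-⊕ h (0ℚ · Δ ^ (2 * m + 1)) zeroP)))) ⟩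
        L h (1ℚ · A) ℚ.+ (L h (0ℚ · s₁₂ A) ℚ.+ (L h (0ℚ · Δ ^ (2 * m + 1)) ℚ.+ 0ℚ))
          ≡⟨ cong₂ ℚ._+_ (L-· h 1ℚ A) (cong₂ ℚ._+_ (L-· h 0ℚ (s₁₂ A)) (cong (ℚ._+ 0ℚ) (L-· h 0ℚ (Δ ^ (2 * m + 1))))) ⟩
        1ℚ ℚ.* L h A ℚ.+ (0ℚ ℚ.* L h (s₁₂ A) ℚ.+ (0ℚ ℚ.* L h (Δ ^ (2 * m + 1)) ℚ.+ 0ℚ))
          ≡⟨ solve 3 (λ x y z → con 1ℚ :* x :+ (con 0ℚ :* y :+ (con 0ℚ :* z :+ con 0ℚ)) := x) refl (L h A) (L h (s₁₂ A)) (L h (Δ ^ (2 * m + 1))) ⟩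
        L h A ∎

  -- `S` has to hold both exponents of each term, because A - s₁₂A also contains the swapped terms.
  -- With at most 2m entries, below the power 2m + 1, that difference vanishes on the face. Then A
  -- is symmetric there, so any term has both exponents at most m, against d > 2m.
  face-support : (S : List ℕ) → length S ≤ 2 * m → ¬ (∀ a b → coeff A (a , b , 0) ≢ 0ℚ → a ∈ S × b ∈ S)
  face-support S le supp = face-nonzero λ a b → symmetric⇒0 a b (x-y≡0⇒x≡y _ _
    (trans (sym (difference a b)) (sparse-vanishes {d = d} {A ⊖ s₁₂ A} S (ℕₚ.≤-trans (s≤s le) (ℕₚ.≤-reflexive (ℕₚ.+-comm 1 (2 * m)))) (proj₁ QI-A) support a b)))
    where
    difference : ∀ a b → coeff (A ⊖ s₁₂ A) (a , b , 0) ≡ coeff A (a , b , 0) ℚ.- coeff A (b , a , 0)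
    difference a b = trans (coeff-⊖ A (s₁₂ A) (a , b , 0)) (cong (λ x → coeff A (a , b , 0) ℚ.- x) (coeff-s₁₂ A (a , b , 0)))
    degree : ∀ a b → coeff A (a , b , 0) ≢ 0ℚ → a + b ≡ d
    degree a b n = trans (sym (ℕₚ.+-identityʳ (a + b))) (homogeneous a b 0 n)
    support : ∀ a b → coeff (A ⊖ s₁₂ A) (a , b , 0) ≢ 0ℚ → a ∈ S × a + b ≡ d
    support a b n with coeff A (a , b , 0) ℚ.≟ 0ℚ | coeff A (b , a , 0) ℚ.≟ 0ℚ
    ... | no p | _ = proj₁ (supp a b p) , degree a b p
    ... | yes _ | no q = proj₂ (supp b a q) , trans (ℕₚ.+-comm a b) (degree b a q)
    ... | yes p | yes q = contradiction (trans (difference a b) (cong₂ ℚ._-_ p q)) n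
    symmetric⇒0 : ∀ a b → coeff A (a , b , 0) ≡ coeff A (b , a , 0) → coeff A (a , b , 0) ≡ 0ℚ
    symmetric⇒0 a b p with coeff A (a , b , 0) ℚ.≟ 0ℚ
    ... | yes q = q
    ... | no q = contradiction (degree a b q) (small-sum (proj₁ (≢0⇒Form (b , a , 0) (q ∘ trans p))) (proj₁ (≢0⇒Form (a , b , 0) q)))

-- The m values 2m+2, ..., 3m+1: the exponents of x₁ on the face once the corner is removed, in
-- either degree.
upper : ℕ → List ℕ
upper m = map (2 * m + 2 +_) (upTo m)

length-++upper : ∀ m (f : ℕ → ℕ) → length (map f (upTo m) ++ upper m) ≤ 2 * m
length-++upper m f = ℕₚ.≤-reflexive (begin
  length (map f (upTo m) ++ upper m)           ≡⟨ length-++ (map f (upTo m)) ⟩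
  length (map f (upTo m)) + length (upper m)   ≡⟨ cong₂ _+_ (len f) (len (2 * m + 2 +_)) ⟩
  m + m                                        ≡⟨ cong (m +_) (ℕₚ.+-identityʳ m) ⟨
  2 * m                                        ∎)
  where
  open ≡-Reasoning
  len : ∀ (g : ℕ → ℕ) → length (map g (upTo m)) ≡ m
  len g = trans (length-map g (upTo m)) (length-upTo m)

2m<3m+1 : ∀ m → 2 * m < 3 * m + 1
2m<3m+1 m = subst (2 * m <_) (ℕₚ.+-comm 1 (3 * m)) (s≤s (ℕₚ.m≤n+m (2 * m) m))

2m<3m+2 : ∀ m → 2 * m < 3 * m + 2
2m<3m+2 m = ℕₚ.<-≤-trans (2m<3m+1 m) (ℕₚ.+-monoʳ-≤ (3 * m) (s≤s z≤n))

-- In degree 3m+1 the corner is the term with b = m. Without it b runs through 0, ..., m-1 and a =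
-- 3m+1-b through `upper`: only 2m exponents in all.
corner₁≢0 : ∀ m A → Hyp m (3 * m + 1) A → coeff A (2 * m + 1 , m , 0) ≢ 0ℚ
-- The identity map gives both corners the same shape of list, for `length-++upper`.
corner₁≢0 m A H z = face-support m (3 * m + 1) A (2m<3m+1 m) H (map (λ x → x) (upTo m) ++ upper m) (length-++upper m (λ x → x)) λ a b n →
  let b≤m , _ , s = ≢0⇒Form m (3 * m + 1) A (2m<3m+1 m) H (a , b , 0) n
      s′ = trans (sym (ℕₚ.+-identityʳ (a + b))) s
      b<m = ℕₚ.≤∧≢⇒< b≤m λ { refl → n (trans (cong (λ x → coeff A (x , b , 0)) (ℕₚ.+-cancelʳ-≡ b a (2 * b + 1) (trans s′ (eq₀ b)))) z) }
      t , m≡ = ℕₚ.m≤n⇒∃[o]m+o≡n b<m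
  in ∈-++⁺ʳ (map (λ x → x) (upTo m)) (subst (_∈ upper m) (sym (ℕₚ.+-cancelʳ-≡ b a (2 * m + 2 + t) (trans s′ (eq₁ m b t (sym m≡)))))
       (∈-map⁺ (2 * m + 2 +_) (∈-upTo⁺ (ℕₚ.≤-trans (s≤s (ℕₚ.m≤n+m t b)) (ℕₚ.≤-reflexive m≡)))))
   , ∈-++⁺ˡ (∈-map⁺ (λ x → x) (∈-upTo⁺ b<m))
  where
  eq₀ : ∀ m → 3 * m + 1 ≡ 2 * m + 1 + m
  eq₀ = ℕ-solve 1 (λ m → conⁿ 3 :*ⁿ m :+ⁿ conⁿ 1 :=ⁿ conⁿ 2 :*ⁿ m :+ⁿ conⁿ 1 :+ⁿ m) refl
  eq₁ : ∀ m b t → m ≡ suc b + t → 3 * m + 1 ≡ 2 * m + 2 + t + b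
  eq₁ m b t refl = ℕ-solve 2 (λ b t → let m = conⁿ 1 :+ⁿ b :+ⁿ t in conⁿ 3 :*ⁿ m :+ⁿ conⁿ 1 :=ⁿ conⁿ 2 :*ⁿ m :+ⁿ conⁿ 2 :+ⁿ t :+ⁿ b) refl b t

-- In degree 3m+2 the corner sits at the other end, b = 0. Without it b runs through 1, ..., m and a
-- = 3m+2-b again through `upper`.
corner₂≢0 : ∀ m A → Hyp m (3 * m + 2) A → coeff A (3 * m + 2 , 0 , 0) ≢ 0ℚ
corner₂≢0 m A H z = face-support m (3 * m + 2) A (2m<3m+2 m) H (map suc (upTo m) ++ upper m) (length-++upper m suc) support
  where
  eq₁ : ∀ m b t → m ≡ suc b + t → 3 * m + 2 ≡ 2 * m + 2 + t + suc b
  eq₁ m b t refl = ℕ-solve 2 (λ b t → let m = conⁿ 1 :+ⁿ b :+ⁿ t in conⁿ 3 :*ⁿ m :+ⁿ conⁿ 2 :=ⁿ conⁿ 2 :*ⁿ m :+ⁿ conⁿ 2 :+ⁿ t :+ⁿ (conⁿ 1 :+ⁿ b)) refl b t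
  support : ∀ a b → coeff A (a , b , 0) ≢ 0ℚ → a ∈ map suc (upTo m) ++ upper m × b ∈ map suc (upTo m) ++ upper m
  support a zero n = contradiction (trans (cong (λ x → coeff A (x , 0 , 0)) a≡) z) n
    where
    a≡ : a ≡ 3 * m + 2
    a≡ = trans (sym (trans (ℕₚ.+-identityʳ (a + 0)) (ℕₚ.+-identityʳ a))) (proj₂ (proj₂ (≢0⇒Form m (3 * m + 2) A (2m<3m+2 m) H (a , 0 , 0) n)))
  support a (suc b) n =
    let b<m , _ , s = ≢0⇒Form m (3 * m + 2) A (2m<3m+2 m) H (a , suc b , 0) n
        s′ = trans (sym (ℕₚ.+-identityʳ (a + suc b))) s
        t , m≡ = ℕₚ.m≤n⇒∃[o]m+o≡n b<m
    in ∈-++⁺ʳ (map suc (upTo m)) (subst (_∈ upper m) (sym (ℕₚ.+-cancelʳ-≡ (suc b) a (2 * m + 2 + t) (trans s′ (eq₁ m b t (sym m≡)))))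
         (∈-map⁺ (2 * m + 2 +_) (∈-upTo⁺ (ℕₚ.≤-trans (s≤s (ℕₚ.m≤n+m t b)) (ℕₚ.≤-reflexive m≡)))))
     , ∈-++⁺ˡ (∈-map⁺ suc (∈-upTo⁺ b<m))

-- Degrees and homogeneous quotients

degree : Exp → ℕ
degree (a , b , c) = a + b + c

degree-addExp : ∀ e f → degree (addExp e f) ≡ degree e + degree f
degree-addExp (a , b , c) (a' , b' , c') = ℕ-solve 6
  (λ a b c a' b' c' → (a :+ⁿ a') :+ⁿ (b :+ⁿ b') :+ⁿ (c :+ⁿ c') :=ⁿ (a :+ⁿ b :+ⁿ c) :+ⁿ (a' :+ⁿ b' :+ⁿ c')) refl a b c a' b' c'

OfDegree : ℕ → Poly → Set
OfDegree n = AllE (λ e → degree e ≡ n)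

OfDegree-⊗ : ∀ {k n} P Q → OfDegree k P → OfDegree n Q → OfDegree (k + n) (P ⊗ Q)
OfDegree-⊗ P Q = AllE-⊗ (λ {e} {f} p q → trans (degree-addExp e f) (cong₂ _+_ p q)) P Q

OfDegree-^ : ∀ P k → OfDegree 1 P → OfDegree k (P ^ k)
OfDegree-^ P zero p = refl ∷ []
OfDegree-^ P (suc k) p = OfDegree-⊗ P (P ^ k) p (OfDegree-^ P k p)

OfDegree-s₁₂ : ∀ {n} P → OfDegree n P → OfDegree n (s₁₂ P)
OfDegree-s₁₂ P p = map⁺ (All.map (λ { {_ , a , b , c} q → trans (cong (_+ c) (ℕₚ.+-comm b a)) q }) p)

OfDegree-s₂₃ : ∀ {n} P → OfDegree n P → OfDegree n (s₂₃ P)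
OfDegree-s₂₃ P p = map⁺ (All.map (λ { {_ , a , b , c} q → trans (trans (ℕₚ.+-assoc a c b) (trans (cong (a +_) (ℕₚ.+-comm c b)) (sym (ℕₚ.+-assoc a b c)))) q }) p)

OfDegree-s₁₃ : ∀ {n} P → OfDegree n P → OfDegree n (s₁₃ P)
OfDegree-s₁₃ P p = map⁺ (All.map (λ { {_ , a , b , c} q → trans (trans (ℕₚ.+-comm (c + b) a) (trans (cong (a +_) (ℕₚ.+-comm c b)) (sym (ℕₚ.+-assoc a b c)))) q }) p)

component : ℕ → (Exp → ℚ) → Exp → ℚ
component n g e with degree e ℕₚ.≟ n
... | yes _ = g e
... | no _ = 0ℚ

component-≡ : ∀ {n} g e → degree e ≡ n → component n g e ≡ g e
component-≡ {n} g e p with degree e ℕₚ.≟ n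
... | yes _ = refl
... | no q = contradiction p q

ε-degree : ∀ f → degree f ≢ 0 → ε f ≡ 0ℚ
ε-degree (0 , 0 , 0) p = contradiction refl p
ε-degree (0 , 0 , suc c) p = refl
ε-degree (0 , suc b , c) p = refl
ε-degree (suc a , b , c) p = refl

degree≡0 : ∀ f → degree f ≡ 0 → f ≡ (0 , 0 , 0)
degree≡0 (0 , 0 , 0) p = refl

addExp-0 : ∀ e → addExp e (0 , 0 , 0) ≡ e
addExp-0 (a , b , c) = cong₂ _,_ (ℕₚ.+-identityʳ a) (cong₂ _,_ (ℕₚ.+-identityʳ b) (ℕₚ.+-identityʳ c))

component-addExp : ∀ {n} g e → degree e ≡ n → ∀ f → component n g (addExp e f) ≡ g e ℚ.* ε f
component-addExp {n} g e p f with degree (addExp e f) ℕₚ.≟ n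
... | yes q rewrite degree≡0 f (ℕₚ.+-cancelˡ-≡ (degree e) (degree f) 0
      (trans (sym (degree-addExp e f)) (trans q (trans (sym p) (sym (ℕₚ.+-identityʳ (degree e)))))))
  = trans (cong g (addExp-0 e)) (sym (ℚₚ.*-identityʳ (g e)))
... | no q = sym (trans (cong (g e ℚ.*_) (ε-degree f λ z → q (trans (degree-addExp e f) (trans (cong (degree e +_) z) (trans (ℕₚ.+-identityʳ (degree e)) p)))))
    (ℚₚ.*-zeroʳ (g e)))

-- Test with functionals cut off to degree n: since D already has degree n, only the constant term
-- of Q can contribute. In this way no homogeneity of Q has to be known.
homogeneous-quotient : ∀ n D P Q → OfDegree n D → OfDegree n P → P ≈ D ⊗ Q → P ≈ scalar (L ε Q) ⊗ D
homogeneous-quotient n D P Q dD dP eq = L⇒≈ P (scalar (L ε Q) ⊗ D) λ g → begin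
  L g P                                              ≡⟨ L-congᴬ dP (λ {e} x → sym (component-≡ g e x)) ⟩
  L (component n g) P                                ≡⟨ ≈⇒L P (D ⊗ Q) eq (component n g) ⟩
  L (component n g) (D ⊗ Q)                          ≡⟨ L-⊗ (component n g) D Q ⟩
  L (λ e → L (λ f → component n g (addExp e f)) Q) D
    ≡⟨ L-congᴬ dD (λ {e} x → trans (L-cong (component-addExp g e x) Q) (trans (L-* (g e) ε Q) (ℚₚ.*-comm (g e) (L ε Q)))) ⟩
  L (λ e → L ε Q ℚ.* g e) D                          ≡⟨ L-* (L ε Q) g D ⟩
  L ε Q ℚ.* L g D                                    ≡⟨ L-scalar⊗ g (L ε Q) D ⟨
  L g (scalar (L ε Q) ⊗ D)                           ∎
  where open ≡-Reasoning

coeff-⊗-unique : ∀ {X Y : Exp → Set} P Q e₀ f₀ → AllE X P → AllE Y Q →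
  (∀ {e f} → X e → Y f → addExp e f ≡ addExp e₀ f₀ → e ≡ e₀ × f ≡ f₀) →
  coeff (P ⊗ Q) (addExp e₀ f₀) ≡ coeff P e₀ ℚ.* coeff Q f₀
coeff-⊗-unique {X} {Y} P Q e₀ f₀ p q uniq = begin
  coeff (P ⊗ Q) (addExp e₀ f₀)                                ≡⟨ coeff-L (P ⊗ Q) (addExp e₀ f₀) ⟩
  L (δ (addExp e₀ f₀)) (P ⊗ Q)                                ≡⟨ L-⊗ (δ (addExp e₀ f₀)) P Q ⟩
  L (λ e → L (λ f → δ (addExp e₀ f₀) (addExp e f)) Q) P       ≡⟨ L-congᴬ p (λ {e} x → trans (L-congᴬ q (λ {f} y → split e f x y)) (trans (L-* (δ e₀ e) (δ f₀) Q) (ℚₚ.*-comm (δ e₀ e) (L (δ f₀) Q)))) ⟩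
  L (λ e → L (δ f₀) Q ℚ.* δ e₀ e) P                           ≡⟨ L-* (L (δ f₀) Q) (δ e₀) P ⟩
  L (δ f₀) Q ℚ.* L (δ e₀) P                                   ≡⟨ ℚₚ.*-comm (L (δ f₀) Q) (L (δ e₀) P) ⟩
  L (δ e₀) P ℚ.* L (δ f₀) Q                                   ≡⟨ cong₂ ℚ._*_ (coeff-L P e₀) (coeff-L Q f₀) ⟨
  coeff P e₀ ℚ.* coeff Q f₀                                   ∎
  where
  open ≡-Reasoning
  split : ∀ e f → X e → Y f → δ (addExp e₀ f₀) (addExp e f) ≡ δ e₀ e ℚ.* δ f₀ f
  split e f x y with eqExp e e₀ in eq | eqExp f f₀ in eq'
  ... | true | true rewrite eqExp-sound e e₀ eq | eqExp-sound f f₀ eq' | eqExp-refl (addExp e₀ f₀) = refl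
  ... | false | true rewrite eqExp-≢ (eqExp-false e e₀ eq ∘ proj₁ ∘ uniq x y) = refl
  ... | true | false rewrite eqExp-≢ (eqExp-false f f₀ eq' ∘ proj₂ ∘ uniq x y) = refl
  ... | false | false rewrite eqExp-≢ (eqExp-false e e₀ eq ∘ proj₁ ∘ uniq x y) = refl

Form-positive : ∀ {m d} → 2 * m < d → ∀ {a b c} → Form m d (a , b , c) → 1 ≤ a
Form-positive {m} 2m<d {zero} (b≤m , c≤m , p) = contradiction (ℕₚ.≤-trans (ℕₚ.≤-reflexive (sym p))
  (ℕₚ.+-mono-≤ b≤m (ℕₚ.≤-trans c≤m (ℕₚ.≤-reflexive (sym (ℕₚ.+-identityʳ m)))))) (ℕₚ.<⇒≱ 2m<d)
Form-positive 2m<d {suc a} _ = s≤s z≤n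

-- The constant κ and its non-vanishing

module Gram (m : ℕ) (A₁ A₂ : Poly) (H₁ : Hyp m (3 * m + 1) A₁) (H₂ : Hyp m (3 * m + 2) A₂) where
  open QuasiInvariants (quasi m) using (Alt; Alt-cong; Alt-QI; QI-*; QI-s₁₂)

  D : Poly
  D = S₃Algebra.D (quasi m)

  private
    k = 2 * m + 1
    F₁ = normalForm m (3 * m + 1) A₁ (2m<3m+1 m) H₁
    F₂ = normalForm m (3 * m + 2) A₂ (2m<3m+2 m) H₂
    F₁-Form = normalForm-Form m (3 * m + 1) A₁ (2m<3m+1 m) H₁
    F₂-Form = normalForm-Form m (3 * m + 2) A₂ (2m<3m+2 m) H₂
    A₁≈F₁ = A≈normalForm m (3 * m + 1) A₁ (2m<3m+1 m) H₁
    A₂≈F₂ = A≈normalForm m (3 * m + 2) A₂ (2m<3m+2 m) H₂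
    X = F₁ ⊗ s₁₂ F₂

    s₁₂F₂-Form : AllE (Form m (3 * m + 2) ∘ sw₁₂) (s₁₂ F₂)
    s₁₂F₂-Form = map⁺ (All.map (λ p → p) F₂-Form)

    -- Chosen to exclude the five other images of `e*`: four of them have exponent 0 at x₁ or x₂,
    -- and the swap of the first two entries has 4m+2 at x₁, one more than the bound.
    Box : Exp → Set
    Box (a , b , c) = 1 ≤ a × 1 ≤ b × a ≤ 3 * m + 1 + m

    X-Box : AllE Box X
    X-Box = AllE-⊗ {Z = Box} (λ { {a , b , c} {b' , a' , c'} p q →
        ℕₚ.≤-trans (Form-positive (2m<3m+1 m) p) (ℕₚ.m≤m+n a b')
      , ℕₚ.≤-trans (Form-positive (2m<3m+2 m) q) (ℕₚ.m≤n+m a' b)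
      , ℕₚ.+-mono-≤ (ℕₚ.≤-trans (ℕₚ.≤-trans (ℕₚ.m≤m+n a b) (ℕₚ.m≤m+n (a + b) c)) (ℕₚ.≤-reflexive (proj₂ (proj₂ p)))) (proj₁ q) })
      F₁ (s₁₂ F₂) F₁-Form s₁₂F₂-Form

    e₀ f₀ e* : Exp
    e₀ = (2 * m + 1 , m , 0)
    f₀ = (0 , 3 * m + 2 , 0)
    e* = addExp e₀ f₀

    -- The exponent of x₁ in `e*` is 2m+1. On the face a term of A₁ has b ≤ m and so already a ≥
    -- 2m+1. Hence it takes the whole exponent and is the corner, and the other factor is a pure
    -- power of x₂.
    unique : ∀ {e f} → Form m (3 * m + 1) e → Form m (3 * m + 2) (sw₁₂ f) → addExp e f ≡ e* → e ≡ e₀ × f ≡ f₀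
    unique {a , b , c} {b' , a' , c'} (b≤m , c≤m , p) (b'≤m , c'≤m , q) r =
      cong₂ _,_ a≡ (cong₂ _,_ b≡ c≡) , cong₂ _,_ b'≡ (cong₂ _,_ a'≡ c'≡)
      where
      c≡ : c ≡ 0
      c≡ = ℕₚ.m+n≡0⇒m≡0 c (cong (proj₂ ∘ proj₂) r)
      c'≡ : c' ≡ 0
      c'≡ = ℕₚ.m+n≡0⇒n≡0 c (cong (proj₂ ∘ proj₂) r)
      a+b : a + b ≡ 2 * m + 1 + m
      a+b = trans (trans (sym (ℕₚ.+-identityʳ (a + b))) (trans (cong (a + b +_) (sym c≡)) p))
        (ℕ-solve 1 (λ m → conⁿ 3 :*ⁿ m :+ⁿ conⁿ 1 :=ⁿ conⁿ 2 :*ⁿ m :+ⁿ conⁿ 1 :+ⁿ m) refl m)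
      a+b' : a + b' ≡ 2 * m + 1
      a+b' = trans (cong proj₁ r) (ℕₚ.+-identityʳ (2 * m + 1))
      a≥ : 2 * m + 1 ≤ a
      a≥ = ℕₚ.+-cancelʳ-≤ m (2 * m + 1) a (ℕₚ.≤-trans (ℕₚ.≤-reflexive (sym a+b)) (ℕₚ.+-monoʳ-≤ a b≤m))
      a≡ : a ≡ 2 * m + 1
      a≡ = ℕₚ.≤-antisym (ℕₚ.≤-trans (ℕₚ.m≤m+n a b') (ℕₚ.≤-reflexive a+b')) a≥
      b≡ : b ≡ m
      b≡ = ℕₚ.+-cancelˡ-≡ (2 * m + 1) b m (trans (cong (_+ b) (sym a≡)) a+b)
      b'≡ : b' ≡ 0
      b'≡ = ℕₚ.+-cancelˡ-≡ (2 * m + 1) b' 0 (trans (cong (_+ b') (sym a≡)) (trans a+b' (sym (ℕₚ.+-identityʳ (2 * m + 1)))))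
      a'≡ : a' ≡ 3 * m + 2
      a'≡ = trans (sym (trans (ℕₚ.+-identityʳ (a' + 0)) (ℕₚ.+-identityʳ a'))) (trans (cong₂ (λ x y → a' + x + y) (sym b'≡) (sym c'≡)) q)

    coeff-X : coeff X e* ≢ 0ℚ
    coeff-X z = corner₂≢0 m A₂ H₂ (trans (A₂≈F₂ (3 * m + 2 , 0 , 0)) (trans (sym (coeff-s₁₂ F₂ f₀))
      (ℚ-cancelˡ (coeff (s₁₂ F₂) f₀) (λ w → corner₁≢0 m A₁ H₁ (trans (A₁≈F₁ e₀) w))
        (trans (sym (coeff-⊗-unique F₁ (s₁₂ F₂) e₀ f₀ F₁-Form s₁₂F₂-Form unique)) z))))

    X-outside : ∀ e → ¬ Box e → coeff X e ≡ 0ℚ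
    X-outside = coeff-outside {Box} {X} X-Box

    coeff-Alt : coeff (Alt X) e* ≡ coeff X e*
    coeff-Alt = begin
      coeff (Alt X) e*
        ≡⟨ coeff-⊖ (X ⊕ s₁₂ (s₂₃ X) ⊕ s₁₂ (s₁₃ X)) (s₁₂ X ⊕ s₁₃ X ⊕ s₂₃ X) e* ⟩
      coeff (X ⊕ s₁₂ (s₂₃ X) ⊕ s₁₂ (s₁₃ X)) e* ℚ.- coeff (s₁₂ X ⊕ s₁₃ X ⊕ s₂₃ X) e*
        ≡⟨ cong₂ ℚ._-_ (sum₃ X (s₁₂ (s₂₃ X)) (s₁₂ (s₁₃ X)) refl z₁ z₂) (sum₃ (s₁₂ X) (s₁₃ X) (s₂₃ X) z₃ z₄ z₅) ⟩
      (coeff X e* ℚ.+ 0ℚ ℚ.+ 0ℚ) ℚ.- (0ℚ ℚ.+ 0ℚ ℚ.+ 0ℚ)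
        ≡⟨ solve 1 (λ x → (x :+ con 0ℚ :+ con 0ℚ) :- (con 0ℚ :+ con 0ℚ :+ con 0ℚ) := x) refl (coeff X e*) ⟩
      coeff X e* ∎
      where
      open ≡-Reasoning
      sum₃ : ∀ P Q R {x y z} → coeff P e* ≡ x → coeff Q e* ≡ y → coeff R e* ≡ z → coeff (P ⊕ Q ⊕ R) e* ≡ x ℚ.+ y ℚ.+ z
      sum₃ P Q R p q r = trans (coeff-⊕ (P ⊕ Q) R e*) (cong₂ ℚ._+_ (trans (coeff-⊕ P Q e*) (cong₂ ℚ._+_ p q)) r)
      z₁ : coeff (s₁₂ (s₂₃ X)) e* ≡ 0ℚ
      z₁ = trans (coeff-s₁₂ (s₂₃ X) e*) (trans (coeff-s₂₃ X (sw₁₂ e*)) (X-outside (sw₂₃ (sw₁₂ e*)) λ { (_ , () , _) }))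
      z₂ : coeff (s₁₂ (s₁₃ X)) e* ≡ 0ℚ
      z₂ = trans (coeff-s₁₂ (s₁₃ X) e*) (trans (coeff-s₁₃ X (sw₁₂ e*)) (X-outside (sw₁₃ (sw₁₂ e*)) λ { (() , _) }))
      z₃ : coeff (s₁₂ X) e* ≡ 0ℚ
      z₃ = trans (coeff-s₁₂ X e*) (X-outside (sw₁₂ e*) λ (_ , _ , le) → ℕₚ.<⇒≱ (ℕₚ.≤-reflexive (too-big m)) le)
        where
        too-big : ∀ m → suc (3 * m + 1 + m) ≡ m + (3 * m + 2)
        too-big = ℕ-solve 1 (λ m → conⁿ 1 :+ⁿ (conⁿ 3 :*ⁿ m :+ⁿ conⁿ 1 :+ⁿ m) :=ⁿ m :+ⁿ (conⁿ 3 :*ⁿ m :+ⁿ conⁿ 2)) refl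
      z₄ : coeff (s₁₃ X) e* ≡ 0ℚ
      z₄ = trans (coeff-s₁₃ X e*) (X-outside (sw₁₃ e*) λ { (() , _) })
      z₅ : coeff (s₂₃ X) e* ≡ 0ℚ
      z₅ = trans (coeff-s₂₃ X e*) (X-outside (sw₂₃ e*) λ { (_ , () , _) })

    N = (3 * m + 1) + (3 * m + 2)

    X-degree : OfDegree N X
    X-degree = OfDegree-⊗ F₁ (s₁₂ F₂) (All.map (λ p → proj₂ (proj₂ p)) F₁-Form)
      (OfDegree-s₁₂ F₂ (All.map (λ p → proj₂ (proj₂ p)) F₂-Form))

    Alt-degree : OfDegree N (Alt X)
    Alt-degree = ++⁺ (++⁺ (++⁺ X-degree (OfDegree-s₁₂ (s₂₃ X) (OfDegree-s₂₃ X X-degree))) (OfDegree-s₁₂ (s₁₃ X) (OfDegree-s₁₃ X X-degree)))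
      (AllE-· (ℚ.- 1ℚ) (s₁₂ X ⊕ s₁₃ X ⊕ s₂₃ X) (++⁺ (++⁺ (OfDegree-s₁₂ X X-degree) (OfDegree-s₁₃ X X-degree)) (OfDegree-s₂₃ X X-degree)))

    D-degree : OfDegree N D
    D-degree = subst (λ n → OfDegree n D) (3k≡N m)
      (OfDegree-⊗ ((x₁ ⊖ x₂) ^ k ⊗ (x₁ ⊖ x₃) ^ k) ((x₂ ⊖ x₃) ^ k)
        (OfDegree-⊗ ((x₁ ⊖ x₂) ^ k) ((x₁ ⊖ x₃) ^ k) (OfDegree-^ (x₁ ⊖ x₂) k (refl ∷ refl ∷ [])) (OfDegree-^ (x₁ ⊖ x₃) k (refl ∷ refl ∷ [])))
        (OfDegree-^ (x₂ ⊖ x₃) k (refl ∷ refl ∷ [])))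
      where
      3k≡N : ∀ m → (2 * m + 1) + (2 * m + 1) + (2 * m + 1) ≡ (3 * m + 1) + (3 * m + 2)
      3k≡N = ℕ-solve 1 (λ m → let k = conⁿ 2 :*ⁿ m :+ⁿ conⁿ 1 in k :+ⁿ k :+ⁿ k :=ⁿ (conⁿ 3 :*ⁿ m :+ⁿ conⁿ 1) :+ⁿ (conⁿ 3 :*ⁿ m :+ⁿ conⁿ 2)) refl

    divisible = Alt-QI {A₁ ⊗ s₁₂ A₂} (QI-* {A₁} {s₁₂ A₂} (proj₁ H₁) (QI-s₁₂ {A₂} (proj₁ H₂)))

    Alt-A≈Alt-X : Alt (A₁ ⊗ s₁₂ A₂) ≈ Alt X
    Alt-A≈Alt-X = Alt-cong {A₁ ⊗ s₁₂ A₂} {X} (⊗-cong A₁ F₁ (s₁₂ A₂) (s₁₂ F₂) A₁≈F₁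
      (λ e → trans (coeff-s₁₂ A₂ e) (trans (A₂≈F₂ (sw₁₂ e)) (sym (coeff-s₁₂ F₂ e)))))

  κ : ℚ
  κ = L ε (proj₁ divisible)

  gram : Alt (A₁ ⊗ s₁₂ A₂) ≈ scalar κ ⊗ D
  -- `homogeneous-quotient` asks for the degree of each listed term, which is known for the normal
  -- forms in `X`.
  gram e = trans (Alt-A≈Alt-X e) (homogeneous-quotient N D (Alt X) (proj₁ divisible) D-degree Alt-degree
    (λ e → trans (sym (Alt-A≈Alt-X e)) (proj₂ (proj₂ divisible) e)) e)

  κ≢0 : κ ≢ 0ℚ
  κ≢0 z = coeff-X (begin
    coeff X e*                      ≡⟨ coeff-Alt ⟨
    coeff (Alt X) e*                ≡⟨ Alt-A≈Alt-X e* ⟨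
    coeff (Alt (A₁ ⊗ s₁₂ A₂)) e*    ≡⟨ gram e* ⟩
    coeff (scalar κ ⊗ D) e*         ≡⟨ coeff-L (scalar κ ⊗ D) e* ⟩
    L (δ e*) (scalar κ ⊗ D)         ≡⟨ L-scalar⊗ (δ e*) κ D ⟩
    κ ℚ.* L (δ e*) D                ≡⟨ cong (ℚ._* L (δ e*) D) z ⟩
    0ℚ ℚ.* L (δ e*) D               ≡⟨ ℚₚ.*-zeroˡ (L (δ e*) D) ⟩
    0ℚ                              ∎)
    where open ≡-Reasoning

-- Return from the abstract setting to lists of terms

x₁-power : ∀ n → x₁ ^ᴿ n ≈ mono 1ℚ n 0 0
x₁-power zero e = refl
x₁-power (suc n) = ⊗-cong x₁ x₁ (x₁ ^ᴿ n) (mono 1ℚ n 0 0) (λ _ → refl) (x₁-power n)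

x₂-power : ∀ n → x₂ ^ᴿ n ≈ mono 1ℚ 0 n 0
x₂-power zero e = refl
x₂-power (suc n) = ⊗-cong x₂ x₂ (x₂ ^ᴿ n) (mono 1ℚ 0 n 0) (λ _ → refl) (x₂-power n)

x₃-power : ∀ n → x₃ ^ᴿ n ≈ mono 1ℚ 0 0 n
x₃-power zero e = refl
x₃-power (suc n) = ⊗-cong x₃ x₃ (x₃ ^ᴿ n) (mono 1ℚ 0 0 n) (λ _ → refl) (x₃-power n)

mono≈ : ∀ q a b c → mono q a b c ≈ scalar q ⊗ (x₁ ^ᴿ a ⊗ x₂ ^ᴿ b ⊗ x₃ ^ᴿ c)
mono≈ q a b c e = sym (trans
  (⊗-cong (scalar q) (scalar q) (x₁ ^ᴿ a ⊗ x₂ ^ᴿ b ⊗ x₃ ^ᴿ c) (mono 1ℚ a 0 0 ⊗ mono 1ℚ 0 b 0 ⊗ mono 1ℚ 0 0 c) (λ _ → refl)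
    (⊗-cong (x₁ ^ᴿ a ⊗ x₂ ^ᴿ b) (mono 1ℚ a 0 0 ⊗ mono 1ℚ 0 b 0) (x₃ ^ᴿ c) (mono 1ℚ 0 0 c)
      (⊗-cong (x₁ ^ᴿ a) (mono 1ℚ a 0 0) (x₂ ^ᴿ b) (mono 1ℚ 0 b 0) (x₁-power a) (x₂-power b)) (x₃-power c)) e)
  (cong (λ t → coeff (t ∷ []) e) (cong₂ _,_ (ℚₚ.*-identityʳ q)
    (cong₂ _,_ (trans (ℕₚ.+-identityʳ (a + 0)) (ℕₚ.+-identityʳ a)) (cong (_, c) (ℕₚ.+-identityʳ b))))))

module _ (m : ℕ) where
  open QuasiInvariants (quasi m) using (Sym; Sym-+; Sym-cong; Sym-*ˡ; Symmetric-⟦⟧)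
  open Coinvariants (quasi m) using (Generated; Generated-resp; Generated-+; Generated-⟦⟧*; monomial; Sym-monomial-generated)

  -- The terms of a symmetric polynomial are not symmetric one by one, so the induction over terms
  -- is run on Sym P for arbitrary P.
  Sym-generated : ∀ P → Generated (Sym P)
  Sym-generated [] = 0ℚ , [] , [] , [] , Symmetric-[] , Symmetric-[] , Symmetric-[] ,
    λ e → sym (_-Raw-AlmostCommutative⟶_.0-homo scalars e)
    where
    Symmetric-[] : Symmetric []
    Symmetric-[] = (λ e → refl) , (λ e → refl) , (λ e → refl)
  Sym-generated ((q , a , b , c) ∷ P) = Generated-resp {Sym M ⊕ Sym P} {Sym (M ⊕ P)} (λ e → sym (Sym-+ M P e))
    (Generated-+ {Sym M} {Sym P}
      (Generated-resp {scalar q ⊗ Sym (monomial a b c)} {Sym M}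
        (λ e → sym (trans (Sym-cong {M} {scalar q ⊗ monomial a b c} (mono≈ q a b c) e) (Sym-*ˡ {scalar q} (Symmetric-⟦⟧ q) (monomial a b c) e)))
        (Generated-⟦⟧* q {Sym (monomial a b c)} (Sym-monomial-generated a b c)))
      (Sym-generated P))
    where M = mono q a b c

Δ^≈ : ∀ k → Δ ^ k ≈ (x₁ ⊖ x₂) ^ k ⊗ (x₁ ⊖ x₃) ^ k ⊗ (x₂ ⊖ x₃) ^ k
Δ^≈ k e rewrite ^≡^ᴿ Δ k | ^≡^ᴿ (x₁ ⊖ x₂) k | ^≡^ᴿ (x₁ ⊖ x₃) k | ^≡^ᴿ (x₂ ⊖ x₃) k = trans
  (^-distrib-* ((x₁ ⊖ x₂) ⊗ (x₁ ⊖ x₃)) (x₂ ⊖ x₃) k e)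
  (⊗-cong (((x₁ ⊖ x₂) ⊗ (x₁ ⊖ x₃)) ^ᴿ k) ((x₁ ⊖ x₂) ^ᴿ k ⊗ (x₁ ⊖ x₃) ^ᴿ k) ((x₂ ⊖ x₃) ^ᴿ k) ((x₂ ⊖ x₃) ^ᴿ k)
    (^-distrib-* (x₁ ⊖ x₂) (x₁ ⊖ x₃) k) (λ _ → refl) e)
  where open Algebra.Properties.CommutativeSemiring.Exp Rₚ.commutativeSemiring using (^-distrib-*)

scalarComb : ∀ m (A₁ A₂ : Poly) (c : Fin 6 → ℚ) → Poly
scalarComb m A₁ A₂ c = QuasiInvariants.comb (quasi m) A₁ A₂
  (scalar (c (# 0))) (scalar (c (# 1))) (scalar (c (# 2))) (scalar (c (# 3))) (scalar (c (# 4))) (scalar (c (# 5)))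

lincomb≈scalarComb : ∀ m A₁ A₂ (c : Fin 6 → ℚ) → lincomb c (six A₁ A₂ m) ≈ scalarComb m A₁ A₂ c
lincomb≈scalarComb m A₁ A₂ c =
  step (c (# 0)) oneP X₁ Y₁ (step (c (# 1)) A₁ X₂ Y₂ (step (c (# 2)) (s₁₂ A₁) X₃ Y₃
    (step (c (# 3)) A₂ X₄ Y₄ (step (c (# 4)) (s₁₂ A₂) X₅ Y₅
      λ e → trans (cong (λ P → coeff P e) (++-identityʳ (c (# 5) · Δ ^ k)))
        (trans (·≈scalar⊗ (c (# 5)) (Δ ^ k) e)
          (⊗-cong (scalar (c (# 5))) (scalar (c (# 5))) (Δ ^ k) D (λ _ → refl) (Δ^≈ k) e))))))
  where
  k = 2 * m + 1
  D = S₃Algebra.D (quasi m)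
  X₁ X₂ X₃ X₄ X₅ Y₁ Y₂ Y₃ Y₄ Y₅ : Poly
  X₅ = c (# 5) · Δ ^ k ⊕ zeroP
  X₄ = c (# 4) · s₁₂ A₂ ⊕ X₅
  X₃ = c (# 3) · A₂ ⊕ X₄
  X₂ = c (# 2) · s₁₂ A₁ ⊕ X₃
  X₁ = c (# 1) · A₁ ⊕ X₂
  Y₅ = scalar (c (# 5)) ⊗ D
  Y₄ = scalar (c (# 4)) ⊗ s₁₂ A₂ ⊕ Y₅
  Y₃ = scalar (c (# 3)) ⊗ A₂ ⊕ Y₄
  Y₂ = scalar (c (# 2)) ⊗ s₁₂ A₁ ⊕ Y₃
  Y₁ = scalar (c (# 1)) ⊗ A₁ ⊕ Y₂
  step : ∀ q v X Y → X ≈ Y → q · v ⊕ X ≈ scalar q ⊗ v ⊕ Y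
  step q v X Y p = ⊕-cong (q · v) (scalar q ⊗ v) X Y (·≈scalar⊗ q v) p

theorem3 : (m : ℕ) (A₁ A₂ : Poly) →
    Hyp m (3 * m + 1) A₁ → Hyp m (3 * m + 2) A₂ →
    BasisMod m (six A₁ A₂ m)
theorem3 m A₁ A₂ H₁ H₂ = independent , spans
  where
  open Gram m A₁ A₂ H₁ H₂ using (κ; gram; κ≢0)
  open QuasiInvariants (quasi m) using (module Duality)
  open Coinvariants (quasi m) using (InIdeal-resp; Combination-InIdeal; module Independence)
  κ⁻¹ = proj₁ (ℚ-inverse κ≢0)
  κκ⁻¹ = proj₂ (ℚ-inverse κ≢0)
  QI-A₁ = proj₁ H₁
  QI-A₂ = proj₁ H₂
  s₂₃A₁ = proj₁ (proj₂ (proj₂ (proj₂ (proj₂ H₁))))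
  s₂₃A₂ = proj₁ (proj₂ (proj₂ (proj₂ (proj₂ H₂))))

  independent : LinIndepMod m (six A₁ A₂ m)
  independent c i =
    let p₀ , p₁ , p₂ , p₃ , p₄ , p₅ = Independence.independence {A₁} {A₂} QI-A₁ QI-A₂ s₂₃A₁ s₂₃A₂ κ κ⁻¹ κκ⁻¹ gram (c (# 0)) (c (# 1)) (c (# 2)) (c (# 3)) (c (# 4)) (c (# 5))
          (InIdeal-resp {lincomb c (six A₁ A₂ m)} {scalarComb m A₁ A₂ c} (lincomb≈scalarComb m A₁ A₂ c) i)
    in λ { zero → p₀ ; (suc zero) → p₁ ; (suc (suc zero)) → p₂ ; (suc (suc (suc zero))) → p₃
         ; (suc (suc (suc (suc zero)))) → p₄ ; (suc (suc (suc (suc (suc zero))))) → p₅ }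

  spans : SpansMod m (six A₁ A₂ m)
  spans P QI-P =
    let c₀ , c₁ , c₂ , c₃ , c₄ , c₅ , i = Combination-InIdeal (Sym-generated m) {A₁} {A₂} {P} QI-A₁ QI-A₂
          (Duality.spanning {A₁} {A₂} QI-A₁ QI-A₂ s₂₃A₁ s₂₃A₂ κ κ⁻¹ κκ⁻¹ gram {P} QI-P)
        c : Fin 6 → ℚ
        c = λ { zero → c₀ ; (suc zero) → c₁ ; (suc (suc zero)) → c₂ ; (suc (suc (suc zero))) → c₃
              ; (suc (suc (suc (suc zero)))) → c₄ ; (suc (suc (suc (suc (suc zero))))) → c₅ }
        C = scalarComb m A₁ A₂ c
    in c , InIdeal-resp {P ⊖ C} {P ⊖ lincomb c (six A₁ A₂ m)}
         (⊕-cong P P ((ℚ.- 1ℚ) · C) ((ℚ.- 1ℚ) · lincomb c (six A₁ A₂ m)) (λ _ → refl)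
           (·-cong (ℚ.- 1ℚ) C (lincomb c (six A₁ A₂ m)) (λ e → sym (lincomb≈scalarComb m A₁ A₂ c e)))) i
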